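{- Let $n = xy2^\alpha$, where $x,y\ge 1$ are odd integers and $\alpha\ge 1$ is an integer. Write the binary representation of $y$ as $y = 2^{i_1}+2^{i_2}+\cdots+2^{i_j}$ with $i_1>i_2>\cdots>i_j=0$. Then for every integer $q$ with $0\le q\le n-i_1-2xj$, the hypercube $Q_n$ has an edge decomposition into $x2^{i_1+\alpha+j-2+q}$ cycles, each of length $y2^{n-i_1-j-q+1}$.
   Context: $Q_n$ denotes the $n$-dimensional hypercube: its vertex set is $\{0,1\}^n$ and two vertices are adjacent iff they differ in exactly one coordinate. An edge decomposition of a graph $G$ into subgraphs $G_1,\dots,G_k$ means that $G_1,\dots,G_k$ are pairwise edge-disjoint and their union is $G$. The length of a cycle is its number of edges. -}

module Defs where

open import Data.Bool using (Bool; not)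
open import Data.Nat using (ℕ; zero; suc; _+_; _*_; _≤_; _<?_; s≤s)
open import Data.Fin using (Fin; fromℕ<; toℕ)
open import Data.Vec using (Vec; _[_]%=_)
open import Data.Product using (Σ; ∃; _×_; _,_)
open import Data.Sum using (_⊎_)
open import Relation.Nullary using (yes; no)
open import Relation.Binary.PropositionalEquality using (_≡_)
open import Function.Definitions using (Injective)

Odd : ℕ → Set
Odd x = ∃ λ k → x ≡ suc (2 * k)

Vertex : ℕ → Set
Vertex n = Vec Bool n

Adjacent : ∀ {n} → Vertex n → Vertex n → Set
Adjacent {n} u v = ∃ λ (i : Fin n) → v ≡ (u [ i ]%= not)

-- an edge of Q_n, given by its two endpoints (as an unordered pair)
record Edge (n : ℕ) : Set where
  constructor edge
  field
    end₁ end₂ : Vertex n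
    adjacent  : Adjacent end₁ end₂

SamePair : ∀ {n} → Vertex n → Vertex n → Vertex n → Vertex n → Set
SamePair a b c d = (a ≡ c × b ≡ d) ⊎ (a ≡ d × b ≡ c)

next : ∀ {L} → Fin L → Fin L
next {suc m} k with suc (toℕ k) <? suc m
... | yes p = fromℕ< p
... | no _  = Fin.zero

record Cycle (n L : ℕ) : Set where
  field
    vert     : Fin L → Vertex n
    len≥3    : 3 ≤ L
    distinct : Injective _≡_ _≡_ vert
    adj      : ∀ k → Adjacent (vert k) (vert (next k))

EdgeOf : ∀ {n L} → Edge n → Cycle n L → Set
EdgeOf {L = L} e C =
  ∃ λ (k : Fin L) → SamePair (Edge.end₁ e) (Edge.end₂ e) (Cycle.vert C k) (Cycle.vert C (next k))

IsCycleDecomposition : ∀ {n L m} → (Fin m → Cycle n L) → Set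
IsCycleDecomposition {n} {L} {m} C =
  ∀ (e : Edge n) →
    (∃ λ (c : Fin m) → EdgeOf e (C c)) ×
    (∀ (c c′ : Fin m) → EdgeOf e (C c) → EdgeOf e (C c′) → c ≡ c′)

HasCycleDecomposition : (n m L : ℕ) → Set
HasCycleDecomposition n m L = Σ (Fin m → Cycle n L) IsCycleDecomposition

-- A cycle P and an even cycle D span a torus P × D. If copies of D are kept only above some special vertices of P,
-- the torus still splits into cycles that follow P and climb in D at each special vertex (Kotzig). The cube Q_n is the
-- product of the cubes Q_d with d = x 2^(i+α), one for each binary digit 2^i of y. Multiplying by these factors in
-- turn, with a share of special vertices proportional to 2^i, adds 2^i to the odd part of the cycle length. Which
-- vertices are special for which cycle is decided by labels that are equidistributed along every cycle.
--
-- The factors are first decomposed into cycles of length a power of 2, starting from Hamiltonian decompositions of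
-- Q_{2m}. For these, Q_{2m} is the product of Q_{2⌈m/2⌉} and Q_{2⌊m/2⌋}, whose Hamiltonian cycles are paired up to
-- form tori; if m is odd, two cycles of the first factor have to share one cycle of the second. All decompositions are
-- only shown to cover every edge: disjointness follows at the end, because the number of edges is right.
module Submission where

open import Defs
open import Data.Bool as Bool using (Bool; true; false; not; _∧_; _xor_; if_then_else_)
open import Data.Empty using (⊥; ⊥-elim)
open import Data.Fin as Fin using (Fin; toℕ)
open import Data.Fin.Properties as Fin using (injective⇒≤; any?; punchOut-injective)
open import Data.List as List using (List; []; _∷_; _++_; lookup; length; map; last)
open import Data.List.Membership.Propositional using (_∈_)
open import Data.List.Membership.Propositional.Properties using (∈-++⁻)
open import Data.List.Relation.Unary.All as All using (All; []; _∷_)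
open import Data.List.Relation.Unary.AllPairs using ([]; _∷_)
open import Data.List.Relation.Unary.Any using (here; there; index)
open import Data.List.Relation.Unary.Any.Properties using (lookup-index)
open import Data.List.Relation.Unary.Unique.Propositional using (Unique)
open import Data.Maybe using (just)
open import Data.Nat as Nat using (ℕ; zero; suc; _+_; _*_; _∸_; _^_; _≤_; _<_; _>_; _⊓_; z≤n; s≤s; z<s; NonZero; >-nonZero; >-nonZero⁻¹)
open import Data.Nat.Properties
open import Data.Nat.ListAction using (sum)
open import Data.List.Relation.Unary.Linked using (Linked; []; _∷_)
open import Data.Product using (Σ; ∃; ∃₂; _×_; _,_; proj₁; proj₂)
open import Data.Unit using (⊤; tt)
open import Data.Vec as Vec using (Vec; []; _∷_; _[_]%=_)
import Data.Vec.Properties as Vec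
open import Data.Nat.Induction using (<-rec)
open import Data.Sum as Sum using (_⊎_; inj₁; inj₂)
open import Relation.Nullary using (yes; no; contradiction)
open import Relation.Binary.PropositionalEquality
open import Function using (_∘_; id; case_of_; _↔_; Inverse; mk↔ₛ′)
open import Function.Construct.Composition using (_↔-∘_)
open import Function.Construct.Identity using (↔-id)
open import Function.Construct.Symmetry using (↔-sym)
open import Data.Product.Function.NonDependent.Propositional using (_×-↔_)
open import Data.Bool.Properties using (∧-assoc; ∧-comm; ∧-identityʳ; ∧-zeroʳ; not-distribˡ-xor; not-distribʳ-xor; not-involutive; xor-identityʳ; xor-comm; not-¬; ¬-not)
open import Data.Nat.DivMod
open import Data.Nat.Divisibility using (divides; ∣1⇒≡1; ∣m+n∣m⇒∣n; n∣m*n)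
open import Data.Nat.Tactic.RingSolver using (solve-∀)
import Data.List.Relation.Unary.Unique.Propositional.Properties as Unique

-- Graphs and walks

-- A torus uses up one cycle of each factor, so both factors must be split into equally many
-- classes, each meeting every vertex, and only cycles of the same class are multiplied. Starts of
-- different parity give cycles in different classes: over a special vertex each level is reached
-- from starts of both parities, so each parity alone still meets everything that is special. A
-- product thus doubles the number of classes, while turning a label bit into a position halves it.
-- Throughout, r label bits go with x 2^(α-1) 2^r classes, and r = i is exactly the case in which
-- this agrees with the x 2^(i+α-1) Hamiltonian cycles of the factor for the digit 2^i. The bound on
-- q comes from the factors as well. The shortest cycles used in them are copies of the x
-- Hamiltonian cycles of Q_{2x}, of length 2^(2x), so a factor of dimension d has at most 2^(d-2x)
-- cycles per class. The first factor must in addition keep i₁ label bits. Adding up over the j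
-- factors leaves n - i₁ - 2xj for q.

record Graph : Set₁ where
  field
    V     : Set
    _~_   : V → V → Set
    ~-sym : ∀ {u v} → u ~ v → v ~ u

open Graph public using (V)

Adj : (Γ : Graph) → V Γ → V Γ → Set
Adj = Graph._~_

-- A walk lists its edges; `verts` omits the last endpoint, so that a closed walk lists every visit once.
data Walk (Γ : Graph) : V Γ → V Γ → Set where
  []  : ∀ {a} → Walk Γ a a
  _∷_ : ∀ {a b c} → Adj Γ a b → Walk Γ b c → Walk Γ a c

verts : ∀ {Γ a b} → Walk Γ a b → List (V Γ)
verts []              = []
verts (_∷_ {a} e w) = a ∷ verts w

len : ∀ {Γ a b} → Walk Γ a b → ℕ
len []      = 0
len (e ∷ w) = suc (len w)

data Step {Γ : Graph} : ∀ {a b} → Walk Γ a b → V Γ → V Γ → Set where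
  here  : ∀ {a b c} {e : Adj Γ a b} {w : Walk Γ b c} → Step (e ∷ w) a b
  there : ∀ {a b c u v} {e : Adj Γ a b} {w : Walk Γ b c} → Step w u v → Step (e ∷ w) u v

On : ∀ {Γ a b} → Walk Γ a b → V Γ → V Γ → Set
On w u v = Step w u v ⊎ Step w v u

On-sym : ∀ {Γ a b} {w : Walk Γ a b} {u v} → On w u v → On w v u
On-sym = Sum.swap

Visits : ∀ {Γ a b} → Walk Γ a b → V Γ → Set
Visits w u = ∃ λ v → Step w u v

infixr 5 _++ʷ_ _∷_

_++ʷ_ : ∀ {Γ a b c} → Walk Γ a b → Walk Γ b c → Walk Γ a c
[]      ++ʷ w′ = w′
(e ∷ w) ++ʷ w′ = e ∷ (w ++ʷ w′)

castʷ : ∀ {Γ} {a b c : V Γ} → b ≡ c → Walk Γ a b → Walk Γ a c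
castʷ refl w = w

rev : ∀ {Γ a b} → Walk Γ a b → Walk Γ b a
rev []              = []
rev {Γ} (e ∷ w) = rev w ++ʷ (Graph.~-sym Γ e ∷ [])

module _ {Γ : Graph} where

  step-++ˡ : ∀ {a b c u v} {w : Walk Γ a b} (w′ : Walk Γ b c) → Step w u v → Step (w ++ʷ w′) u v
  step-++ˡ w′ here      = here
  step-++ˡ w′ (there s) = there (step-++ˡ w′ s)

  step-++ʳ : ∀ {a b c u v} (w : Walk Γ a b) {w′ : Walk Γ b c} → Step w′ u v → Step (w ++ʷ w′) u v
  step-++ʳ []      s = s
  step-++ʳ (e ∷ w) s = there (step-++ʳ w s)

  step-cast : ∀ {a b c u v} (eq : b ≡ c) {w : Walk Γ a b} → Step w u v → Step (castʷ eq w) u v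
  step-cast refl s = s

  on-++ˡ : ∀ {a b c u v} {w : Walk Γ a b} (w′ : Walk Γ b c) → On w u v → On (w ++ʷ w′) u v
  on-++ˡ w′ = Sum.map (step-++ˡ w′) (step-++ˡ w′)

  on-++ʳ : ∀ {a b c u v} (w : Walk Γ a b) {w′ : Walk Γ b c} → On w′ u v → On (w ++ʷ w′) u v
  on-++ʳ w = Sum.map (step-++ʳ w) (step-++ʳ w)

  on-cast : ∀ {a b c u v} (eq : b ≡ c) {w : Walk Γ a b} → On w u v → On (castʷ eq w) u v
  on-cast refl o = o

  on-there : ∀ {a b c u v} {e : Adj Γ a b} {w : Walk Γ b c} → On w u v → On (e ∷ w) u v
  on-there = Sum.map there there

  step-rev : ∀ {a b u v} {w : Walk Γ a b} → Step w u v → Step (rev w) v u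
  step-rev {w = e ∷ w} here      = step-++ʳ (rev w) here
  step-rev {w = e ∷ w} (there s) = step-++ˡ _ (step-rev s)

  on-rev : ∀ {a b u v} {w : Walk Γ a b} → On w u v → On (rev w) u v
  on-rev (inj₁ s) = inj₂ (step-rev s)
  on-rev (inj₂ s) = inj₁ (step-rev s)

  verts-++ : ∀ {a b c} (w : Walk Γ a b) (w′ : Walk Γ b c) → verts (w ++ʷ w′) ≡ verts w ++ verts w′
  verts-++ []      w′ = refl
  verts-++ (e ∷ w) w′ = cong (_ ∷_) (verts-++ w w′)

  verts-cast : ∀ {a b c} (eq : b ≡ c) (w : Walk Γ a b) → verts (castʷ eq w) ≡ verts w
  verts-cast refl w = refl

  len-++ : ∀ {a b c} (w : Walk Γ a b) (w′ : Walk Γ b c) → len (w ++ʷ w′) ≡ len w + len w′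
  len-++ []      w′ = refl
  len-++ (e ∷ w) w′ = cong suc (len-++ w w′)

  len-cast : ∀ {a b c} (eq : b ≡ c) (w : Walk Γ a b) → len (castʷ eq w) ≡ len w
  len-cast refl w = refl

  len-rev : ∀ {a b} (w : Walk Γ a b) → len (rev w) ≡ len w
  len-rev []      = refl
  len-rev (e ∷ w) = trans (len-++ (rev w) _) (trans (+-comm _ 1) (cong suc (len-rev w)))

  length-verts : ∀ {a b} (w : Walk Γ a b) → length (verts w) ≡ len w
  length-verts []      = refl
  length-verts (e ∷ w) = cong suc (length-verts w)

  visits⇒∈ : ∀ {a b u} {w : Walk Γ a b} → Visits w u → u ∈ verts w
  visits⇒∈ (_ , here)    = here refl
  visits⇒∈ (_ , there s) = there (visits⇒∈ (_ , s))

  step-adj : ∀ {a b u v} {w : Walk Γ a b} → Step w u v → Adj Γ u v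
  step-adj {w = e ∷ w} here = e
  step-adj (there s)        = step-adj s

  step-target : ∀ {a b u v} {w : Walk Γ a b} → Step w u v → Visits w v ⊎ v ≡ b
  step-target {w = e ∷ []}      here = inj₂ refl
  step-target {w = e ∷ e′ ∷ w} here = inj₁ (_ , there here)
  step-target (there s) with step-target s
  ... | inj₁ (_ , s′) = inj₁ (_ , there s′)
  ... | inj₂ eq       = inj₂ eq

  visits-base : ∀ {a b u v} {w : Walk Γ a b} → Step w u v → Visits w a
  visits-base {w = e ∷ w} _ = _ , here

  on-visits : ∀ {a u v} {w : Walk Γ a a} → On w u v → Visits w u
  on-visits (inj₁ s) = _ , s
  on-visits (inj₂ s) with step-target s
  ... | inj₁ vis  = vis
  ... | inj₂ refl = visits-base s

  at : ∀ {a b} → Walk Γ a b → ℕ → V Γ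
  at {a} []      n       = a
  at {a} (e ∷ w) zero    = a
  at     (e ∷ w) (suc n) = at w n

  at-0 : ∀ {a b} (w : Walk Γ a b) → at w 0 ≡ a
  at-0 []      = refl
  at-0 (e ∷ w) = refl

  at-len : ∀ {a b} (w : Walk Γ a b) → at w (len w) ≡ b
  at-len []      = refl
  at-len (e ∷ w) = at-len w

  at-step : ∀ {a b} (w : Walk Γ a b) {n} → n < len w → Step w (at w n) (at w (suc n))
  at-step (_∷_ {a} {b} e w) {zero} _ = subst (Step (e ∷ w) a) (sym (at-0 w)) here
  at-step (e ∷ w) {suc n} (s≤s n<) = there (at-step w n<)

  step-at : ∀ {a b u v} {w : Walk Γ a b} → Step w u v →
            ∃ λ n → n < len w × at w n ≡ u × at w (suc n) ≡ v
  step-at {w = e ∷ w} here = 0 , s≤s z≤n , refl , at-0 w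
  step-at (there s) with step-at s
  ... | n , n< , p , q = suc n , s≤s n< , p , q

  at-∈ : ∀ {a b} (w : Walk Γ a b) {n} → n < len w → at w n ∈ verts w
  at-∈ (e ∷ w) {zero}  _         = here refl
  at-∈ (e ∷ w) {suc n} (s≤s n<) = there (at-∈ w n<)

  at-injective : ∀ {a b} (w : Walk Γ a b) → Unique (verts w) → ∀ {i j} →
                 i < len w → j < len w → at w i ≡ at w j → i ≡ j
  at-injective (e ∷ w) (x∉ ∷ u) {zero}  {zero}  _ _ _ = refl
  at-injective (e ∷ w) (x∉ ∷ u) {zero}  {suc j} _ (s≤s j<) eq =
    contradiction eq (All.lookup x∉ (at-∈ w j<))
  at-injective (e ∷ w) (x∉ ∷ u) {suc i} {zero}  (s≤s i<) _ eq =
    contradiction (sym eq) (All.lookup x∉ (at-∈ w i<))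
  at-injective (e ∷ w) (x∉ ∷ u) {suc i} {suc j} (s≤s i<) (s≤s j<) eq =
    cong suc (at-injective w u i< j< eq)

  splitStep : ∀ {a b u v} {w : Walk Γ a b} → Step w u v → Walk Γ a u × Walk Γ v b
  splitStep {w = e ∷ w} here = [] , w
  splitStep {w = e ∷ w} (there s) = e ∷ proj₁ (splitStep s) , proj₂ (splitStep s)

-- Counting in lists and the pigeonhole principle

cnt : {A : Set} → (A → Bool) → List A → ℕ
cnt p []       = 0
cnt p (x ∷ xs) = (if p x then 1 else 0) + cnt p xs

module _ {A : Set} where

  cnt-++ : ∀ (p : A → Bool) xs ys → cnt p (xs ++ ys) ≡ cnt p xs + cnt p ys
  cnt-++ p []       ys = refl
  cnt-++ p (x ∷ xs) ys = trans (cong ((if p x then 1 else 0) +_) (cnt-++ p xs ys))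
                               (sym (+-assoc (if p x then 1 else 0) _ _))

  cnt-cong : ∀ {p q : A → Bool} → (∀ x → p x ≡ q x) → ∀ xs → cnt p xs ≡ cnt q xs
  cnt-cong eq []       = refl
  cnt-cong eq (x ∷ xs) = cong₂ (λ b n → (if b then 1 else 0) + n) (eq x) (cnt-cong eq xs)

  cnt-all : ∀ {p : A → Bool} → (∀ x → p x ≡ true) → ∀ xs → cnt p xs ≡ length xs
  cnt-all eq []       = refl
  cnt-all eq (x ∷ xs) rewrite eq x = cong suc (cnt-all eq xs)

  cnt-none : ∀ {p : A → Bool} xs → (∀ {x} → x ∈ xs → p x ≡ false) → cnt p xs ≡ 0
  cnt-none []       eq = refl
  cnt-none (x ∷ xs) eq rewrite eq (here refl) = cnt-none xs (eq ∘ there)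

  cnt-map : ∀ {B : Set} (p : B → Bool) (f : A → B) xs → cnt p (map f xs) ≡ cnt (p ∘ f) xs
  cnt-map p f []       = refl
  cnt-map p f (x ∷ xs) = cong ((if p (f x) then 1 else 0) +_) (cnt-map p f xs)

injective⇒surjective : ∀ {n} {g : Fin n → Fin n} → (∀ {i j} → g i ≡ g j → i ≡ j) → ∀ x → ∃ λ i → g i ≡ x
injective⇒surjective {suc n} {g} g-inj x with any? (λ i → g i Fin.≟ x)
... | yes hit = hit
... | no miss = contradiction
  (injective⇒≤ (λ {i} {j} eq → g-inj (punchOut-injective (λ e → miss (i , sym e)) (λ e → miss (j , sym e)) eq)))
  1+n≰n

-- A section `g` of `f` is injective, hence onto by the pigeonhole principle, hence a two-sided
-- inverse.
surjective⇒injective : ∀ {n} {f : Fin n → Fin n} → (∀ y → ∃ λ x → f x ≡ y) →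
                       ∀ {x y} → f x ≡ f y → x ≡ y
surjective⇒injective {n} {f} sur {x} {y} eq =
  trans (sym (g∘f x)) (trans (cong g eq) (g∘f y))
  where
  g : Fin n → Fin n
  g z = proj₁ (sur z)
  f∘g : ∀ z → f (g z) ≡ z
  f∘g z = proj₂ (sur z)
  g∘f : ∀ z → g (f z) ≡ z
  g∘f z with injective⇒surjective {g = g} (λ {i} {j} e → trans (sym (f∘g i)) (trans (cong f e) (f∘g j))) z
  ... | i , refl = cong g (f∘g i)

lookup-injective⇒unique : {A : Set} (xs : List A) → (∀ {i j} → lookup xs i ≡ lookup xs j → i ≡ j) → Unique xs
lookup-injective⇒unique []       inj = []
lookup-injective⇒unique (x ∷ xs) inj =
  All.tabulate (λ y∈ eq → case inj {Fin.zero} {Fin.suc (index y∈)} (trans eq (lookup-index y∈)) of λ ())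
  ∷ lookup-injective⇒unique xs (Fin.suc-injective ∘ inj)

-- A list as long as the set that it exhausts has no room for a repetition. The three gadget cycles
-- get their distinctness this way, without any comparison of their pieces.
covering⇒unique : {A : Set} {N : ℕ} → A ↔ Fin N → (xs : List A) → length xs ≡ N →
                  (∀ x → x ∈ xs) → Unique xs
covering⇒unique {A} A↔N xs refl all∈ = lookup-injective⇒unique xs λ {i} {j} eq →
  surjective⇒injective {f = to ∘ lookup xs} sur (cong to eq)
  where
  open Inverse A↔N using (to; from; strictlyInverseˡ)
  sur : ∀ y → ∃ λ i → to (lookup xs i) ≡ y
  sur y = index (all∈ (from y)) , trans (cong to (sym (lookup-index (all∈ (from y))))) (strictlyInverseˡ y)

-- Cartesian products of graphs and unrolled cycles

data Prod {A B : Set} (R : A → A → Set) (S : B → B → Set) : A × B → A × B → Set where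
  along₁ : ∀ {u v w} → R u v → Prod R S (u , w) (v , w)
  along₂ : ∀ {u v w} → S v w → Prod R S (u , v) (u , w)

infixr 4 _⊠_

_⊠_ : Graph → Graph → Graph
Γ ⊠ Δ = record
  { V     = V Γ × V Δ
  ; _~_   = Prod (Adj Γ) (Adj Δ)
  ; ~-sym = λ { (along₁ e) → along₁ (Graph.~-sym Γ e) ; (along₂ e) → along₂ (Graph.~-sym Δ e) }
  }

module _ {Γ Δ : Graph} where

  copyˡ : ∀ {u v} → Walk Γ u v → ∀ d → Walk (Γ ⊠ Δ) (u , d) (v , d)
  copyˡ []      d = []
  copyˡ (e ∷ w) d = along₁ e ∷ copyˡ w d

  step-copyˡ : ∀ {u v x y d} {w : Walk Γ u v} → Step w x y → Step (copyˡ w d) (x , d) (y , d)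
  step-copyˡ here      = here
  step-copyˡ (there s) = there (step-copyˡ s)

  len-copyˡ : ∀ {u v} (w : Walk Γ u v) d → len (copyˡ w d) ≡ len w
  len-copyˡ []      d = refl
  len-copyˡ (e ∷ w) d = cong suc (len-copyˡ w d)

  verts-copyˡ : ∀ {u v} (w : Walk Γ u v) d → verts (copyˡ w d) ≡ map (_, d) (verts w)
  verts-copyˡ []      d = refl
  verts-copyˡ (e ∷ w) d = cong (_ ∷_) (verts-copyˡ w d)

record _≅_ (Γ Δ : Graph) : Set where
  field
    to      : V Γ → V Δ
    from    : V Δ → V Γ
    to∘from : ∀ x → to (from x) ≡ x
    from∘to : ∀ x → from (to x) ≡ x
    to-~    : ∀ {x y} → Adj Γ x y → Adj Δ (to x) (to y)
    from-~  : ∀ {x y} → Adj Δ x y → Adj Γ (from x) (from y)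

⊠-swap : ∀ {Γ Δ} → (Γ ⊠ Δ) ≅ (Δ ⊠ Γ)
⊠-swap = record
  { to = λ (u , d) → d , u ; from = λ (d , u) → u , d ; to∘from = λ _ → refl ; from∘to = λ _ → refl
  ; to-~ = λ { (along₁ e) → along₂ e ; (along₂ e) → along₁ e }
  ; from-~ = λ { (along₁ e) → along₂ e ; (along₂ e) → along₁ e }
  }

-- A cycle of length c, unrolled to a periodic function; inj says that equal values have arguments congruent modulo c.
record Cyc (Γ : Graph) (c : ℕ) : Set where
  field
    D      : ℕ → V Γ
    step   : ∀ n → Adj Γ (D n) (D (suc n))
    period : ∀ n → D (c + n) ≡ D n
    inj    : ∀ {m n} → D m ≡ D n → ∃₂ λ i j → m + i * c ≡ n + j * c

  periods : ∀ k n → D (k * c + n) ≡ D n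
  periods zero    n = refl
  periods (suc k) n = trans (cong D (+-assoc c (k * c) n)) (trans (period (k * c + n)) (periods k n))

suc-% : ∀ n c .{{_ : NonZero c}} → (suc n % c ≡ suc (n % c)) ⊎ (suc (n % c) ≡ c × suc n % c ≡ 0)
suc-% n c with suc (n % c) <? c
... | yes p = inj₁ (trans (trans (cong (λ z → suc z % c) (m≡m%n+[m/n]*n n c)) ([m+kn]%n≡m%n (suc (n % c)) (n / c) c)) (m<n⇒m%n≡m p))
... | no ¬p = inj₂ (full , trans (trans (cong (λ z → suc z % c) (m≡m%n+[m/n]*n n c)) ([m+kn]%n≡m%n (suc (n % c)) (n / c) c)) (trans (cong (_% c) full) (n%n≡0 c)))
  where
  full : suc (n % c) ≡ c
  full = ≤-antisym (m%n<n n c) (≮⇒≥ ¬p)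

module Unroll {Γ : Graph} {a : V Γ} (w : Walk Γ a a) (u : Unique (verts w)) {c : ℕ} .{{_ : NonZero c}}
  (len≡ : len w ≡ c) where

  private
    D : ℕ → V Γ
    D n = at w (n % c)

    <len : ∀ n → n % c < len w
    <len n = <-≤-trans (m%n<n n c) (≤-reflexive (sym len≡))

    wrap : ∀ n → at w (suc n % c) ≡ at w (suc (n % c))
    wrap n with suc-% n c
    ... | inj₁ eq = cong (at w) eq
    -- After the last position the index jumps to 0, while `at` reports the endpoint of the walk;
    -- the two agree because the walk is closed.
    ... | inj₂ (full , eq) = begin
      at w (suc n % c)    ≡⟨ cong (at w) eq ⟩
      at w 0              ≡⟨ at-0 w ⟩
      a                   ≡⟨ at-len w ⟨
      at w (len w)        ≡⟨ cong (at w) (trans len≡ (sym full)) ⟩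
      at w (suc (n % c))  ∎
      where open ≡-Reasoning

    step′ : ∀ n → Step w (D n) (D (suc n))
    step′ n = subst (Step w (D n)) (sym (wrap n)) (at-step w (<len n))

  cyc : Cyc Γ c
  cyc = record
    { D = D
    ; step = λ n → step-adj (step′ n)
    ; period = λ n → cong (at w) (trans (cong (_% c) (+-comm c n)) ([m+n]%n≡m%n n c))
    -- The quotients are exchanged: m and n have the same remainder, so adding to each the multiple
    -- of c contained in the other gives equal sums.
    ; inj = λ {m} {n} eq → n / c , m / c ,
        (let r≡ = at-injective w u (<len m) (<len n) eq in begin
          m + n / c * c                  ≡⟨ cong (_+ n / c * c) (m≡m%n+[m/n]*n m c) ⟩
          m % c + m / c * c + n / c * c  ≡⟨ cong (λ r → r + m / c * c + n / c * c) r≡ ⟩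
          n % c + m / c * c + n / c * c  ≡⟨ swap (n % c) (m / c * c) (n / c * c) ⟩
          n % c + n / c * c + m / c * c  ≡⟨ cong (_+ m / c * c) (m≡m%n+[m/n]*n n c) ⟨
          n + m / c * c                  ∎)
    }
    where
    open ≡-Reasoning
    swap : ∀ x y z → x + y + z ≡ x + z + y
    swap = solve-∀

  open Cyc cyc using () renaming (D to D̂)

  step-cyc : ∀ {x y} → Step w x y → ∃ λ n → D̂ n ≡ x × D̂ (suc n) ≡ y
  step-cyc s with step-at s
  ... | n , n< , p , q = n , D≡ , trans (wrap n) (trans (cong (at w ∘ suc) (m<n⇒m%n≡m n<c)) q)
    where
    n<c : n < c
    n<c = <-≤-trans n< (≤-reflexive len≡)
    D≡ = trans (cong (at w) (m<n⇒m%n≡m n<c)) p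

-- Kotzig's torus decomposition

-- The level profile of a traversal: after k vertical moves it is at level off m k, which oscillates
-- between 0 and 1 for the first 2m moves and climbs from then on.
off : ℕ → ℕ → ℕ
off m       zero          = zero
off zero    (suc k)       = suc k
off (suc m) (suc zero)    = 1
off (suc m) (suc (suc k)) = off m k

off-step : ∀ m k → off m (suc k) ≡ suc (off m k) ⊎ off m k ≡ suc (off m (suc k))
off-step zero    zero          = inj₁ refl
off-step zero    (suc k)       = inj₁ refl
off-step (suc m) zero          = inj₁ refl
off-step (suc m) (suc zero)    = inj₂ refl
off-step (suc m) (suc (suc k)) = off-step m k

off-end : ∀ m t → off m (m * 2 + t) ≡ t
off-end zero    zero    = refl
off-end zero    (suc t) = refl
off-end (suc m) t       = off-end m t

∑< : ℕ → (ℕ → ℕ) → ℕ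
∑< zero    f = 0
∑< (suc n) f = f n + ∑< n f

∑-cong : ∀ n {f g : ℕ → ℕ} → (∀ i → f i ≡ g i) → ∑< n f ≡ ∑< n g
∑-cong zero    eq = refl
∑-cong (suc n) eq = cong₂ _+_ (eq n) (∑-cong n eq)

∑-+ : ∀ n (f g : ℕ → ℕ) → ∑< n (λ i → f i + g i) ≡ ∑< n f + ∑< n g
∑-+ zero    f g = refl
∑-+ (suc n) f g = trans (cong (f n + g n +_) (∑-+ n f g)) (shuffle (f n) (g n) (∑< n f) (∑< n g))
  where
  shuffle : ∀ a b c d → a + b + (c + d) ≡ a + c + (b + d)
  shuffle = solve-∀

∑-const : ∀ n k → ∑< n (λ _ → k) ≡ n * k
∑-const zero    k = refl
∑-const (suc n) k = cong (k +_) (∑-const n k)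

-- The Kotzig decomposition of the torus P × D in which only the special vertices of P carry copies of D.
-- Block p is one round trip along P starting at level p; A ε strings together the blocks ε, ε + t, ε + 2t, …
module Torus (Γ : Graph) {Δ : Graph} {c : ℕ} (cyc : Cyc Δ c) (sp : V Γ → Bool) (m : ℕ) where

  open Cyc cyc

  ctr : List (V Γ) → ℕ → ℕ
  ctr []       k = k
  ctr (u ∷ us) k = ctr us (if sp u then suc k else k)

  ctr≡ : ∀ us k → ctr us k ≡ cnt sp us + k
  ctr≡ []       k = refl
  ctr≡ (u ∷ us) k with sp u
  ... | true  = trans (ctr≡ us (suc k)) (+-suc _ k)
  ... | false = ctr≡ us k

  lev : ℕ → ℕ → V Δ
  lev k p = D (off m k + p)

  rise : ∀ u k p → Prod (Adj Γ) (Adj Δ) (u , lev k p) (u , lev (suc k) p)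
  rise u k p with off-step m k
  ... | inj₁ eq = along₂ (subst (λ l → Adj Δ (lev k p) (D (l + p))) (sym eq) (step _))
  ... | inj₂ eq = along₂ (subst (λ l → Adj Δ (D (l + p)) (lev (suc k) p)) (sym eq) (Graph.~-sym Δ (step _)))

  run : ∀ {u v} (w : Walk Γ u v) k p → Walk (Γ ⊠ Δ) (u , lev k p) (v , lev (ctr (verts w) k) p)
  run []              k p = []
  run (_∷_ {u} e w) k p with sp u
  ... | true  = rise u k p ∷ along₁ e ∷ run w (suc k) p
  ... | false = along₁ e ∷ run w k p

  len-run : ∀ {u v} (w : Walk Γ u v) k p → len (run w k p) ≡ cnt sp (verts w) + len w
  len-run []            k p = refl
  len-run (_∷_ {u} e w) k p with sp u
  ... | true  = cong suc (trans (cong suc (len-run w (suc k) p)) (sym (+-suc _ _)))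
  ... | false = trans (cong suc (len-run w k p)) (sym (+-suc _ _))

  -- The offset is found before the level p is given: runs from different levels are vertical
  -- translates of each other, so one offset serves all blocks of all cycles.
  run-along : ∀ {u v x y} {w : Walk Γ u v} → Step w x y → ∀ k →
              ∃ λ o → ∀ p → Step (run w k p) (x , D (o + p)) (y , D (o + p))
  run-along {u} {w = e ∷ w} here k with sp u
  ... | true  = off m (suc k) , λ p → there here
  ... | false = off m k , λ p → here
  run-along {u} {w = e ∷ w} (there s) k with sp u
  ... | true  = let o , f = run-along s (suc k) in o , λ p → there (there (f p))
  ... | false = let o , f = run-along s k in o , λ p → there (f p)

  run-rise : ∀ {u v x y} {w : Walk Γ u v} → Step w x y → sp x ≡ true → ∀ k →
             ∃ λ l → ∀ p → Step (run w k p) (x , lev l p) (x , lev (suc l) p) ×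
                           Step (run w k p) (x , lev (suc l) p) (y , lev (suc l) p)
  run-rise {w = e ∷ w} here eq k rewrite eq = k , λ p → here , there here
  run-rise {u} {w = e ∷ w} (there s) eq k with sp u
  ... | true  = let l , f = run-rise s eq (suc k) in l , λ p → there (there (proj₁ (f p))) , there (there (proj₂ (f p)))
  ... | false = let l , f = run-rise s eq k in l , λ p → there (proj₁ (f p)) , there (proj₂ (f p))

  run-proj : ∀ {u v x d} (w : Walk Γ u v) k p → (x , d) ∈ verts (run w k p) → x ∈ verts w
  run-proj (_∷_ {u} e w) k p x∈ with sp u
  run-proj (e ∷ w) k p (here refl)         | true  = here refl
  run-proj (e ∷ w) k p (there (here refl)) | true  = here refl
  run-proj (e ∷ w) k p (there (there x∈))  | true  = there (run-proj w (suc k) p x∈)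
  run-proj (e ∷ w) k p (here refl)         | false = here refl
  run-proj (e ∷ w) k p (there x∈)          | false = there (run-proj w k p x∈)

  -- A block lists a special vertex twice, before and after its vertical move, at two consecutive
  -- levels. Hence each special vertex with property `f` contributes the sum in the hypothesis,
  -- whatever its offset.
  count-run : ∀ (f : V Γ → Bool) (g : V Δ → Bool) R t {γ} →
              (∀ a → ∑< R (λ r → (if g (D (r * t + a)) then 1 else 0) + (if g (D (r * t + suc a)) then 1 else 0)) ≡ γ) →
              ∀ ε {u v} (w : Walk Γ u v) k →
              ∑< R (λ r → cnt (λ x → (sp (proj₁ x) ∧ f (proj₁ x)) ∧ g (proj₂ x)) (verts (run w k (r * t + ε))))
              ≡ cnt (λ x → sp x ∧ f x) (verts w) * γ
  count-run f g R t hγ ε [] k = trans (∑-const R 0) (*-zeroʳ R)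
  count-run f g R t {γ} hγ ε (_∷_ {u} e w) k with sp u in eq
  ... | false rewrite eq = count-run f g R t hγ ε w k
  ... | true rewrite eq with f u
  ...   | false = count-run f g R t hγ ε w (suc k)
  ...   | true = begin
    ∑< R (λ r → χ (lev k (r * t + ε)) + (χ (lev (suc k) (r * t + ε)) + rest r))
      ≡⟨ ∑-cong R (λ r → sym (+-assoc (χ (lev k (r * t + ε))) _ _)) ⟩
    ∑< R (λ r → (χ (lev k (r * t + ε)) + χ (lev (suc k) (r * t + ε))) + rest r)
      ≡⟨ ∑-+ R _ rest ⟩
    ∑< R (λ r → χ (lev k (r * t + ε)) + χ (lev (suc k) (r * t + ε))) + ∑< R rest
      ≡⟨ cong₂ _+_ here-γ (count-run f g R t hγ ε w (suc k)) ⟩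
    γ + cnt (λ x → sp x ∧ f x) (verts w) * γ ∎
    where
    open ≡-Reasoning
    χ : V Δ → ℕ
    χ d = if g d then 1 else 0
    rest : ℕ → ℕ
    rest r = cnt (λ x → (sp (proj₁ x) ∧ f (proj₁ x)) ∧ g (proj₂ x)) (verts (run w (suc k) (r * t + ε)))
    shift : ∀ o z → o + (z + ε) ≡ z + (o + ε)
    shift o z = trans (sym (+-assoc o z ε)) (trans (cong (_+ ε) (+-comm o z)) (+-assoc z o ε))
    here-γ : ∑< R (λ r → χ (lev k (r * t + ε)) + χ (lev (suc k) (r * t + ε))) ≡ γ
    here-γ with off-step m k
    ... | inj₁ up = trans (∑-cong R λ r → cong₂ (λ a b → χ (D a) + χ (D b))
                      (shift (off m k) (r * t))
                      (trans (cong (_+ (r * t + ε)) up) (shift (suc (off m k)) (r * t)))) (hγ (off m k + ε))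
    -- A descending move lists the same two consecutive levels in the opposite order.
    ... | inj₂ dn = trans (∑-cong R λ r → trans (+-comm (χ (lev k (r * t + ε))) _) (cong₂ (λ a b → χ (D a) + χ (D b))
                      (shift (off m (suc k)) (r * t))
                      (trans (cong (_+ (r * t + ε)) dn) (shift (suc (off m (suc k))) (r * t))))) (hγ (off m (suc k) + ε))

odd : ℕ → Bool
odd zero    = false
odd (suc n) = not (odd n)

odd-+ : ∀ m n → odd (m + n) ≡ odd m xor odd n
odd-+ zero    n = refl
odd-+ (suc m) n = trans (cong not (odd-+ m n)) (not-distribˡ-xor (odd m) (odd n))

odd-double : ∀ k → odd (k * 2) ≡ false
odd-double zero    = refl
odd-double (suc k) = cong (not ∘ not) (odd-double k)

odd-*2 : ∀ m n → odd (m * (n * 2)) ≡ false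
odd-*2 m n = trans (cong odd (sym (*-assoc m n 2))) (odd-double (m * n))

module Kotzig {Γ Δ : Graph} {a : V Γ} (P : Walk Γ a a) (sp : V Γ → Bool) (m R t : ℕ)
  (cyc : Cyc Δ (R * t)) (special≡ : cnt sp (verts P) ≡ m * 2 + t) where

  open Cyc cyc
  open Torus Γ cyc sp m

  top : ∀ p → lev (ctr (verts P) 0) p ≡ D (t + p)
  top p = cong (λ l → D (l + p)) (begin
    off m (ctr (verts P) 0)      ≡⟨ cong (off m) (trans (ctr≡ (verts P) 0) (+-identityʳ _)) ⟩
    off m (cnt sp (verts P))     ≡⟨ cong (off m) special≡ ⟩
    off m (m * 2 + t)            ≡⟨ off-end m t ⟩
    t                            ∎)
    where open ≡-Reasoning

  ascent : ∀ n p → _≡_ {A = V (Γ ⊠ Δ)} (a , lev (ctr (verts P) 0) (n * t + p)) (a , D (suc n * t + p))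
  ascent n p = cong (a ,_) (trans (top (n * t + p)) (cong D (sym (+-assoc t (n * t) p))))

  blocks : ∀ n p → Walk (Γ ⊠ Δ) (a , D p) (a , D (n * t + p))
  blocks zero    p = []
  blocks (suc n) p = blocks n p ++ʷ castʷ (ascent n p) (run P 0 (n * t + p))

  closing : ∀ p → _≡_ {A = V (Γ ⊠ Δ)} (a , D (R * t + p)) (a , D p)
  closing p = cong (a ,_) (period p)

  A : ∀ p → Walk (Γ ⊠ Δ) (a , D p) (a , D p)
  A p = castʷ (closing p) (blocks R p)

  blocks-step : ∀ {n r p x y} → r < n → Step (run P 0 (r * t + p)) x y → Step (blocks n p) x y
  blocks-step {suc n} {r} {p} r< s with m≤n⇒m<n∨m≡n (≤-pred r<)
  ... | inj₁ r<n  = step-++ˡ _ (blocks-step r<n s)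
  ... | inj₂ refl = step-++ʳ (blocks n p) (step-cast (ascent n p) s)

  A-step : ∀ {r p x y} → r < R → Step (run P 0 (r * t + p)) x y → Step (A p) x y
  A-step {p = p} r< s = step-cast (closing p) (blocks-step r< s)

  blocks-len : ∀ n p → len (blocks n p) ≡ n * (cnt sp (verts P) + len P)
  blocks-len zero    p = refl
  blocks-len (suc n) p = begin
    len (blocks n p ++ʷ castʷ (ascent n p) (run P 0 (n * t + p)))  ≡⟨ len-++ (blocks n p) _ ⟩
    len (blocks n p) + len (castʷ (ascent n p) (run P 0 (n * t + p)))
      ≡⟨ cong₂ _+_ (blocks-len n p) (trans (len-cast (ascent n p) _) (len-run P 0 _)) ⟩
    n * (cnt sp (verts P) + len P) + (cnt sp (verts P) + len P) ≡⟨ +-comm (n * (cnt sp (verts P) + len P)) _ ⟩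
    suc n * (cnt sp (verts P) + len P) ∎
    where open ≡-Reasoning

  A-len : ∀ p → len (A p) ≡ R * (cnt sp (verts P) + len P)
  A-len p = trans (len-cast (closing p) _) (blocks-len R p)

  blocks-count : ∀ (q : V (Γ ⊠ Δ) → Bool) n p →
                 cnt q (verts (blocks n p)) ≡ ∑< n (λ r → cnt q (verts (run P 0 (r * t + p))))
  blocks-count q zero    p = refl
  blocks-count q (suc n) p = begin
    cnt q (verts (blocks n p ++ʷ castʷ (ascent n p) (run P 0 (n * t + p))))
      ≡⟨ cong (cnt q) (trans (verts-++ (blocks n p) _) (cong (verts (blocks n p) ++_) (verts-cast (ascent n p) _))) ⟩
    cnt q (verts (blocks n p) ++ verts (run P 0 (n * t + p)))  ≡⟨ cnt-++ q (verts (blocks n p)) _ ⟩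
    cnt q (verts (blocks n p)) + cnt q (verts (run P 0 (n * t + p)))
      ≡⟨ +-comm (cnt q (verts (blocks n p))) _ ⟩
    cnt q (verts (run P 0 (n * t + p))) + cnt q (verts (blocks n p))
      ≡⟨ cong (cnt q (verts (run P 0 (n * t + p))) +_) (blocks-count q n p) ⟩
    ∑< (suc n) (λ r → cnt q (verts (run P 0 (r * t + p)))) ∎
    where open ≡-Reasoning

  A-count : ∀ (f : V Γ → Bool) (g : V Δ → Bool) {γ} →
            (∀ a → ∑< R (λ r → (if g (D (r * t + a)) then 1 else 0) + (if g (D (r * t + suc a)) then 1 else 0)) ≡ γ) →
            ∀ p → cnt (λ x → (sp (proj₁ x) ∧ f (proj₁ x)) ∧ g (proj₂ x)) (verts (A p)) ≡ cnt (λ x → sp x ∧ f x) (verts P) * γ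
  A-count f g hγ p =
    trans (cong (cnt _) (verts-cast (closing p) _))
      (trans (blocks-count _ R p) (count-run f g R t hγ p P 0))

  module _ (2≤t : 2 ≤ t) where

    private instance
      t≢0 : NonZero t
      t≢0 = >-nonZero (≤-trans (s≤s z≤n) 2≤t)

    -- The two visits of a block to a special vertex lie on consecutive levels. Two blocks of one
    -- cycle can therefore meet only if a multiple of t equals 0 or 1.
    Near : ℕ → ℕ → Set
    Near k l = off m k ≡ off m l ⊎ off m k ≡ suc (off m l) ⊎ off m l ≡ suc (off m k)

    near-suc : ∀ k → Near (suc k) k
    near-suc k = inj₂ (off-step m k)

    near-suc′ : ∀ k → Near k (suc k)
    near-suc′ k = inj₂ (Sum.swap (off-step m k))

    private
      regroup : ∀ o r p i → o + (r * t + p) + i * (R * t) ≡ (o + (r + i * R) * t) + p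
      regroup o r p i = begin
        o + (r * t + p) + i * (R * t) ≡⟨ cong (o + (r * t + p) +_) (sym (*-assoc i R t)) ⟩
        o + (r * t + p) + i * R * t   ≡⟨ lemma o (r * t) p (i * R * t) ⟩
        (o + (r * t + i * R * t)) + p ≡⟨ cong (λ z → (o + z) + p) (sym (*-distribʳ-+ t r (i * R))) ⟩
        (o + (r + i * R) * t) + p     ∎
        where
        open ≡-Reasoning
        lemma : ∀ o x p y → o + (x + p) + y ≡ (o + (x + y)) + p
        lemma = solve-∀

      -- Here t must be at least 2: for t = 1 the upper end of a vertical move in one block would be
      -- the lower end of the same move in the next block.
      t∤1 : ∀ X Y → suc (X * t) ≡ Y * t → ⊥
      t∤1 X Y eq = <⇒≢ 2≤t (sym (∣1⇒≡1 (∣m+n∣m⇒∣n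
        (divides Y (trans (+-comm (X * t) 1) eq)) (n∣m*n X))))

    clash : ∀ {k l r r′} p → Near k l → r < R → r′ < R →
            lev k (r * t + p) ≡ lev l (r′ * t + p) → r ≡ r′
    clash {k} {l} {r} {r′} p nr r< r′< eq with inj eq
    ... | i , j , e = go nr (+-cancelʳ-≡ p _ _ (trans (sym (regroup (off m k) r p i)) (trans e (regroup (off m l) r′ p j))))
      where
      instance
        R≢0 : NonZero R
        R≢0 = >-nonZero (≤-trans (s≤s z≤n) r<)
      go : Near k l → off m k + (r + i * R) * t ≡ off m l + (r′ + j * R) * t → r ≡ r′
      go (inj₁ same) e′ = trans (sym (m<n⇒m%n≡m r<)) (trans (sym ([m+kn]%n≡m%n r i R))
        (trans (cong (_% R) q) (trans ([m+kn]%n≡m%n r′ j R) (m<n⇒m%n≡m r′<))))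
        where
        q : r + i * R ≡ r′ + j * R
        q = *-cancelʳ-≡ _ _ t (+-cancelˡ-≡ (off m l) _ _ (trans (cong (_+ (r + i * R) * t) (sym same)) e′))
      go (inj₂ (inj₁ dn)) e′ = ⊥-elim (t∤1 (r + i * R) (r′ + j * R)
        (+-cancelˡ-≡ (off m l) _ _ (trans (+-suc (off m l) _) (trans (cong (_+ (r + i * R) * t) (sym dn)) e′))))
      go (inj₂ (inj₂ u)) e′ = ⊥-elim (t∤1 (r′ + j * R) (r + i * R)
        (+-cancelˡ-≡ (off m k) _ _ (trans (+-suc (off m k) _) (trans (cong (_+ (r′ + j * R) * t) (sym u)) (sym e′)))))

    rise≢ : ∀ k p → 0 < R → lev k p ≢ lev (suc k) p
    rise≢ k p 0<R eq with inj eq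
    ... | i , j , e with off-step m k
    ...   | inj₁ u = t∤1 (j * R) (i * R) (sym (+-cancelˡ-≡ (off m k + p) _ _ (trans (cong (off m k + p +_) (*-assoc i R t)) (trans e
                       (trans (cong₂ (λ x y → x + p + y) u (sym (*-assoc j R t))) (sym (+-suc (off m k + p) _)))))))
    ...   | inj₂ u = t∤1 (i * R) (j * R) (+-cancelˡ-≡ (off m (suc k) + p) _ _ (trans (trans (+-suc _ _)
                       (cong₂ (λ x y → x + p + y) (sym u) (*-assoc i R t))) (trans e (cong (off m (suc k) + p +_) (sym (*-assoc j R t))))))

    fresh : ∀ {u v x d} (w : Walk Γ u v) k p → All (x ≢_) (verts w) → (x , d) ∈ verts (run w k p) → ⊥
    fresh w k p x∉ x∈ = All.lookup x∉ (run-proj w k p x∈) refl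

    run-disjoint : ∀ {u v x} (w : Walk Γ u v) → Unique (verts w) → ∀ k {r r′} p → r < R → r′ < R →
                   x ∈ verts (run w k (r * t + p)) → x ∈ verts (run w k (r′ * t + p)) → r ≡ r′
    run-disjoint (_∷_ {u} e w) (x∉ ∷ uq) k {r} {r′} p r< r′< x∈ y∈ with sp u
    run-disjoint (e ∷ w) (x∉ ∷ uq) k p r< r′< (here refl) (here eq) | false = clash {k} {k} p (inj₁ refl) r< r′< (cong proj₂ eq)
    run-disjoint (e ∷ w) (x∉ ∷ uq) k p r< r′< (here refl) (there y∈) | false = ⊥-elim (fresh w k _ x∉ y∈)
    run-disjoint (e ∷ w) (x∉ ∷ uq) k p r< r′< (there x∈) (here refl) | false = ⊥-elim (fresh w k _ x∉ x∈)
    run-disjoint (e ∷ w) (x∉ ∷ uq) k p r< r′< (there x∈) (there y∈) | false = run-disjoint w uq k p r< r′< x∈ y∈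
    run-disjoint (e ∷ w) (x∉ ∷ uq) k p r< r′< (here refl) (here eq) | true = clash {k} {k} p (inj₁ refl) r< r′< (cong proj₂ eq)
    run-disjoint (e ∷ w) (x∉ ∷ uq) k p r< r′< (here refl) (there (here eq)) | true = clash {k} {suc k} p (near-suc′ k) r< r′< (cong proj₂ eq)
    run-disjoint (e ∷ w) (x∉ ∷ uq) k p r< r′< (here refl) (there (there y∈)) | true = ⊥-elim (fresh w (suc k) _ x∉ y∈)
    run-disjoint (e ∷ w) (x∉ ∷ uq) k p r< r′< (there (here refl)) (here eq) | true = clash {suc k} {k} p (near-suc k) r< r′< (cong proj₂ eq)
    run-disjoint (e ∷ w) (x∉ ∷ uq) k p r< r′< (there (here refl)) (there (here eq)) | true = clash {suc k} {suc k} p (inj₁ refl) r< r′< (cong proj₂ eq)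
    run-disjoint (e ∷ w) (x∉ ∷ uq) k p r< r′< (there (here refl)) (there (there y∈)) | true = ⊥-elim (fresh w (suc k) _ x∉ y∈)
    run-disjoint (e ∷ w) (x∉ ∷ uq) k p r< r′< (there (there x∈)) (here refl) | true = ⊥-elim (fresh w (suc k) _ x∉ x∈)
    run-disjoint (e ∷ w) (x∉ ∷ uq) k p r< r′< (there (there x∈)) (there (here refl)) | true = ⊥-elim (fresh w (suc k) _ x∉ x∈)
    run-disjoint (e ∷ w) (x∉ ∷ uq) k p r< r′< (there (there x∈)) (there (there y∈)) | true = run-disjoint w uq (suc k) p r< r′< x∈ y∈

    run-unique : ∀ {u v} (w : Walk Γ u v) → Unique (verts w) → ∀ k p → 0 < R → Unique (verts (run w k p))
    run-unique []            uq        k p 0<R = []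
    run-unique (_∷_ {u} e w) (x∉ ∷ uq) k p 0<R with sp u
    ... | false = All.tabulate (λ y∈ eq → fresh w k p x∉ (subst (_∈ _) (sym eq) y∈)) ∷ run-unique w uq k p 0<R
    ... | true  = ((rise≢ k p 0<R ∘ cong proj₂) ∷ All.tabulate (λ y∈ eq → fresh w (suc k) p x∉ (subst (_∈ _) (sym eq) y∈)))
                ∷ All.tabulate (λ y∈ eq → fresh w (suc k) p x∉ (subst (_∈ _) (sym eq) y∈))
                ∷ run-unique w uq (suc k) p 0<R

    blocks-∈ : ∀ {x} n p → x ∈ verts (blocks n p) → ∃ λ r → r < n × x ∈ verts (run P 0 (r * t + p))
    blocks-∈ (suc n) p x∈ with ∈-++⁻ (verts (blocks n p)) (subst (_ ∈_) (verts-++ (blocks n p) _) x∈)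
    ... | inj₁ x∈ˡ = let r , r< , x∈r = blocks-∈ n p x∈ˡ in r , m<n⇒m<1+n r< , x∈r
    ... | inj₂ x∈ʳ = n , ≤-refl , subst (_ ∈_) (verts-cast (ascent n p) _) x∈ʳ

    blocks-unique : Unique (verts P) → ∀ n p → n ≤ R → Unique (verts (blocks n p))
    blocks-unique uq zero    p n≤ = []
    blocks-unique uq (suc n) p n< = subst Unique (sym (verts-++ (blocks n p) _))
      (Unique.++⁺ (blocks-unique uq n p (<⇒≤ n<))
        (subst Unique (sym (verts-cast (ascent n p) _)) (run-unique P uq 0 _ (≤-trans (s≤s z≤n) n<)))
        λ (x∈ˡ , x∈ʳ) → let r , r< , x∈r = blocks-∈ n p x∈ˡ in
          <⇒≢ r< (run-disjoint P uq 0 p (<-trans r< n<) n< x∈r (subst (_ ∈_) (verts-cast (ascent n p) _) x∈ʳ)))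

    A-unique : Unique (verts P) → ∀ p → Unique (verts (A p))
    A-unique uq p = subst Unique (sym (verts-cast (closing p) _)) (blocks-unique uq R p ≤-refl)

  module _ .{{_ : NonZero t}} .{{_ : NonZero R}} where

    find : ∀ o n → ∃₂ λ ε r → ε < t × r < R × (∃ λ i → o + (r * t + ε) + i * (R * t) ≡ n + o * (R * t))
    find o n = z % c % t , z % c / t , m%n<n (z % c) t , m<n*o⇒m/o<n (m%n<n z c) , z / c , eq
      where
      c = R * t
      instance
        c≢0 : NonZero c
        c≢0 = m*n≢0 R t
      -- This stands for n - o modulo c without subtraction, as o (c - 1) is congruent to -o. Its
      -- remainder modulo c is then split into block number and start.
      z = n + o * (c ∸ 1)
      open ≡-Reasoning
      eq : o + (z % c / t * t + z % c % t) + z / c * c ≡ n + o * c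
      eq = begin
        o + (z % c / t * t + z % c % t) + z / c * c ≡⟨ cong (λ y → o + y + z / c * c) (trans (+-comm _ (z % c % t)) (sym (m≡m%n+[m/n]*n (z % c) t))) ⟩
        o + z % c + z / c * c                       ≡⟨ +-assoc o _ _ ⟩
        o + (z % c + z / c * c)                     ≡⟨ cong (o +_) (sym (m≡m%n+[m/n]*n z c)) ⟩
        o + (n + o * (c ∸ 1))                       ≡⟨ lemma o n (o * (c ∸ 1)) ⟩
        n + (o + o * (c ∸ 1))                       ≡⟨ cong (n +_) (sym (*-suc o (c ∸ 1))) ⟩
        n + o * suc (c ∸ 1)                         ≡⟨ cong (λ y → n + o * y) (suc-pred c) ⟩
        n + o * c                                   ∎
        where
        lemma : ∀ o n x → o + (n + x) ≡ n + (o + x)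
        lemma = solve-∀

    find-shift : ∀ e i o n {q} → o + q + i * (R * t) ≡ n + o * (R * t) → D (e + o + q) ≡ D (e + n)
    find-shift e i o n {q} eq = begin
      D (e + o + q)                 ≡⟨ periods i _ ⟨
      D (i * (R * t) + (e + o + q)) ≡⟨ cong D (trans (shuffle (i * (R * t)) e o q) (trans (cong (e +_) eq) (shuffle′ e n (o * (R * t))))) ⟩
      D (o * (R * t) + (e + n))     ≡⟨ periods o _ ⟩
      D (e + n)                     ∎
      where
      open ≡-Reasoning
      shuffle : ∀ x e o q → x + (e + o + q) ≡ e + (o + q + x)
      shuffle = solve-∀
      shuffle′ : ∀ e n x → e + (n + x) ≡ x + (e + n)
      shuffle′ = solve-∀

    cover-along : ∀ {x y} → Step P x y → ∀ n → ∃ λ ε → ε < t × Step (A ε) (x , D n) (y , D n)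
    cover-along s n with run-along s 0
    ... | o , f with find o n
    ...   | ε , r , ε< , r< , i , eq = ε , ε< , subst (λ d → Step (A ε) (_ , d) (_ , d)) (find-shift 0 i o n eq) (A-step r< (f (r * t + ε)))

    cover-rise : ∀ {x} → Visits P x → sp x ≡ true → ∀ n →
                 ∃ λ ε → ε < t × On (A ε) (x , D n) (x , D (suc n))
    cover-rise {x} (_ , s) special n with run-rise s special 0
    ... | l , f with off-step m l
    ...   | inj₁ u with find (off m l) n
    ...     | ε , r , ε< , r< , i , eq = ε , ε< , inj₁ (subst₂ (λ d d′ → Step (A ε) (x , d) (x , d′))
                (find-shift 0 i (off m l) n eq) (trans (cong (λ z → D (z + (r * t + ε))) u) (find-shift 1 i (off m l) n eq)) (A-step r< (proj₁ (f (r * t + ε)))))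
    cover-rise {x} (_ , s) special n | l , f | inj₂ u with find (off m (suc l)) n
    ...     | ε , r , ε< , r< , i , eq = ε , ε< , inj₂ (subst₂ (λ d d′ → Step (A ε) (x , d) (x , d′))
                (trans (cong (λ z → D (z + (r * t + ε))) u) (find-shift 1 i (off m (suc l)) n eq)) (find-shift 0 i (off m (suc l)) n eq) (A-step r< (proj₁ (f (r * t + ε)))))

  module _ (τ : ℕ) (t≡ : t ≡ τ * 2) .{{_ : NonZero t}} .{{_ : NonZero R}} where

    -- Both t and the period R t are even, so the parity of a level is that of offset plus start,
    -- regardless of the block and of the number of turns.
    find-odd : ∀ o n ε r i → o + (r * t + ε) + i * (R * t) ≡ n + o * (R * t) → odd o xor odd ε ≡ odd n
    find-odd o n ε r i eq = begin
      odd o xor odd ε                           ≡⟨ cong (λ b → odd o xor (b xor odd ε)) (trans (cong (λ t → odd (r * t)) t≡) (odd-*2 r τ)) ⟨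
      odd o xor (odd (r * t) xor odd ε)         ≡⟨ cong (odd o xor_) (odd-+ (r * t) ε) ⟨
      odd o xor odd (r * t + ε)                 ≡⟨ odd-+ o _ ⟨
      odd (o + (r * t + ε))                     ≡⟨ xor-identityʳ _ ⟨
      odd (o + (r * t + ε)) xor false           ≡⟨ cong (odd (o + (r * t + ε)) xor_) (period-even i) ⟨
      odd (o + (r * t + ε)) xor odd (i * (R * t)) ≡⟨ odd-+ (o + (r * t + ε)) _ ⟨
      odd (o + (r * t + ε) + i * (R * t))       ≡⟨ cong odd eq ⟩
      odd (n + o * (R * t))                     ≡⟨ odd-+ n _ ⟩
      odd n xor odd (o * (R * t))               ≡⟨ cong (odd n xor_) (period-even o) ⟩
      odd n xor false                           ≡⟨ xor-identityʳ _ ⟩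
      odd n                                     ∎
      where
      open ≡-Reasoning
      period-even : ∀ i → odd (i * (R * t)) ≡ false
      period-even i = trans (cong (λ t → odd (i * (R * t))) t≡)
        (trans (cong odd (sym (*-assoc i R (τ * 2)))) (odd-*2 (i * R) τ))

    solve-xor : ∀ a {b c} → a xor b ≡ c → b ≡ a xor c
    solve-xor true  {b} refl = sym (not-involutive b)
    solve-xor false refl = refl

    -- A special vertex is passed at two adjacent levels in each block, so each level is reached from an even and from an odd start.
    cover-visit : ∀ {x} → Visits P x → sp x ≡ true → ∀ n β →
                  ∃ λ ε → ε < t × odd ε ≡ β × Visits (A ε) (x , D n)
    cover-visit {x} (_ , s) special n β with run-rise s special 0
    ... | l , f with odd (off m l) xor odd n Bool.≟ β
    ...   | yes p with find (off m l) n
    ...     | ε , r , ε< , r< , i , eq = ε , ε< , trans (solve-xor (odd (off m l)) (find-odd (off m l) n ε r i eq)) p ,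
                subst (λ d → Visits (A ε) (x , d)) (find-shift 0 i (off m l) n eq) (_ , A-step r< (proj₁ (f (r * t + ε))))
    cover-visit {x} (_ , s) special n β | l , f | no ¬p with find (off m (suc l)) n
    ...     | ε , r , ε< , r< , i , eq = ε , ε< , trans (solve-xor (odd (off m (suc l))) (find-odd (off m (suc l)) n ε r i eq)) flipped ,
                subst (λ d → Visits (A ε) (x , d)) (find-shift 0 i (off m (suc l)) n eq) (_ , A-step r< (proj₂ (f (r * t + ε))))
      where
      other : ∀ a b c → (a xor b ≡ c → ⊥) → not a xor b ≡ c
      other a b c ne = trans (sym (not-distribˡ-xor a b)) (sym (¬-not (ne ∘ sym)))
      flip≡ : odd (off m (suc l)) ≡ not (odd (off m l))
      flip≡ with off-step m l
      ... | inj₁ u = cong odd u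
      ... | inj₂ u = trans (sym (not-involutive _)) (cong not (cong odd (sym u)))
      flipped : odd (off m (suc l)) xor odd n ≡ β
      flipped = trans (cong (_xor odd n) flip≡) (other (odd (off m l)) (odd n) β ¬p)

-- Two cycles times one cycle

module Wire {Γ Δ : Graph} {c : ℕ} (cyc : Cyc Δ c) where

  open Cyc cyc

  up : ∀ u n → Prod (Adj Γ) (Adj Δ) (u , D n) (u , D (suc n))
  up u n = along₂ (step n)

  down : ∀ u n → Prod (Adj Γ) (Adj Δ) (u , D (suc n)) (u , D n)
  down u n = along₂ (Graph.~-sym Δ (step n))

  -- The zigzag at level n takes all edges over w between the levels n and n + 1 and returns to level n, so the zigzags
  -- at all levels together act as parallel wires.
  zig : ∀ {u v} (w : Walk Γ u v) k → len w ≡ k * 2 → ∀ n → Walk (Γ ⊠ Δ) (u , D n) (v , D n)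
  zig []                      zero    eq n = []
  zig (_∷_ {u} {u′} e (e′ ∷ w)) (suc k) eq n =
    up u n ∷ along₁ e ∷ down u′ n ∷ along₁ e′ ∷ zig w k (suc-injective (suc-injective eq)) n

  len-zig : ∀ {u v} (w : Walk Γ u v) k eq n → len (zig w k eq n) ≡ len w + len w
  len-zig []           zero    eq n = refl
  len-zig (e ∷ e′ ∷ w) (suc k) eq n = trans (cong (4 +_) (len-zig w k _ n)) (lemma (len w))
    where
    lemma : ∀ l → 4 + (l + l) ≡ (2 + l) + (2 + l)
    lemma = solve-∀

  -- The edges of `w` are taken alternately at level n + 1 and at level n. Which of the two applies
  -- depends on the edge only, so the zigzags at all levels take each edge at every level.
  zig-along : ∀ {u v x y} {w : Walk Γ u v} k eq → Step w x y →
              (∀ n → Step (zig w k eq n) (x , D n) (y , D n)) ⊎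
              (∀ n → Step (zig w k eq n) (x , D (suc n)) (y , D (suc n)))
  zig-along {w = e ∷ e′ ∷ w} (suc k) eq here         = inj₂ λ n → there here
  zig-along {w = e ∷ e′ ∷ w} (suc k) eq (there here) = inj₁ λ n → there (there (there here))
  zig-along {w = e ∷ e′ ∷ w} (suc k) eq (there (there s)) with zig-along k _ s
  ... | inj₁ f = inj₁ λ n → there (there (there (there (f n))))
  ... | inj₂ f = inj₂ λ n → there (there (there (there (f n))))

  zig-rise : ∀ {u v x y} {w : Walk Γ u v} k eq → Step w x y → ∀ n → On (zig w k eq n) (x , D n) (x , D (suc n))
  zig-rise {w = e ∷ e′ ∷ w} (suc k) eq here         n = inj₁ here
  zig-rise {w = e ∷ e′ ∷ w} (suc k) eq (there here) n = inj₂ (there (there here))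
  zig-rise {w = e ∷ e′ ∷ w} (suc k) eq (there (there s)) n =
    on-there (on-there (on-there (on-there (zig-rise k _ s n))))

-- Two cycles C = v₀ v₁ v₂ v₃ … v₀ and C′ = v₃ … v₀ v₃ such that the edge v₃v₀ of C′ is a chord of C.
record Corner (Γ : Graph) (N : ℕ) : Set where
  field
    {v₀ v₁ v₂ v₃ v₄} : V Γ
    e₀₁  : Adj Γ v₀ v₁
    e₁₂  : Adj Γ v₁ v₂
    e₂₃  : Adj Γ v₂ v₃
    e₃₄  : Adj Γ v₃ v₄
    rest : Walk Γ v₄ v₀
    half : ℕ
    even : len rest ≡ half * 2
    len≡ : 4 + len rest ≡ N
    e₀₃  : Adj Γ v₀ v₃
    path : Walk Γ v₃ v₀
    len≡′ : suc (len path) ≡ N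
    all   : ∀ x → Visits (e₀₁ ∷ e₁₂ ∷ e₂₃ ∷ e₃₄ ∷ rest) x
    all′  : ∀ x → Visits (e₀₃ ∷ path) x

  C : Walk Γ v₀ v₀
  C = e₀₁ ∷ e₁₂ ∷ e₂₃ ∷ e₃₄ ∷ rest

  C′ : Walk Γ v₀ v₀
  C′ = e₀₃ ∷ path

-- The torus (C ∪ C′) × D as three Hamiltonian cycles X, Y, Z: Z takes C′ without its chord and climbs
-- alternately along v₀ and v₃; X spirals up; Y climbs in a second spiral and returns down the column over v₂.
-- The rest of C only carries the wires, so the pattern, found by computer search, lives on four columns.
module Gadget {Γ Δ : Graph} {N : ℕ} (κ : Corner Γ N) (h : ℕ) (cyc : Cyc Δ (4 + h * 2)) where

  open Corner κ
  open Cyc cyc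
  open Wire {Γ} cyc

  private
    Π : Graph
    Π = Γ ⊠ Δ

    M : ℕ
    M = 4 + h * 2

  _⁻¹ : ∀ {u v} → Adj Γ u v → Adj Γ v u
  _⁻¹ = Graph.~-sym Γ

  infix 20 _⁻¹

  -- A zigzag needs an even number of edges, but C has an odd number of them from v₃ on to v₀. So
  -- the first one, v₃v₄, is taken separately, at the single level n.
  wire : ∀ n → Walk Π (v₃ , D n) (v₀ , D n)
  wire n = along₁ e₃₄ ∷ zig rest half even n

  period₂ : D (2 + M) ≡ D 2
  period₂ = trans (cong D (+-comm 2 M)) (period 2)

  period₀ : D M ≡ D 0
  period₀ = trans (cong D (sym (+-identityʳ M))) (period 0)

  blockX : ∀ n → Walk Π (v₀ , D n) (v₀ , D (2 + n))
  blockX n = rev (wire n) ++ʷ (along₁ (e₂₃ ⁻¹) ∷ along₁ (e₁₂ ⁻¹) ∷ up v₁ n ∷ along₁ e₁₂ ∷ along₁ e₂₃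
             ∷ along₁ (e₀₃ ⁻¹) ∷ up v₀ (1 + n) ∷ [])

  blocksX : ∀ k → Walk Π (v₀ , D 4) (v₀ , D (4 + k * 2))
  blocksX zero    = []
  blocksX (suc k) = blocksX k ++ʷ blockX (4 + k * 2)

  capX : Walk Π (v₃ , D M) (v₂ , D (2 + M))
  capX = along₁ (e₂₃ ⁻¹) ∷ along₁ (e₁₂ ⁻¹) ∷ up v₁ M ∷ along₁ (e₀₁ ⁻¹) ∷ along₁ e₀₃
         ∷ along₁ (e₂₃ ⁻¹) ∷ up v₂ (1 + M) ∷ []

  riseX : Walk Π (v₃ , D 2) (v₀ , D 4)
  riseX = up v₃ 2 ∷ along₁ (e₀₃ ⁻¹) ∷ up v₀ 3 ∷ []

  restX : Walk Π (v₁ , D 2) (v₂ , D (2 + M))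
  restX = along₁ (e₀₁ ⁻¹) ∷ rev (wire 2) ++ʷ riseX ++ʷ blocksX h ++ʷ rev (wire M) ++ʷ capX

  openX : Walk Π (v₂ , D 2) (v₂ , D (2 + M))
  openX = up v₂ 2 ∷ along₁ (e₁₂ ⁻¹) ∷ down v₁ 2 ∷ restX

  X : Walk Π (v₂ , D 2) (v₂ , D 2)
  X = castʷ (cong (v₂ ,_) period₂) openX

  line : ∀ k → Walk Π (v₂ , D (3 + k)) (v₂ , D 3)
  line zero    = []
  line (suc k) = down v₂ (3 + k) ∷ line k

  blockY : ∀ n → Walk Π (v₀ , D n) (v₀ , D (2 + n))
  blockY n = (along₁ e₀₁ ∷ up v₁ n ∷ along₁ (e₀₁ ⁻¹) ∷ along₁ e₀₃ ∷ up v₃ (1 + n) ∷ []) ++ʷ wire (2 + n)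

  blocksY : ∀ k → Walk Π (v₀ , D 3) (v₀ , D (3 + k * 2))
  blocksY zero    = []
  blocksY (suc k) = blocksY k ++ʷ blockY (3 + k * 2)

  capY : Walk Π (v₀ , D (1 + M)) (v₂ , D (2 + M))
  capY = up v₀ (1 + M) ∷ along₁ e₀₃ ∷ along₁ (e₂₃ ⁻¹) ∷ []

  restY : Walk Π (v₁ , D (2 + M)) (v₂ , D (2 + M))
  restY = down v₁ (1 + M) ∷ along₁ e₁₂ ∷ line (2 + h * 2) ++ʷ along₁ e₂₃ ∷ wire 3 ++ʷ blocksY (suc h) ++ʷ capY

  Y : Walk Π (v₂ , D (2 + M)) (v₂ , D (2 + M))
  Y = along₁ (e₁₂ ⁻¹) ∷ restY

  blockZ : ∀ n → Walk Π (v₃ , D n) (v₃ , D (2 + n))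
  blockZ n = copyˡ path (D n) ++ʷ up v₀ n ∷ copyˡ (rev path) (D (1 + n)) ++ʷ up v₃ (1 + n) ∷ []

  blocksZ : ∀ k → Walk Π (v₃ , D 0) (v₃ , D (k * 2))
  blocksZ zero    = []
  blocksZ (suc k) = blocksZ k ++ʷ blockZ (k * 2)

  Z : Walk Π (v₃ , D 0) (v₃ , D 0)
  Z = castʷ (cong (v₃ ,_) period₀) (blocksZ (2 + h))

  inBlocksX : ∀ {x y} k i → i < k → On (blockX (4 + i * 2)) x y → On (blocksX k) x y
  inBlocksX (suc k) i i< o with m≤n⇒m<n∨m≡n (≤-pred i<)
  ... | inj₁ i<k  = on-++ˡ _ (inBlocksX k i i<k o)
  ... | inj₂ refl = on-++ʳ (blocksX k) o

  inBlocksY : ∀ {x y} k i → i < k → On (blockY (3 + i * 2)) x y → On (blocksY k) x y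
  inBlocksY (suc k) i i< o with m≤n⇒m<n∨m≡n (≤-pred i<)
  ... | inj₁ i<k  = on-++ˡ _ (inBlocksY k i i<k o)
  ... | inj₂ refl = on-++ʳ (blocksY k) o

  inBlocksZ : ∀ {x y} k i → i < k → On (blockZ (i * 2)) x y → On (blocksZ k) x y
  inBlocksZ (suc k) i i< o with m≤n⇒m<n∨m≡n (≤-pred i<)
  ... | inj₁ i<k  = on-++ˡ _ (inBlocksZ k i i<k o)
  ... | inj₂ refl = on-++ʳ (blocksZ k) o

  inLine : ∀ k i → i < k → On (line k) (v₂ , D (3 + i)) (v₂ , D (4 + i))
  inLine (suc k) i i< with m≤n⇒m<n∨m≡n (≤-pred i<)
  ... | inj₁ i<k  = on-there (inLine k i i<k)
  ... | inj₂ refl = inj₂ here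

  module _ {x y : V Π} where

    fromX : On openX x y → On X x y
    fromX = on-cast (cong (v₂ ,_) period₂)

    X-wire₂ : On (wire 2) x y → On X x y
    X-wire₂ o = fromX (on-there (on-there (on-there (on-there (on-++ˡ _ (on-rev {w = wire 2} o))))))

    private
      beyond₁ : On (riseX ++ʷ blocksX h ++ʷ rev (wire M) ++ʷ capX) x y → On X x y
      beyond₁ o = fromX (on-there (on-there (on-there (on-there (on-++ʳ (rev (wire 2)) o)))))

    X-rise : On riseX x y → On X x y
    X-rise o = beyond₁ (on-++ˡ _ o)

    X-block : ∀ i → i < h → On (blockX (4 + i * 2)) x y → On X x y
    X-block i i< o = beyond₁ (on-++ʳ riseX (on-++ˡ _ (inBlocksX h i i< o)))

    X-wireM : On (wire M) x y → On X x y
    X-wireM o = beyond₁ (on-++ʳ riseX (on-++ʳ (blocksX h) (on-++ˡ _ (on-rev {w = wire M} o))))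

    X-cap : On capX x y → On X x y
    X-cap o = beyond₁ (on-++ʳ riseX (on-++ʳ (blocksX h) (on-++ʳ (rev (wire M)) o)))

    X-wireᵢ : ∀ i → i < h → On (wire (4 + i * 2)) x y → On X x y
    X-wireᵢ i i< o = X-block i i< (on-++ˡ _ (on-rev {w = wire (4 + i * 2)} o))

    Y-line : On (line (2 + h * 2)) x y → On Y x y
    Y-line o = on-there (on-there (on-there (on-++ˡ _ o)))

    private
      beyond₂ : On (along₁ e₂₃ ∷ wire 3 ++ʷ blocksY (suc h) ++ʷ capY) x y → On Y x y
      beyond₂ o = on-there (on-there (on-there (on-++ʳ (line (2 + h * 2)) o)))

    Y-e₂₃ : x ≡ (v₂ , D 3) → y ≡ (v₃ , D 3) → On Y x y
    Y-e₂₃ refl refl = beyond₂ (inj₁ here)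

    Y-wire₃ : On (wire 3) x y → On Y x y
    Y-wire₃ o = beyond₂ (on-there (on-++ˡ {w = wire 3} _ o))

    Y-block : ∀ i → i < suc h → On (blockY (3 + i * 2)) x y → On Y x y
    Y-block i i< o = beyond₂ (on-there (on-++ʳ (wire 3) (on-++ˡ _ (inBlocksY (suc h) i i< o))))

    Y-wireᵢ : ∀ i → i < suc h → On (wire (5 + i * 2)) x y → On Y x y
    Y-wireᵢ i i< o = Y-block i i< (on-there (on-there (on-there (on-there (on-there o)))))

    Y-cap : On capY x y → On Y x y
    Y-cap o = beyond₂ (on-there (on-++ʳ (wire 3) (on-++ʳ (blocksY (suc h)) o)))

    Z-block : ∀ i → i < 2 + h → On (blockZ (i * 2)) x y → On Z x y
    Z-block i i< o = on-cast (cong (v₃ ,_) period₀) (inBlocksZ (2 + h) i i< o)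

  -- The levels are represented modulo M by 2, …, M + 1.
  data Level : ℕ → Set where
    lo₂ : Level 2
    lo₃ : Level 3
    ev  : ∀ i → i < h → Level (4 + i * 2)
    od  : ∀ i → i < h → Level (5 + i * 2)
    hi₀ : Level M
    hi₁ : Level (1 + M)

  -- Agreement from n and m onwards, not just at one level, so that it passes to the successors
  -- without appeal to the injectivity of the cycle.
  _≈_ : ℕ → ℕ → Set
  n ≈ m = ∀ k → D (k + n) ≡ D (k + m)

  ≈-suc : ∀ {n m} → n ≈ m → suc n ≈ suc m
  ≈-suc {n} {m} eq k = trans (cong D (+-suc k n)) (trans (eq (suc k)) (cong D (sym (+-suc k m))))

  wrap : ∀ n → (n + M) ≈ n
  wrap n k = trans (cong D (trans (sym (+-assoc k n M)) (+-comm (k + n) M))) (period (k + n))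

  next-level : ∀ {m} → Level m → ∃ λ m′ → Level m′ × suc m ≈ m′
  next-level lo₂ = _ , lo₃ , λ k → refl
  next-level lo₃ = first h refl
    where
    first : ∀ k → k ≡ h → ∃ λ m′ → Level m′ × 4 ≈ m′
    first zero    refl = _ , hi₀ , λ k → refl
    first (suc k) refl = _ , ev 0 z<s , λ k → refl
  next-level (ev i i<) = _ , od i i< , λ k → refl
  next-level (od i i<) with m≤n⇒m<n∨m≡n i<
  ... | inj₁ i<′  = _ , ev (suc i) i<′ , λ k → refl
  ... | inj₂ refl = _ , hi₀ , λ k → refl
  next-level hi₀ = _ , hi₁ , λ k → refl
  next-level hi₁ = _ , lo₂ , wrap 2

  level : ∀ n → ∃ λ m → Level m × n ≈ m
  level zero    = _ , hi₀ , λ k → trans (cong D (+-identityʳ k)) (sym (trans (cong D (+-comm k M)) (period k)))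
  level (suc n) with level n
  ... | m , l , eq with next-level l
  ...   | m′ , l′ , eq′ = m′ , l′ , λ k → trans (≈-suc eq k) (eq′ k)

  data Some (x y : V Π) : Set where
    inX : On X x y → Some x y
    inY : On Y x y → Some x y
    inZ : On Z x y → Some x y

  private
    at₂ : ∀ {u v} → On Y (u , D (2 + M)) (v , D (2 + M)) → On Y (u , D 2) (v , D 2)
    at₂ = subst (λ d → On Y (_ , d) (_ , d)) period₂

  zRise₀ : ∀ j → j < 2 + h → On Z (v₀ , D (j * 2)) (v₀ , D (suc (j * 2)))
  zRise₀ j j< = Z-block j j< (on-++ʳ (copyˡ path (D (j * 2))) (inj₁ here))

  zRise₃ : ∀ j → j < 2 + h → On Z (v₃ , D (suc (j * 2))) (v₃ , D (2 + j * 2))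
  zRise₃ j j< = Z-block j j< (on-++ʳ (copyˡ path (D (j * 2))) (on-there (on-++ʳ (copyˡ (rev path) (D (1 + j * 2))) (inj₁ here))))

  zRise₀′ : On Z (v₀ , D M) (v₀ , D (1 + M))
  zRise₀′ = subst₂ (λ d d′ → On Z (v₀ , d) (v₀ , d′)) (sym (wrap 0 0)) (sym (wrap 0 1)) (zRise₀ 0 z<s)

  zRise₃′ : On Z (v₃ , D (1 + M)) (v₃ , D (2 + M))
  zRise₃′ = subst₂ (λ d d′ → On Z (v₃ , d) (v₃ , d′)) (sym (wrap 0 1)) (sym (wrap 0 2)) (zRise₃ 0 z<s)

  entry : ∀ k → k ≤ h → Visits X (v₀ , D (4 + k * 2))
  entry zero    k≤ = on-visits (X-rise (inj₂ (there (there here))))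
  entry (suc k) k< = on-visits (X-block k k< (on-++ʳ (rev (wire (4 + k * 2))) (inj₂ (there (there (there (there (there (there here)))))))))

  chord : ∀ {n} → Level n → Some (v₀ , D n) (v₃ , D n)
  chord lo₂ = inY (at₂ (Y-cap (inj₁ (there here))))
  chord lo₃ = inX (X-rise (inj₂ (there here)))
  chord (ev i i<) = inY (Y-block i (m<n⇒m<1+n i<) (inj₁ (there (there (there here)))))
  chord (od i i<) = inX (X-block i i< (on-++ʳ (rev (wire (4 + i * 2))) (inj₂ (there (there (there (there (there here))))))))
  chord hi₀ = inY (Y-block h ≤-refl (inj₁ (there (there (there here)))))
  chord hi₁ = inX (X-cap (inj₁ (there (there (there (there here))))))

  edge₀₁ : ∀ {n} → Level n → Some (v₀ , D n) (v₁ , D n)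
  edge₀₁ lo₂ = inX (fromX (inj₂ (there (there (there here)))))
  edge₀₁ lo₃ = inY (Y-block 0 z<s (inj₁ here))
  edge₀₁ (ev i i<) = inY (Y-block i (m<n⇒m<1+n i<) (inj₂ (there (there here))))
  edge₀₁ (od i i<) = inY (Y-block (suc i) (s≤s i<) (inj₁ here))
  edge₀₁ hi₀ = inY (Y-block h ≤-refl (inj₂ (there (there here))))
  edge₀₁ hi₁ = inX (X-cap (inj₂ (there (there (there here)))))

  edge₁₂ : ∀ {n} → Level n → Some (v₁ , D n) (v₂ , D n)
  edge₁₂ lo₂ = inY (at₂ (inj₂ here))
  edge₁₂ lo₃ = inX (fromX (inj₂ (there here)))
  edge₁₂ (ev i i<) = inX (X-block i i< (on-++ʳ (rev (wire (4 + i * 2))) (inj₂ (there here))))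
  edge₁₂ (od i i<) = inX (X-block i i< (on-++ʳ (rev (wire (4 + i * 2))) (inj₁ (there (there (there here))))))
  edge₁₂ hi₀ = inX (X-cap (inj₂ (there here)))
  edge₁₂ hi₁ = inY (inj₁ (there (there here)))

  edge₂₃ : ∀ {n} → Level n → Some (v₂ , D n) (v₃ , D n)
  edge₂₃ lo₂ = inY (at₂ (Y-cap (inj₂ (there (there here)))))
  edge₂₃ lo₃ = inY (Y-e₂₃ refl refl)
  edge₂₃ (ev i i<) = inX (X-block i i< (on-++ʳ (rev (wire (4 + i * 2))) (inj₂ here)))
  edge₂₃ (od i i<) = inX (X-block i i< (on-++ʳ (rev (wire (4 + i * 2))) (inj₁ (there (there (there (there here)))))))
  edge₂₃ hi₀ = inX (X-cap (inj₂ here))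
  edge₂₃ hi₁ = inX (X-cap (inj₂ (there (there (there (there (there here)))))))

  rise₀ : ∀ {n} → Level n → Some (v₀ , D n) (v₀ , D (suc n))
  rise₀ lo₂ = inZ (zRise₀ 1 (s≤s (s≤s z≤n)))
  rise₀ lo₃ = inX (X-rise (inj₁ (there (there here))))
  rise₀ (ev i i<) = inZ (zRise₀ (2 + i) (s≤s (s≤s i<)))
  rise₀ (od i i<) = inX (X-block i i< (on-++ʳ (rev (wire (4 + i * 2))) (inj₁ (there (there (there (there (there (there here)))))))))
  rise₀ hi₀ = inZ (zRise₀′)
  rise₀ hi₁ = inY (Y-cap (inj₁ here))

  rise₁ : ∀ {n} → Level n → Some (v₁ , D n) (v₁ , D (suc n))
  rise₁ lo₂ = inX (fromX (inj₂ (there (there here))))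
  rise₁ lo₃ = inY (Y-block 0 z<s (inj₁ (there here)))
  rise₁ (ev i i<) = inX (X-block i i< (on-++ʳ (rev (wire (4 + i * 2))) (inj₁ (there (there here)))))
  rise₁ (od i i<) = inY (Y-block (suc i) (s≤s i<) (inj₁ (there here)))
  rise₁ hi₀ = inX (X-cap (inj₁ (there (there here))))
  rise₁ hi₁ = inY (inj₂ (there here))

  rise₂ : ∀ {n} → Level n → Some (v₂ , D n) (v₂ , D (suc n))
  rise₂ lo₂ = inX (fromX (inj₁ here))
  rise₂ lo₃ = inY (Y-line (inLine (2 + h * 2) 0 z<s))
  rise₂ (ev i i<) = inY (Y-line (inLine (2 + h * 2) (1 + i * 2) (s≤s (m<n⇒m<1+n (*-monoˡ-< 2 i<)))))
  rise₂ (od i i<) = inY (Y-line (inLine (2 + h * 2) (2 + i * 2) (s≤s (s≤s (*-monoˡ-< 2 i<)))))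
  rise₂ hi₀ = inY (Y-line (inLine (2 + h * 2) (1 + h * 2) ≤-refl))
  rise₂ hi₁ = inX (X-cap (inj₁ (there (there (there (there (there (there here))))))))

  rise₃ : ∀ {n} → Level n → Some (v₃ , D n) (v₃ , D (suc n))
  rise₃ lo₂ = inX (X-rise (inj₁ here))
  rise₃ lo₃ = inZ (zRise₃ 1 (s≤s (s≤s z≤n)))
  rise₃ (ev i i<) = inY (Y-block i (m<n⇒m<1+n i<) (inj₁ (there (there (there (there here))))))
  rise₃ (od i i<) = inZ (zRise₃ (2 + i) (s≤s (s≤s i<)))
  rise₃ hi₀ = inY (Y-block h ≤-refl (inj₁ (there (there (there (there here))))))
  rise₃ hi₁ = inZ (zRise₃′)

  visitsX₀ : ∀ {n} → Level n → Visits X (v₀ , D n)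
  visitsX₀ lo₂ = on-visits (fromX (inj₂ (there (there (there here)))))
  visitsX₀ lo₃ = on-visits (X-rise (inj₂ (there here)))
  visitsX₀ (ev i i<) = entry i (<⇒≤ i<)
  visitsX₀ (od i i<) = on-visits (X-block i i< (on-++ʳ (rev (wire (4 + i * 2))) (inj₂ (there (there (there (there (there here))))))))
  visitsX₀ hi₀ = entry h ≤-refl
  visitsX₀ hi₁ = on-visits (X-cap (inj₁ (there (there (there (there here))))))

  visitsX₁ : ∀ {n} → Level n → Visits X (v₁ , D n)
  visitsX₁ lo₂ = on-visits (On-sym (fromX (inj₂ (there (there (there here))))))
  visitsX₁ lo₃ = on-visits (fromX (inj₂ (there here)))
  visitsX₁ (ev i i<) = on-visits (X-block i i< (on-++ʳ (rev (wire (4 + i * 2))) (inj₂ (there here))))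
  visitsX₁ (od i i<) = on-visits (X-block i i< (on-++ʳ (rev (wire (4 + i * 2))) (inj₁ (there (there (there here))))))
  visitsX₁ hi₀ = on-visits (X-cap (inj₂ (there here)))
  visitsX₁ hi₁ = on-visits (On-sym (X-cap (inj₂ (there (there (there here))))))

  visitsX₂ : ∀ {n} → Level n → Visits X (v₂ , D n)
  visitsX₂ lo₂ = on-visits (fromX (inj₁ here))
  visitsX₂ lo₃ = on-visits (On-sym (fromX (inj₂ (there here))))
  visitsX₂ (ev i i<) = on-visits (On-sym (X-block i i< (on-++ʳ (rev (wire (4 + i * 2))) (inj₂ (there here)))))
  visitsX₂ (od i i<) = on-visits (On-sym (X-block i i< (on-++ʳ (rev (wire (4 + i * 2))) (inj₁ (there (there (there here)))))))
  visitsX₂ hi₀ = on-visits (On-sym (X-cap (inj₂ (there here))))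
  visitsX₂ hi₁ = on-visits (X-cap (inj₂ (there (there (there (there (there here)))))))

  visitsX₃ : ∀ {n} → Level n → Visits X (v₃ , D n)
  visitsX₃ lo₂ = on-visits (X-rise (inj₁ here))
  visitsX₃ lo₃ = on-visits (On-sym (X-rise (inj₂ (there here))))
  visitsX₃ (ev i i<) = on-visits (On-sym (X-block i i< (on-++ʳ (rev (wire (4 + i * 2))) (inj₂ here))))
  visitsX₃ (od i i<) = on-visits (On-sym (X-block i i< (on-++ʳ (rev (wire (4 + i * 2))) (inj₂ (there (there (there (there (there here)))))))))
  visitsX₃ hi₀ = on-visits (On-sym (X-cap (inj₂ here)))
  visitsX₃ hi₁ = on-visits (On-sym (X-cap (inj₁ (there (there (there (there here)))))))

  visitsY₀ : ∀ {n} → Level n → Visits Y (v₀ , D n)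
  visitsY₀ lo₂ = on-visits (at₂ (Y-cap (inj₁ (there here))))
  visitsY₀ lo₃ = on-visits (Y-block 0 z<s (inj₁ here))
  visitsY₀ (ev i i<) = on-visits (Y-block i (m<n⇒m<1+n i<) (inj₂ (there (there here))))
  visitsY₀ (od i i<) = on-visits (Y-block (suc i) (s≤s i<) (inj₁ here))
  visitsY₀ hi₀ = on-visits (Y-block h ≤-refl (inj₂ (there (there here))))
  visitsY₀ hi₁ = on-visits (Y-cap (inj₁ here))

  visitsY₁ : ∀ {n} → Level n → Visits Y (v₁ , D n)
  visitsY₁ lo₂ = on-visits (at₂ (inj₂ here))
  visitsY₁ lo₃ = on-visits (On-sym (Y-block 0 z<s (inj₁ here)))
  visitsY₁ (ev i i<) = on-visits (On-sym (Y-block i (m<n⇒m<1+n i<) (inj₂ (there (there here)))))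
  visitsY₁ (od i i<) = on-visits (On-sym (Y-block (suc i) (s≤s i<) (inj₁ here)))
  visitsY₁ hi₀ = on-visits (On-sym (Y-block h ≤-refl (inj₂ (there (there here)))))
  visitsY₁ hi₁ = on-visits (inj₁ (there (there here)))

  visitsY₂ : ∀ {n} → Level n → Visits Y (v₂ , D n)
  visitsY₂ lo₂ = on-visits (On-sym (at₂ (inj₂ here)))
  visitsY₂ lo₃ = on-visits (Y-e₂₃ refl refl)
  visitsY₂ (ev i i<) = on-visits (Y-line (inLine (2 + h * 2) (1 + i * 2) (s≤s (m<n⇒m<1+n (*-monoˡ-< 2 i<)))))
  visitsY₂ (od i i<) = on-visits (Y-line (inLine (2 + h * 2) (2 + i * 2) (s≤s (s≤s (*-monoˡ-< 2 i<)))))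
  visitsY₂ hi₀ = on-visits (Y-line (inLine (2 + h * 2) (1 + h * 2) ≤-refl))
  visitsY₂ hi₁ = on-visits (On-sym (inj₁ (there (there here))))

  visitsY₃ : ∀ {n} → Level n → Visits Y (v₃ , D n)
  visitsY₃ lo₂ = on-visits (On-sym (at₂ (Y-cap (inj₁ (there here)))))
  visitsY₃ lo₃ = on-visits (On-sym (Y-e₂₃ refl refl))
  visitsY₃ (ev i i<) = on-visits (On-sym (Y-block i (m<n⇒m<1+n i<) (inj₁ (there (there (there here))))))
  visitsY₃ (od i i<) = on-visits (On-sym (Y-block i (m<n⇒m<1+n i<) (inj₁ (there (there (there (there here)))))))
  visitsY₃ hi₀ = on-visits (On-sym (Y-block h ≤-refl (inj₁ (there (there (there here))))))
  visitsY₃ hi₁ = on-visits (On-sym (Y-block h ≤-refl (inj₁ (there (there (there (there here)))))))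

  Wired : ∀ {a b} → Walk Π a b → ℕ → Set
  Wired W n = ∀ {x y} → On (wire n) x y → On W x y

  wires : ∀ {n} → Level n → Wired X n ⊎ Wired Y n
  wires lo₂       = inj₁ X-wire₂
  wires lo₃       = inj₂ Y-wire₃
  wires (ev i i<) = inj₁ (X-wireᵢ i i<)
  wires (od i i<) = inj₂ (Y-wireᵢ i (m<n⇒m<1+n i<))
  wires hi₀       = inj₁ X-wireM
  wires hi₁       = inj₂ (Y-wireᵢ h ≤-refl)

  -- Wire n passes through the levels n and n + 1; the colours of consecutive wires alternate.
  wireX : ∀ {n} → Level n → Wired X n ⊎ (∃ λ n′ → suc n′ ≈ n × Wired X n′)
  wireX lo₂       = inj₁ X-wire₂
  wireX lo₃       = inj₂ (2 , (λ k → refl) , X-wire₂)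
  wireX (ev i i<) = inj₁ (X-wireᵢ i i<)
  wireX (od i i<) = inj₂ (4 + i * 2 , (λ k → refl) , X-wireᵢ i i<)
  wireX hi₀       = inj₁ X-wireM
  wireX hi₁       = inj₂ (M , (λ k → refl) , X-wireM)

  wireY : ∀ {n} → Level n → Wired Y n ⊎ (∃ λ n′ → suc n′ ≈ n × Wired Y n′)
  wireY lo₂             = inj₂ (1 + M , wrap 2 , Y-wireᵢ h ≤-refl)
  wireY lo₃             = inj₁ Y-wire₃
  wireY (ev zero i<)    = inj₂ (3 , (λ k → refl) , Y-wire₃)
  wireY (ev (suc i) i<) = inj₂ (5 + i * 2 , (λ k → refl) , Y-wireᵢ i (<-trans ≤-refl (m<n⇒m<1+n i<)))
  wireY (od i i<)       = inj₁ (Y-wireᵢ i (m<n⇒m<1+n i<))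
  wireY hi₀             = inj₂ (3 + h * 2 , (λ k → refl) , below)
    where
    below : Wired Y (3 + h * 2)
    below = top h refl
      where
      top : ∀ k → k ≡ h → Wired Y (3 + k * 2)
      top zero    _    = Y-wire₃
      top (suc k) refl = Y-wireᵢ k (<-trans ≤-refl ≤-refl)
  wireY hi₁             = inj₁ (Y-wireᵢ h ≤-refl)

  private
    move : ∀ {u v n m} → n ≈ m → Some (u , D m) (v , D m) → Some (u , D n) (v , D n)
    move eq = subst (λ d → Some (_ , d) (_ , d)) (sym (eq 0))

    move↑ : ∀ {u n m} → n ≈ m → Some (u , D m) (u , D (suc m)) → Some (u , D n) (u , D (suc n))
    move↑ eq = subst₂ (λ d d′ → Some (_ , d) (_ , d′)) (sym (eq 0)) (sym (eq 1))

    moveᵛ : ∀ {a W u n m} → n ≈ m → Visits {Π} {a} {a} W (u , D m) → Visits W (u , D n)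
    moveᵛ eq = subst (λ d → Visits _ (_ , d)) (sym (eq 0))

    some : ∀ {x y n} → On (wire n) x y → Level n → Some x y
    some o l with wires l
    ... | inj₁ f = inX (f o)
    ... | inj₂ f = inY (f o)

    pred-level : ∀ n → ∃ λ m → Level m × n ≈ suc m
    -- Adding M - 1 goes down by one level modulo M. This serves the edges that wire m takes at
    -- level m + 1.
    pred-level n with level (n + (3 + h * 2))
    ... | m , l , eq = m , l , λ k → trans (sym (wrap n k)) (trans (cong (λ z → D (k + z)) (+-suc n _)) (≈-suc eq k))

  -- Z is built from pairs of levels 2j and 2j + 1 starting at 0, so for Z the representatives
  -- modulo M are 0, ..., M - 1 instead of those in `Level`.
  half-layer : ∀ n → ∃₂ λ j b → j < 2 + h × n ≈ ((if b then 1 else 0) + j * 2)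
  half-layer n with level n
  ... | _ , lo₂ , eq       = 1 , false , s≤s (s≤s z≤n) , eq
  ... | _ , lo₃ , eq       = 1 , true , s≤s (s≤s z≤n) , eq
  ... | _ , (ev i i<) , eq = 2 + i , false , s≤s (s≤s i<) , eq
  ... | _ , (od i i<) , eq = 2 + i , true , s≤s (s≤s i<) , eq
  ... | _ , hi₀ , eq       = 0 , false , z<s , λ k → trans (eq k) (wrap 0 k)
  ... | _ , hi₁ , eq       = 0 , true , z<s , λ k → trans (eq k) (wrap 1 k)

  path-lift : ∀ {x y} → Step path x y → ∀ n → On Z (x , D n) (y , D n)
  path-lift s n with half-layer n
  ... | j , false , j< , eq = subst (λ d → On Z (_ , d) (_ , d)) (sym (eq 0))
    (Z-block j j< (on-++ˡ _ (inj₁ (step-copyˡ s))))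
  ... | j , true , j< , eq = subst (λ d → On Z (_ , d) (_ , d)) (sym (eq 0))
    (Z-block j j< (on-++ʳ (copyˡ path (D (j * 2))) (on-there (on-++ˡ _ (inj₂ (step-copyˡ (step-rev s)))))))

  Z-v₀ : ∀ n → Visits Z (v₀ , D n)
  Z-v₀ n with half-layer n
  ... | j , false , j< , eq = moveᵛ eq (on-visits (zRise₀ j j<))
  ... | j , true , j< , eq = moveᵛ eq (on-visits (On-sym (zRise₀ j j<)))

  cover-C : ∀ {x y} → Step C x y → ∀ n → Some (x , D n) (y , D n)
  cover-C here n = let _ , l , eq = level n in move eq (edge₀₁ l)
  cover-C (there here) n = let _ , l , eq = level n in move eq (edge₁₂ l)
  cover-C (there (there here)) n = let _ , l , eq = level n in move eq (edge₂₃ l)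
  cover-C (there (there (there here))) n = let _ , l , eq = level n in move eq (some (inj₁ here) l)
  cover-C (there (there (there (there s)))) n with zig-along half even s
  ... | inj₁ f = let m , l , eq = level n in move eq (some (inj₁ (there (f m))) l)
  ... | inj₂ f = let m , l , eq = pred-level n in
    move {m = suc m} eq (some (inj₁ (there (f m))) l)

  cover-C′ : ∀ {x y} → Step C′ x y → ∀ n → Some (x , D n) (y , D n)
  cover-C′ here n = let _ , l , eq = level n in move eq (chord l)
  cover-C′ (there s) n = inZ (path-lift s n)

  cover-rise : ∀ x n → Some (x , D n) (x , D (suc n))
  cover-rise x n with all x | level n
  ... | _ , here                            | _ , l , eq = move↑ eq (rise₀ l)
  ... | _ , there here                      | _ , l , eq = move↑ eq (rise₁ l)
  ... | _ , there (there here)              | _ , l , eq = move↑ eq (rise₂ l)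
  ... | _ , there (there (there here))      | _ , l , eq = move↑ eq (rise₃ l)
  ... | _ , there (there (there (there s))) | m , l , eq = move↑ eq (some (on-there (zig-rise half even s m)) l)

  visitsX : ∀ x n → Visits X (x , D n)
  visitsX x n with all x | level n
  ... | _ , here                            | _ , l , eq = moveᵛ eq (visitsX₀ l)
  ... | _ , there here                      | _ , l , eq = moveᵛ eq (visitsX₁ l)
  ... | _ , there (there here)              | _ , l , eq = moveᵛ eq (visitsX₂ l)
  ... | _ , there (there (there here))      | _ , l , eq = moveᵛ eq (visitsX₃ l)
  ... | _ , there (there (there (there s))) | m , l , eq = moveᵛ eq (through (wireX l))
    where
    through : (Wired X m ⊎ (∃ λ n′ → suc n′ ≈ m × Wired X n′)) → Visits X (x , D m)
    through (inj₁ f)             = on-visits (f (on-there (zig-rise half even s m)))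
    through (inj₂ (n′ , e , f)) = moveᵛ {m = suc n′} (λ k → sym (e k)) (on-visits (f (On-sym (on-there (zig-rise half even s n′)))))

  visitsY : ∀ x n → Visits Y (x , D n)
  visitsY x n with all x | level n
  ... | _ , here                            | _ , l , eq = moveᵛ eq (visitsY₀ l)
  ... | _ , there here                      | _ , l , eq = moveᵛ eq (visitsY₁ l)
  ... | _ , there (there here)              | _ , l , eq = moveᵛ eq (visitsY₂ l)
  ... | _ , there (there (there here))      | _ , l , eq = moveᵛ eq (visitsY₃ l)
  ... | _ , there (there (there (there s))) | m , l , eq = moveᵛ eq (through (wireY l))
    where
    through : (Wired Y m ⊎ (∃ λ n′ → suc n′ ≈ m × Wired Y n′)) → Visits Y (x , D m)
    through (inj₁ f)             = on-visits (f (on-there (zig-rise half even s m)))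
    through (inj₂ (n′ , e , f)) = moveᵛ {m = suc n′} (λ k → sym (e k)) (on-visits (f (On-sym (on-there (zig-rise half even s n′)))))

  visitsZ : ∀ x n → Visits Z (x , D n)
  visitsZ x n with all′ x
  ... | y , here    = Z-v₀ n
  ... | y , there s = on-visits (path-lift s n)

  private
    ρ : ℕ
    ρ = len rest

    len-wire : ∀ n → len (wire n) ≡ 1 + (ρ + ρ)
    len-wire n = cong suc (len-zig rest half even n)

    len-wire⁻ : ∀ n → len (rev (wire n)) ≡ 1 + (ρ + ρ)
    len-wire⁻ n = trans (len-rev (wire n)) (len-wire n)

    len-blocksX : ∀ k → len (blocksX k) ≡ k * (8 + (ρ + ρ))
    len-blocksX zero    = refl
    len-blocksX (suc k) = begin
      len (blocksX k ++ʷ blockX (4 + k * 2))                ≡⟨ len-++ (blocksX k) _ ⟩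
      len (blocksX k) + len (blockX (4 + k * 2))            ≡⟨ cong₂ _+_ (len-blocksX k) (len-++ (rev (wire (4 + k * 2))) _) ⟩
      k * (8 + (ρ + ρ)) + (len (rev (wire (4 + k * 2))) + 7) ≡⟨ cong (λ l → k * (8 + (ρ + ρ)) + (l + 7)) (len-wire⁻ (4 + k * 2)) ⟩
      k * (8 + (ρ + ρ)) + (1 + (ρ + ρ) + 7)                  ≡⟨ lemma k ρ ⟩
      suc k * (8 + (ρ + ρ))                                  ∎
      where
      open ≡-Reasoning
      lemma : ∀ k r → k * (8 + (r + r)) + (1 + (r + r) + 7) ≡ suc k * (8 + (r + r))
      lemma = solve-∀

    len-blocksY : ∀ k → len (blocksY k) ≡ k * (6 + (ρ + ρ))
    len-blocksY zero    = refl
    len-blocksY (suc k) = begin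
      len (blocksY k ++ʷ blockY (3 + k * 2))        ≡⟨ len-++ (blocksY k) _ ⟩
      len (blocksY k) + (5 + len (wire (5 + k * 2))) ≡⟨ cong₂ (λ a b → a + (5 + b)) (len-blocksY k) (len-wire (5 + k * 2)) ⟩
      k * (6 + (ρ + ρ)) + (5 + (1 + (ρ + ρ)))        ≡⟨ lemma k ρ ⟩
      suc k * (6 + (ρ + ρ))                          ∎
      where
      open ≡-Reasoning
      lemma : ∀ k r → k * (6 + (r + r)) + (5 + (1 + (r + r))) ≡ suc k * (6 + (r + r))
      lemma = solve-∀

    len-line : ∀ k → len (line k) ≡ k
    len-line zero    = refl
    len-line (suc k) = cong suc (len-line k)

    len-blocksZ : ∀ k → len (blocksZ k) ≡ k * (N + N)
    len-blocksZ zero    = refl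
    len-blocksZ (suc k) = begin
      len (blocksZ k ++ʷ blockZ (k * 2))         ≡⟨ len-++ (blocksZ k) _ ⟩
      len (blocksZ k) + len (blockZ (k * 2))     ≡⟨ cong₂ _+_ (len-blocksZ k) block ⟩
      k * (N + N) + (N + N)                      ≡⟨ +-comm (k * (N + N)) _ ⟩
      suc k * (N + N)                            ∎
      where
      open ≡-Reasoning
      block : len (blockZ (k * 2)) ≡ N + N
      block = begin
        len (blockZ (k * 2))                     ≡⟨ len-++ (copyˡ path (D (k * 2))) _ ⟩
        len (copyˡ path (D (k * 2))) + suc (len (copyˡ (rev path) (D (1 + k * 2)) ++ʷ up v₃ (1 + k * 2) ∷ []))
          ≡⟨ cong₂ (λ a b → a + suc b) (len-copyˡ path _) (len-++ (copyˡ (rev path) (D (1 + k * 2))) _) ⟩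
        len path + suc (len (copyˡ (rev path) (D (1 + k * 2))) + 1)
          ≡⟨ cong (λ l → len path + suc (l + 1)) (trans (len-copyˡ (rev path) _) (len-rev path)) ⟩
        len path + suc (len path + 1)            ≡⟨ lemma (len path) ⟩
        suc (len path) + suc (len path)          ≡⟨ cong₂ _+_ len≡′ len≡′ ⟩
        N + N                                    ∎
        where
        lemma : ∀ p → p + suc (p + 1) ≡ suc p + suc p
        lemma = solve-∀

    tailX : Walk Π (v₀ , D 2) (v₂ , D (2 + M))
    tailX = rev (wire 2) ++ʷ riseX ++ʷ blocksX h ++ʷ rev (wire M) ++ʷ capX

    len-tailX : 4 + len tailX ≡ N * M
    len-tailX = begin
      4 + len tailX
        ≡⟨ cong (4 +_) (trans (len-++ (rev (wire 2)) _) (cong₂ _+_ (len-wire⁻ 2) (cong (3 +_) (trans (len-++ (blocksX h) _)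
             (cong₂ _+_ (len-blocksX h) (trans (len-++ (rev (wire M)) _) (cong (_+ 7) (len-wire⁻ M)))))))) ⟩
      4 + (1 + (ρ + ρ) + (3 + (h * (8 + (ρ + ρ)) + (1 + (ρ + ρ) + 7))))  ≡⟨ lemma ρ h ⟩
      (4 + ρ) * (4 + h * 2)                                               ≡⟨ cong (_* M) len≡ ⟩
      N * M                                                               ∎
      where
      open ≡-Reasoning
      lemma : ∀ r h → 4 + (1 + (r + r) + (3 + (h * (8 + (r + r)) + (1 + (r + r) + 7)))) ≡ (4 + r) * (4 + h * 2)
      lemma = solve-∀

    len-Y : len Y ≡ N * M
    len-Y = begin
      len Y
        ≡⟨ cong (3 +_) (trans (len-++ (line (2 + h * 2)) _) (cong₂ (λ a b → a + (1 + b)) (len-line (2 + h * 2))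
             (trans (len-++ (wire 3) _) (cong₂ _+_ (len-wire 3) (trans (len-++ (blocksY (suc h)) _) (cong (_+ 3) (len-blocksY (suc h)))))))) ⟩
      3 + (2 + h * 2 + (1 + (1 + (ρ + ρ) + (suc h * (6 + (ρ + ρ)) + 3))))  ≡⟨ lemma ρ h ⟩
      (4 + ρ) * (4 + h * 2)                                                 ≡⟨ cong (_* M) len≡ ⟩
      N * M                                                                 ∎
      where
      open ≡-Reasoning
      lemma : ∀ r h → 3 + (2 + h * 2 + (1 + (1 + (r + r) + (suc h * (6 + (r + r)) + 3)))) ≡ (4 + r) * (4 + h * 2)
      lemma = solve-∀

  len-Z : len Z ≡ N * M
  len-Z = trans (len-cast (cong (v₃ ,_) period₀) _) (trans (len-blocksZ (2 + h)) (lemma N h))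
    where
    lemma : ∀ N h → (2 + h) * (N + N) ≡ N * (4 + h * 2)
    lemma = solve-∀

  module _ (onto : ∀ d → ∃ λ n → D n ≡ d) where

    private
      half′ : ℕ
      half′ = N * (2 + h) ∸ 2

      -- The new cycle has N M edges, four of them before the rest, and M = 2 (2 + h).
      even′ : len tailX ≡ half′ * 2
      even′ = begin
        len tailX               ≡⟨ m+n∸m≡n 4 (len tailX) ⟨
        4 + len tailX ∸ 4       ≡⟨ cong (_∸ 4) (trans len-tailX (lemma N h)) ⟩
        N * (2 + h) * 2 ∸ 2 * 2 ≡⟨ *-distribʳ-∸ 2 (N * (2 + h)) 2 ⟨
        half′ * 2               ∎
        where
        open ≡-Reasoning
        lemma : ∀ N h → N * (4 + h * 2) ≡ N * (2 + h) * 2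
        lemma = solve-∀

      cast-∷ : ∀ {a b c d} (eq : c ≡ d) (e : Adj Π a b) (w : Walk Π b c) → castʷ eq (e ∷ w) ≡ e ∷ castʷ eq w
      cast-∷ refl e w = refl

      at₂ᶜ : V Δ → Set
      at₂ᶜ d = Walk Π (v₁ , d) (v₂ , d)

      len-subst : ∀ {d d′} (eq : d ≡ d′) (w : at₂ᶜ d) → len (subst at₂ᶜ eq w) ≡ len w
      len-subst refl w = refl

      on-subst : ∀ {d d′} (eq : d ≡ d′) {w : at₂ᶜ d} →
                 (∀ {u v} → On (along₁ (e₁₂ ⁻¹) ∷ w) u v → On (along₁ (e₁₂ ⁻¹) ∷ subst at₂ᶜ eq w) u v)
      on-subst refl o = o

      closed : _≡_ {A = V Π} (v₂ , D (2 + M)) (v₂ , D 2)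
      closed = cong (v₂ ,_) period₂

      toX : ∀ {x y} → On X x y → On (up v₂ 2 ∷ along₁ (e₁₂ ⁻¹) ∷ down v₁ 2 ∷ along₁ (e₀₁ ⁻¹) ∷ castʷ closed tailX) x y
      toX = subst (λ w → On w _ _) (trans (cast-∷ closed _ _) (cong (_ ∷_) (trans (cast-∷ closed _ _)
              (cong (along₁ (e₁₂ ⁻¹) ∷_) (trans (cast-∷ closed _ _) (cong (_ ∷_) (cast-∷ closed _ _)))))))

      everywhere : ∀ {a} {W : Walk Π a a} → (∀ x n → Visits W (x , D n)) → ∀ x → Visits W x
      everywhere f (x , d) with onto d
      ... | n , refl = f x n

    -- The gadget reproduces what it consumes: of the square over the edge v₁v₂ between the levels 2
    -- and 3, three sides are consecutive edges of X, and the fourth, at level 2, belongs to Y. This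
    -- is why X is written as starting at (v₂, 2).
    corner : Corner Π (N * M)
    corner = record
      { e₀₁   = up v₂ 2
      ; e₁₂   = along₁ (e₁₂ ⁻¹)
      ; e₂₃   = down v₁ 2
      ; e₃₄   = along₁ (e₀₁ ⁻¹)
      ; rest  = castʷ closed tailX
      ; half  = half′
      ; even  = trans (len-cast closed tailX) even′
      ; len≡  = trans (cong (4 +_) (len-cast closed tailX)) len-tailX
      ; e₀₃   = along₁ (e₁₂ ⁻¹)
      ; path  = subst at₂ᶜ period₂ restY
      ; len≡′ = trans (cong suc (len-subst period₂ restY)) len-Y
      ; all   = λ x → on-visits (toX (inj₁ (proj₂ (everywhere visitsX x))))
      ; all′  = λ x → on-visits (on-subst period₂ (inj₁ (proj₂ (everywhere visitsY x))))
      }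

    fromX-corner : ∀ {x y} → On X x y → On (Corner.C corner) x y
    fromX-corner = toX

    fromY-corner : ∀ {x y} → On Y x y → On (Corner.C′ corner) x y
    fromY-corner = on-subst period₂

    visits-Z : ∀ x → Visits Z x
    visits-Z = everywhere visitsZ

-- Hamiltonian decompositions of even cubes

record HamCycle (Γ : Graph) (N : ℕ) : Set where
  field
    {base} : V Γ
    walk   : Walk Γ base base
    uniq   : Unique (verts walk)
    len≡   : len walk ≡ N
    visits : ∀ x → Visits walk x

open HamCycle public

hamCycle : ∀ {Γ N a} → V Γ ↔ Fin N → (w : Walk Γ a a) → len w ≡ N → (∀ x → Visits w x) → HamCycle Γ N
hamCycle V↔N w len≡ vis = record
  { walk = w
  ; uniq = covering⇒unique V↔N (verts w) (trans (length-verts w) len≡) (λ x → visits⇒∈ (vis x))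
  ; len≡ = len≡
  ; visits = vis
  }

-- The corner may start its cycles at other vertices than P and Q do, so they are compared through
-- their edges.
record Chorded {Γ : Graph} {N : ℕ} (P Q : HamCycle Γ N) : Set where
  field
    corner : Corner Γ N
    on₀    : ∀ {x y} → On (walk P) x y → On (Corner.C corner) x y
    on₁    : ∀ {x y} → On (walk Q) x y → On (Corner.C′ corner) x y

record Ham (Γ : Graph) (m N : ℕ) : Set where
  field
    cycle : Fin m → HamCycle Γ N
    cov   : ∀ {x y} → Adj Γ x y → ∃ λ b → On (walk (cycle b)) x y

  unrolled : ∀ {h} → N ≡ 4 + h * 2 → Fin m → Cyc Γ (4 + h * 2)
  unrolled eq b = Unroll.cyc (walk (cycle b)) (uniq (cycle b)) (trans (len≡ (cycle b)) eq)

open Ham public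

module _ {Γ : Graph} where

  rotate : ∀ {a u v} {w : Walk Γ a a} → Step w u v → Walk Γ v u
  rotate s = proj₂ (splitStep s) ++ʷ proj₁ (splitStep s)

  len-split : ∀ {a b u v} {w : Walk Γ a b} (s : Step w u v) →
              suc (len (proj₂ (splitStep s)) + len (proj₁ (splitStep s))) ≡ len w
  len-split here      = cong suc (+-identityʳ _)
  len-split (there s) = cong suc (trans (+-suc _ _) (len-split s))

  len-rotate : ∀ {a u v} {w : Walk Γ a a} (s : Step w u v) → suc (len (rotate s)) ≡ len w
  len-rotate s = trans (cong suc (len-++ (proj₂ (splitStep s)) _)) (len-split s)

  step-split : ∀ {a b u v x y} {w : Walk Γ a b} (s : Step w u v) → Step w x y →
               Step (proj₁ (splitStep s)) x y ⊎ (x ≡ u × y ≡ v) ⊎ Step (proj₂ (splitStep s)) x y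
  step-split here      here       = inj₂ (inj₁ (refl , refl))
  step-split here      (there s′) = inj₂ (inj₂ s′)
  step-split (there s) here       = inj₁ here
  step-split (there s) (there s′) with step-split s s′
  ... | inj₁ s″ = inj₁ (there s″)
  ... | inj₂ o  = inj₂ o

  step-rotate : ∀ {a u v x y} {w : Walk Γ a a} (s : Step w u v) {e : Adj Γ u v} → Step w x y → Step (e ∷ rotate s) x y
  step-rotate s s′ with step-split s s′
  ... | inj₁ s″                   = there (step-++ʳ (proj₂ (splitStep s)) s″)
  ... | inj₂ (inj₁ (refl , refl)) = here
  ... | inj₂ (inj₂ s″)            = there (step-++ˡ _ s″)

  -- Q is rotated to begin with the given step, which becomes the chord; P already begins with the
  -- four vertices of the corner.
  chorded : ∀ {N h} → N ≡ 4 + h * 2 → (P Q : HamCycle Γ N) →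
            Step (walk Q) (at (walk P) 0) (at (walk P) 3) → Chorded P Q
  chorded {h = h} refl record { walk = e₀ ∷ e₁ ∷ e₂ ∷ e₃ ∷ w ; len≡ = eq ; visits = vis } Q s = record
    { corner = record
      { e₀₁ = e₀ ; e₁₂ = e₁ ; e₂₃ = e₂ ; e₃₄ = e₃ ; rest = w
      ; half = h ; even = cong (_∸ 4) eq ; len≡ = eq
      ; e₀₃ = step-adj s ; path = rotate s ; len≡′ = trans (len-rotate s) (len≡ Q)
      ; all = vis ; all′ = λ x → _ , step-rotate s (proj₂ (visits Q x)) }
    ; on₀ = id
    ; on₁ = Sum.map (step-rotate s) (step-rotate s)
    }

-- With all vertices special and t = 2 there are two Kotzig cycles, one for each parity of the
-- start, and every level over every vertex is reached from both parities. So both are Hamiltonian.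
module KotzigHam {Γ Δ : Graph} (h k : ℕ) (P : HamCycle Γ (4 + h * 2)) (Q : HamCycle Δ (4 + k * 2)) where

  private
    all-special : V Γ → Bool
    all-special _ = true

    special≡ : cnt all-special (verts (walk P)) ≡ (1 + h) * 2 + 2
    special≡ = trans (cnt-all (λ _ → refl) (verts (walk P))) (trans (length-verts (walk P)) (trans (len≡ P) (+-comm 2 (2 + h * 2))))

    module U = Unroll (walk Q) (uniq Q) (len≡ Q)
    module K = Kotzig (walk P) all-special (1 + h) (2 + k) 2 U.cyc special≡

  open Cyc U.cyc

  private
    onto : ∀ d → ∃ λ n → D n ≡ d
    onto d = let n , eq , _ = U.step-cyc (proj₂ (visits Q d)) in n , eq

    visitsA : ∀ i x → Visits (K.A (toℕ {2} i)) x
    visitsA i (x , d) with onto d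
    ... | n , refl with K.cover-visit 1 refl (visits P x) refl n (odd (toℕ i))
    visitsA Fin.zero           (x , d) | n , refl | 0 , _ , _ , vis = vis
    visitsA (Fin.suc Fin.zero) (x , d) | n , refl | 1 , _ , _ , vis = vis
    visitsA Fin.zero           (x , d) | n , refl | 1 , _ , () , vis
    visitsA (Fin.suc Fin.zero) (x , d) | n , refl | 0 , _ , () , vis
    visitsA i                  (x , d) | n , refl | suc (suc _) , s≤s (s≤s ()) , _

  A : Fin 2 → HamCycle (Γ ⊠ Δ) ((4 + h * 2) * (4 + k * 2))
  A i = record
    { walk = K.A (toℕ i)
    ; uniq = K.A-unique ≤-refl (uniq P) (toℕ i)
    ; len≡ = trans (K.A-len (toℕ i)) (trans (cong₂ (λ a b → (2 + k) * (a + b))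
               (trans special≡ (+-comm ((1 + h) * 2) 2)) (len≡ P)) (lemma h k))
    ; visits = visitsA i
    }
    where
    lemma : ∀ h k → (2 + k) * ((4 + h * 2) + (4 + h * 2)) ≡ (4 + h * 2) * (4 + k * 2)
    lemma = solve-∀

  private
    pick : ∀ {x y} → (∃ λ ε → ε < 2 × On (K.A ε) x y) → ∃ λ i → On (walk (A i)) x y
    pick (0 , _ , o) = Fin.zero , o
    pick (1 , _ , o) = Fin.suc Fin.zero , o
    pick (suc (suc _) , s≤s (s≤s ()) , _)

  along : ∀ {x y} → On (walk P) x y → ∀ d → ∃ λ i → On (walk (A i)) (x , d) (y , d)
  along o d with onto d
  along (inj₁ s) d | n , refl = let ε , ε< , s′ = K.cover-along s n in pick (ε , ε< , inj₁ s′)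
  along (inj₂ s) d | n , refl = let ε , ε< , s′ = K.cover-along s n in pick (ε , ε< , inj₂ s′)

  rises : ∀ {d d′} → On (walk Q) d d′ → ∀ x → ∃ λ i → On (walk (A i)) (x , d) (x , d′)
  rises (inj₁ s) x with U.step-cyc s
  ... | n , refl , refl = pick (K.cover-rise (visits P x) refl n)
  rises (inj₂ s) x with U.step-cyc s
  ... | n , refl , refl = let i , o = pick (K.cover-rise (visits P x) refl n) in i , On-sym o

module _ {Γ : Graph} where

  at-++ : ∀ {a b c} (w : Walk Γ a b) (w′ : Walk Γ b c) {n} → n < len w → at (w ++ʷ w′) n ≡ at w n
  at-++ (e ∷ w) w′ {zero}  _        = refl
  at-++ (e ∷ w) w′ {suc n} (s≤s n<) = at-++ w w′ n<

  at-cast : ∀ {a b c} (eq : b ≡ c) (w : Walk Γ a b) n → at (castʷ eq w) n ≡ at w n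
  at-cast refl w n = refl

-- The cycle A 0 starts with the three edges (u, 0) (u, 1) (v, 1) (v, 0), whereas A 1 crosses from (u, 0) to (v, 0)
-- in its last block.
kotzig-chorded : ∀ {Γ Δ : Graph} h k {j} (P : HamCycle Γ (4 + h * 2)) (Q : HamCycle Δ (4 + k * 2)) →
                 (eq : (4 + h * 2) * (4 + k * 2) ≡ 4 + j * 2) → let open KotzigHam h k P Q in
                 Chorded (A Fin.zero) (A (Fin.suc Fin.zero))
kotzig-chorded {Γ} {Δ} h k {j} P@record { base = u ; walk = _∷_ {b = v} e₀ (e₁ ∷ w) } Q eq =
  chorded {h = j} eq (A Fin.zero) (A (Fin.suc Fin.zero)) (subst₂ (Step (walk (A (Fin.suc Fin.zero)))) (sym at₀) (sym at₃) crossing)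
  where
  open KotzigHam h k P Q
  module U = Unroll (walk Q) (uniq Q) (len≡ Q)
  open Cyc U.cyc
  module T = Torus Γ U.cyc (λ _ → true) (1 + h)
  module K = Kotzig (walk P) (λ _ → true) (1 + h) (2 + k) 2 U.cyc
    (trans (cnt-all (λ _ → refl) (verts (walk P))) (trans (length-verts (walk P)) (trans (len≡ P) (+-comm 2 (2 + h * 2)))))
  at-blocks : ∀ n i → i < 4 → at (K.blocks (suc n) 0) i ≡ at (T.run (walk P) 0 0) i
  at-blocks zero    i i< = at-cast {Γ ⊠ Δ} (K.ascent 0 0) (T.run (walk P) 0 0) i
  at-blocks (suc n) i i< = trans (at-++ (K.blocks (suc n) 0) _ (<-≤-trans i< (long n))) (at-blocks n i i<)
    where
    long : ∀ n → 4 ≤ len (K.blocks (suc n) 0)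
    long n = subst (4 ≤_) (sym (K.blocks-len (suc n) 0)) (m≤n⇒m≤n+o _ (m≤n⇒m≤o+n (cnt (λ _ → true) (verts (walk P)))
      (subst (4 ≤_) (sym (len≡ P)) (m≤m+n 4 (h * 2)))))
  at₀ : at (walk (A Fin.zero)) 0 ≡ (u , D 0)
  at₀ = at-0 (walk (A Fin.zero))
  at₃ : at (walk (A Fin.zero)) 3 ≡ (v , D 0)
  at₃ = trans (at-cast {Γ ⊠ Δ} (K.closing 0) (K.blocks (2 + k) 0) 3) (at-blocks (1 + k) 3 ≤-refl)
  crossing : Step (walk (A (Fin.suc Fin.zero))) (u , D 0) (v , D 0)
  -- The last block of `A 1` starts at level c - 1. Its first move climbs to level c, which is level
  -- 0, and its second one crosses from u to v.
  crossing = subst (λ d → Step (walk (A (Fin.suc Fin.zero))) (u , d) (v , d))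
    (trans (cong D (lem k)) (period 0))
    (K.A-step {r = 1 + k} ≤-refl (there here))
    where
    lem : ∀ k → 1 + ((1 + k) * 2 + 1) ≡ (2 + k) * 2 + 0
    lem = solve-∀

Four : ℕ → Set
Four N = ∃ λ h → N ≡ 4 + h * 2

Four-* : ∀ {M N} → Four M → Four N → Four (M * N)
Four-* (h , refl) (k , refl) = 6 + 4 * h + 4 * k + 2 * (h * k) , lemma h k
  where
  lemma : ∀ h k → (4 + h * 2) * (4 + k * 2) ≡ 4 + (6 + 4 * h + 4 * k + 2 * (h * k)) * 2
  lemma = solve-∀

via-remQuot : ∀ {m n} {P : Fin m × Fin n → Set} → (∃₂ λ b i → P (b , i)) → ∃ λ c → P (Fin.remQuot n c)
via-remQuot {P = P} (b , i , p) = Fin.combine b i , subst P (sym (Fin.remQuot-combine b i)) p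

×↔Fin : ∀ {A B : Set} {m n} → A ↔ Fin m → B ↔ Fin n → (A × B) ↔ Fin (m * n)
×↔Fin A↔ B↔ = ↔-sym Fin.*↔× ↔-∘ (A↔ ×-↔ B↔)

ham-even : ∀ {Γ Δ m M N} → Ham Γ (suc m) M → Ham Δ (suc m) N → Four M → Four N →
           Σ (Ham (Γ ⊠ Δ) (suc m * 2) (M * N)) λ H → Chorded (cycle H Fin.zero) (cycle H (Fin.suc Fin.zero))
ham-even {Γ} {Δ} {m} {M} {N} H₁ H₂ (h , refl) (k , refl) =
  record { cycle = λ c → torus (Fin.remQuot 2 c) ; cov = λ e → via-remQuot {suc m} {2} (covers e) } ,
  kotzig-chorded h k {j = proj₁ (Four-* (h , refl) (k , refl))} (cycle H₁ Fin.zero) (cycle H₂ Fin.zero) (proj₂ (Four-* (h , refl) (k , refl)))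
  where
  torus : Fin (suc m) × Fin 2 → HamCycle (Γ ⊠ Δ) (M * N)
  torus (b , i) = KotzigHam.A h k (cycle H₁ b) (cycle H₂ b) i
  covers : ∀ {x y} → Adj (Γ ⊠ Δ) x y → ∃₂ λ b i → On (walk (torus (b , i))) x y
  covers (along₁ e) = let b , o = cov H₁ e in b , KotzigHam.along h k (cycle H₁ b) (cycle H₂ b) o _
  covers (along₂ e) = let b , o = cov H₂ e in b , KotzigHam.rises h k (cycle H₁ b) (cycle H₂ b) o _

-- Cycles 0 and 1 of the first graph meet cycle 0 of the second in the gadget, which gives three
-- cycles; the remaining m cycles on each side are paired and give two each. The new chorded pair is
-- X and Y.
ham-odd : ∀ {Γ Δ m M N} → V Γ ↔ Fin M → V Δ ↔ Fin N →
          (H₁ : Ham Γ (2 + m) M) → Chorded (cycle H₁ Fin.zero) (cycle H₁ (Fin.suc Fin.zero)) →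
          Ham Δ (1 + m) N → Four M → Four N →
          Σ (Ham (Γ ⊠ Δ) (3 + m * 2) (M * N)) λ H → Chorded (cycle H Fin.zero) (cycle H (Fin.suc Fin.zero))
ham-odd {Γ} {Δ} {m} {M} {N} ΓM ΔN H₁ ch H₂ (h , refl) (k , refl) =
  record { cycle = λ c → family (Fin.splitAt 3 c) ; cov = λ {x} {y} e → reindex {λ K → On (walk K) x y} (covers e) } ,
  record { corner = corner′ ; on₀ = id ; on₁ = id }
  where
  open Chorded ch renaming (corner to κ)
  module U = Unroll (walk (cycle H₂ Fin.zero)) (uniq (cycle H₂ Fin.zero)) (len≡ (cycle H₂ Fin.zero))
  open Cyc U.cyc
  module G = Gadget κ k U.cyc

  onto : ∀ d → ∃ λ n → D n ≡ d
  onto d = let n , eq , _ = U.step-cyc (proj₂ (visits (cycle H₂ Fin.zero) d)) in n , eq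

  corner′ : Corner (Γ ⊠ Δ) (M * N)
  corner′ = G.corner onto

  ΓΔ : V (Γ ⊠ Δ) ↔ Fin (M * N)
  ΓΔ = ×↔Fin ΓM ΔN

  torus : Fin m × Fin 2 → HamCycle (Γ ⊠ Δ) (M * N)
  torus (b , i) = KotzigHam.A h k (cycle H₁ (Fin.suc (Fin.suc b))) (cycle H₂ (Fin.suc b)) i

  family : Fin 3 ⊎ Fin (m * 2) → HamCycle (Γ ⊠ Δ) (M * N)
  family (inj₁ Fin.zero)                     = hamCycle ΓΔ (Corner.C corner′) (Corner.len≡ corner′) (Corner.all corner′)
  family (inj₁ (Fin.suc Fin.zero))           = hamCycle ΓΔ (Corner.C′ corner′) (Corner.len≡′ corner′) (Corner.all′ corner′)
  family (inj₁ (Fin.suc (Fin.suc Fin.zero))) = hamCycle ΓΔ G.Z G.len-Z (G.visits-Z onto)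
  family (inj₂ c)                            = torus (Fin.remQuot 2 c)

  reindex : ∀ {P : HamCycle (Γ ⊠ Δ) (M * N) → Set} → (∃ λ c → P (family c)) → ∃ λ c → P (family (Fin.splitAt 3 c))
  reindex {P} (c , p) = Fin.join 3 _ c , subst (P ∘ family) (sym (Fin.splitAt-join 3 _ c)) p

  gadget : ∀ {x y} → G.Some x y → ∃ λ c → On (walk (family c)) x y
  gadget (G.inX o) = inj₁ Fin.zero , G.fromX-corner onto o
  gadget (G.inY o) = inj₁ (Fin.suc Fin.zero) , G.fromY-corner onto o
  gadget (G.inZ o) = inj₁ (Fin.suc (Fin.suc Fin.zero)) , o

  flip : ∀ {x y} → (∃ λ c → On (walk (family c)) y x) → ∃ λ c → On (walk (family c)) x y
  flip (c , o) = c , On-sym o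

  regular : ∀ {x y} → (∃₂ λ b i → On (walk (torus (b , i))) x y) → ∃ λ c → On (walk (family c)) x y
  regular o = let c , o′ = via-remQuot {m} {2} o in inj₂ c , o′

  covers : ∀ {x y} → Adj (Γ ⊠ Δ) x y → ∃ λ c → On (walk (family c)) x y
  covers (along₁ {u} {v} {d} e) with cov H₁ e | onto d
  ... | Fin.zero , o | n , refl with on₀ o
  ...   | inj₁ s = gadget (G.cover-C s n)
  ...   | inj₂ s = flip (gadget (G.cover-C s n))
  covers (along₁ {u} {v} {d} e) | Fin.suc Fin.zero , o | n , refl with on₁ o
  ...   | inj₁ s = gadget (G.cover-C′ s n)
  ...   | inj₂ s = flip (gadget (G.cover-C′ s n))
  covers (along₁ {u} {v} {d} e) | Fin.suc (Fin.suc b) , o | n , refl =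
    regular (b , KotzigHam.along h k (cycle H₁ (Fin.suc (Fin.suc b))) (cycle H₂ (Fin.suc b)) o _)
  covers (along₂ {u} e) with cov H₂ e
  ... | Fin.suc b , o = regular (b , KotzigHam.rises h k (cycle H₁ (Fin.suc (Fin.suc b))) (cycle H₂ (Fin.suc b)) o u)
  ... | Fin.zero , inj₁ s with U.step-cyc s
  ...   | n , refl , refl = gadget (G.cover-rise u n)
  covers (along₂ {u} e) | Fin.zero , inj₂ s with U.step-cyc s
  ...   | n , refl , refl = flip (gadget (G.cover-rise u n))

-- Transport along graph isomorphisms

module Transport {Γ Δ : Graph} (iso : Γ ≅ Δ) where
  open _≅_ iso

  mapʷ : ∀ {a b} → Walk Γ a b → Walk Δ (to a) (to b)
  mapʷ []      = []
  mapʷ (e ∷ w) = to-~ e ∷ mapʷ w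

  step-map : ∀ {a b x y} {w : Walk Γ a b} → Step w x y → Step (mapʷ w) (to x) (to y)
  step-map here      = here
  step-map (there s) = there (step-map s)

  on-map : ∀ {a b x y} {w : Walk Γ a b} → On w x y → On (mapʷ w) (to x) (to y)
  on-map = Sum.map step-map step-map

  on-map⁻ : ∀ {a b x y} {w : Walk Γ a b} → On w (from x) (from y) → On (mapʷ w) x y
  on-map⁻ o = subst₂ (On (mapʷ _)) (to∘from _) (to∘from _) (on-map o)

  visits-map⁻ : ∀ {a b x} {w : Walk Γ a b} → Visits w (from x) → Visits (mapʷ w) x
  visits-map⁻ {x = x} (_ , s) = subst (Visits (mapʷ _)) (to∘from x) (_ , step-map s)

  unmap : ∀ {a b x y} {w : Walk Γ a b} → Step (mapʷ w) x y → Step w (from x) (from y)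
  unmap {w = e ∷ w} here      = subst₂ (Step _) (sym (from∘to _)) (sym (from∘to _)) here
  unmap {w = e ∷ w} (there s) = there (unmap s)

  len-map : ∀ {a b} (w : Walk Γ a b) → len (mapʷ w) ≡ len w
  len-map []      = refl
  len-map (e ∷ w) = cong suc (len-map w)

  verts-map : ∀ {a b} (w : Walk Γ a b) → verts (mapʷ w) ≡ map to (verts w)
  verts-map []      = refl
  verts-map (e ∷ w) = cong (_ ∷_) (verts-map w)

  uniq-map : ∀ {a b} (w : Walk Γ a b) → Unique (verts w) → Unique (verts (mapʷ w))
  uniq-map w u = subst Unique (sym (verts-map w))
    (Unique.map⁺ (λ {x} {y} eq → trans (sym (from∘to x)) (trans (cong from eq) (from∘to y))) u)

  hamCycle-map : ∀ {N} → HamCycle Γ N → HamCycle Δ N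
  hamCycle-map P = record
    { walk = mapʷ (walk P)
    ; uniq = uniq-map (walk P) (uniq P)
    ; len≡ = trans (len-map (walk P)) (len≡ P)
    ; visits = λ x → visits-map⁻ (visits P (from x))
    }

  ham-map : ∀ {m N} → Ham Γ m N → Ham Δ m N
  ham-map H = record
    { cycle = λ b → hamCycle-map (cycle H b)
    ; cov = λ e → let b , o = cov H (from-~ e) in b , on-map⁻ o
    }

  chorded-map : ∀ {N} {P Q : HamCycle Γ N} → Chorded P Q → Chorded (hamCycle-map P) (hamCycle-map Q)
  chorded-map ch = record
    { corner = record
      { e₀₁ = to-~ e₀₁ ; e₁₂ = to-~ e₁₂ ; e₂₃ = to-~ e₂₃ ; e₃₄ = to-~ e₃₄ ; rest = mapʷ rest
      ; half = half ; even = trans (len-map rest) even ; len≡ = trans (cong (4 +_) (len-map rest)) (Corner.len≡ corner)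
      ; e₀₃ = to-~ e₀₃ ; path = mapʷ path ; len≡′ = trans (cong suc (len-map path)) len≡′
      ; all = λ x → visits-map⁻ {w = C} (all (from x)) ; all′ = λ x → visits-map⁻ {w = C′} (all′ (from x))
      }
    ; on₀ = λ o → on-map⁻ {w = C} (on₀ (Sum.map unmap unmap o))
    ; on₁ = λ o → on-map⁻ {w = C′} (on₁ (Sum.map unmap unmap o))
    }
    where
    open Chorded ch
    open Corner corner hiding (len≡)

-- Cubes as products of cubes, and the induction for even cubes

Adjacent-sym : ∀ {n} {u v : Vertex n} → Adjacent u v → Adjacent v u
Adjacent-sym {u = u} (i , eq) = i , trans
  (sym (trans (Vec.updateAt-updateAt-local i {h = id} u (not-involutive _)) (Vec.updateAt-id i u)))
  (cong (_[ i ]%= not) (sym eq))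

cube : ℕ → Graph
cube n = record { V = Vertex n ; _~_ = Adjacent ; ~-sym = Adjacent-sym }

take-++ : ∀ {A : Set} {m n} (u : Vec A m) (w : Vec A n) → Vec.take m (u Vec.++ w) ≡ u
take-++ []      w = refl
take-++ (x ∷ u) w = cong (x ∷_) (take-++ u w)

drop-++ : ∀ {A : Set} {m n} (u : Vec A m) (w : Vec A n) → Vec.drop m (u Vec.++ w) ≡ w
drop-++ []      w = refl
drop-++ (x ∷ u) w = drop-++ u w

update-++ˡ : ∀ {A : Set} {m n} (f : A → A) (u : Vec A m) (w : Vec A n) i →
             (u [ i ]%= f) Vec.++ w ≡ (u Vec.++ w) [ i Fin.↑ˡ n ]%= f
update-++ˡ f (x ∷ u) w Fin.zero    = refl
update-++ˡ f (x ∷ u) w (Fin.suc i) = cong (x ∷_) (update-++ˡ f u w i)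

update-++ʳ : ∀ {A : Set} {m n} (f : A → A) (u : Vec A m) (w : Vec A n) i →
             u Vec.++ (w [ i ]%= f) ≡ (u Vec.++ w) [ m Fin.↑ʳ i ]%= f
update-++ʳ f []      w i = refl
update-++ʳ f (x ∷ u) w i = cong (x ∷_) (update-++ʳ f u w i)

Adjacent-split : ∀ m {n} {x y : Vertex (m + n)} → Adjacent x y →
                 Prod Adjacent Adjacent (Vec.take m x , Vec.drop m x) (Vec.take m y , Vec.drop m y)
Adjacent-split zero    e = along₂ e
Adjacent-split (suc m) {x = b ∷ x} (Fin.zero , refl)  = along₁ (Fin.zero , refl)
Adjacent-split (suc m) {x = b ∷ x} (Fin.suc i , refl) = cons (Adjacent-split m (i , refl))
  where
  cons : ∀ {k l} {u u′ : Vertex k} {w w′ : Vertex l} →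
         Prod Adjacent Adjacent (u , w) (u′ , w′) → Prod Adjacent Adjacent (b ∷ u , w) (b ∷ u′ , w′)
  cons (along₁ (j , refl)) = along₁ (Fin.suc j , refl)
  cons (along₂ e)          = along₂ e

cube-⊠ : ∀ m n → (cube m ⊠ cube n) ≅ cube (m + n)
cube-⊠ m n = record
  { to      = λ (u , w) → u Vec.++ w
  ; from    = λ x → Vec.take m x , Vec.drop m x
  ; to∘from = Vec.take++drop≡id m
  ; from∘to = λ (u , w) → cong₂ _,_ (take-++ u w) (drop-++ u w)
  ; to-~    = λ { (along₁ {w = w} (i , refl)) → i Fin.↑ˡ n , update-++ˡ not _ w i
                ; (along₂ {u} (i , refl)) → m Fin.↑ʳ i , update-++ʳ not u _ i }
  ; from-~  = Adjacent-split m
  }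

cube↔Fin : ∀ n → Vertex n ↔ Fin (2 ^ n)
cube↔Fin zero    = ↔-sym Fin.1↔⊤ ↔-∘ mk↔ₛ′ (λ _ → tt) (λ _ → []) (λ _ → refl) (λ { [] → refl })
cube↔Fin (suc n) = ×↔Fin (↔-sym Fin.2↔Bool) (cube↔Fin n) ↔-∘
  mk↔ₛ′ (λ x → Vec.head x , Vec.tail x) (λ (b , u) → b ∷ u) (λ _ → refl) (λ { (b ∷ u) → refl })

ham-square : Ham (cube 2) 1 4
ham-square = record
  { cycle = λ _ → record
    { walk = square
    ; uniq = ((λ ()) ∷ (λ ()) ∷ (λ ()) ∷ []) ∷ ((λ ()) ∷ (λ ()) ∷ []) ∷ ((λ ()) ∷ []) ∷ [] ∷ []
    ; len≡ = refl
    ; visits = λ { (false ∷ false ∷ []) → _ , here ; (true ∷ false ∷ []) → _ , there here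
                 ; (true ∷ true ∷ []) → _ , there (there here) ; (false ∷ true ∷ []) → _ , there (there (there here)) }
    }
  ; cov = λ e → Fin.zero , covers e
  }
  where
  square : Walk (cube 2) (false ∷ false ∷ []) (false ∷ false ∷ [])
  square = _∷_ {b = true ∷ false ∷ []} (Fin.zero , refl) (_∷_ {b = true ∷ true ∷ []} (Fin.suc Fin.zero , refl)
           (_∷_ {b = false ∷ true ∷ []} (Fin.zero , refl) ((Fin.suc Fin.zero , refl) ∷ [])))
  covers : ∀ {x y} → Adjacent x y → On square x y
  covers {false ∷ false ∷ []} (Fin.zero , refl)         = inj₁ here
  covers {true ∷ false ∷ []}  (Fin.zero , refl)         = inj₂ here
  covers {false ∷ true ∷ []}  (Fin.zero , refl)         = inj₂ (there (there here))
  covers {true ∷ true ∷ []}   (Fin.zero , refl)         = inj₁ (there (there here))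
  covers {false ∷ false ∷ []} (Fin.suc Fin.zero , refl) = inj₂ (there (there (there here)))
  covers {true ∷ false ∷ []}  (Fin.suc Fin.zero , refl) = inj₁ (there here)
  covers {false ∷ true ∷ []}  (Fin.suc Fin.zero , refl) = inj₁ (there (there (there here)))
  covers {true ∷ true ∷ []}   (Fin.suc Fin.zero , refl) = inj₂ (there here)

four-^ : ∀ k → Four (2 ^ (2 + k))
four-^ k = Nat.pred (2 ^ k) * 2 , trans (cong (λ z → 2 * (2 * z)) (sym (suc-pred (2 ^ k) {{m^n≢0 2 k}}))) (lemma (Nat.pred (2 ^ k)))
  where
  lemma : ∀ p → 2 * (2 * suc p) ≡ 4 + p * 2 * 2
  lemma = solve-∀

ChordedHam : (Γ : Graph) (m N : ℕ) → Set
ChordedHam Γ m N = Σ (Ham Γ (2 + m) N) λ H → Chorded (cycle H Fin.zero) (cycle H (Fin.suc Fin.zero))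

chordedHam-cube : ∀ m n {k l} → m + n ≡ l → ChordedHam (cube m ⊠ cube n) k (2 ^ m * 2 ^ n) → ChordedHam (cube l) k (2 ^ l)
chordedHam-cube m n {k} refl (H , ch) =
  subst (ChordedHam (cube (m + n)) k) (sym (^-distribˡ-+-* 2 m n)) (T.ham-map H , T.chorded-map ch)
  where module T = Transport (cube-⊠ m n)

-- The odd step consumes a chorded pair, so each step has to produce one. Q_2 has a single
-- Hamiltonian cycle and is exempt.
HamCube : ℕ → Set
HamCube 0             = ⊤
HamCube 1             = Ham (cube 2) 1 4
HamCube (suc (suc m)) = ChordedHam (cube ((2 + m) * 2)) m (2 ^ ((2 + m) * 2))

ham : ∀ m → HamCube (suc m) → Ham (cube (suc m * 2)) (suc m) (2 ^ (suc m * 2))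
ham zero    H = H
ham (suc m) H = proj₁ H

halve-ℕ : ∀ j → (∃ λ i → j ≡ i * 2) ⊎ (∃ λ i → j ≡ 1 + i * 2)
halve-ℕ zero    = inj₁ (0 , refl)
halve-ℕ (suc j) with halve-ℕ j
... | inj₁ (i , refl) = inj₂ (i , refl)
... | inj₂ (i , refl) = inj₁ (suc i , refl)

hamCube : ∀ m → HamCube m
hamCube = <-rec HamCube step
  where
  step : ∀ m → (∀ {k} → k < m → HamCube k) → HamCube m
  step 0 rec = tt
  step 1 rec = ham-square
  step (suc (suc j)) rec with halve-ℕ j
  ... | inj₁ (i , refl) = chordedHam-cube (suc i * 2) (suc i * 2) (lemma i)
          (ham-even (ham i H) (ham i H) (four-^ (i * 2)) (four-^ (i * 2)))
    where
    H : HamCube (suc i)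
    H = rec (s≤s (s≤s (m≤m*n i 2)))
    lemma : ∀ i → suc i * 2 + suc i * 2 ≡ (2 + i * 2) * 2
    lemma = solve-∀
  -- The half-dimension 3 + 2i is (2 + i) + (1 + i). The larger part is at least 2, so it can supply
  -- the chorded pair.
  ... | inj₂ (i , refl) = chordedHam-cube ((2 + i) * 2) (suc i * 2) (lemma i)
          (ham-odd (cube↔Fin ((2 + i) * 2)) (cube↔Fin (suc i * 2)) (proj₁ H₁) (proj₂ H₁) (ham i H₂) (four-^ ((1 + i) * 2)) (four-^ (i * 2)))
    where
    H₁ : HamCube (2 + i)
    H₁ = rec (s≤s (s≤s (s≤s (m≤m*n i 2))))
    H₂ : HamCube (suc i)
    H₂ = rec (s≤s (s≤s (m≤n⇒m≤1+n (m≤m*n i 2))))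
    lemma : ∀ i → (2 + i) * 2 + suc i * 2 ≡ (3 + i * 2) * 2
    lemma = solve-∀

-- Labelled families of cycles

infix 4 _==_ _==ᵇ_

_==ᵇ_ : Bool → Bool → Bool
a ==ᵇ b = not (a xor b)

_==_ : ∀ {n} → Vec Bool n → Vec Bool n → Bool
[]      == []      = true
(a ∷ u) == (b ∷ v) = (a ==ᵇ b) ∧ (u == v)

==ᵇ-refl : ∀ a → (a ==ᵇ a) ≡ true
==ᵇ-refl true  = refl
==ᵇ-refl false = refl

==-refl : ∀ {n} (u : Vec Bool n) → (u == u) ≡ true
==-refl []      = refl
==-refl (a ∷ u) = cong₂ _∧_ (==ᵇ-refl a) (==-refl u)

==⇒≡ : ∀ {n} (u v : Vec Bool n) → (u == v) ≡ true → u ≡ v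
==⇒≡ []          []          _  = refl
==⇒≡ (true ∷ u)  (true ∷ v)  eq = cong (true ∷_) (==⇒≡ u v eq)
==⇒≡ (false ∷ u) (false ∷ v) eq = cong (false ∷_) (==⇒≡ u v eq)

==-++ : ∀ {m n} (u v : Vec Bool m) (u′ v′ : Vec Bool n) →
        (u Vec.++ u′ == v Vec.++ v′) ≡ (u == v) ∧ (u′ == v′)
==-++ []      []      u′ v′ = refl
==-++ (a ∷ u) (b ∷ v) u′ v′ = trans (cong ((a ==ᵇ b) ∧_) (==-++ u v u′ v′)) (sym (∧-assoc (a ==ᵇ b) _ _))

==-xor : ∀ {n} (u w x : Vec Bool n) → (Vec.zipWith _xor_ u w == x) ≡ (u == Vec.zipWith _xor_ x w)
==-xor []      []      []      = refl
==-xor (a ∷ u) (b ∷ w) (c ∷ x) = cong₂ _∧_ (bits a b c) (==-xor u w x)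
  where
  bits : ∀ a b c → ((a xor b) ==ᵇ c) ≡ (a ==ᵇ (c xor b))
  bits true  true  true  = refl
  bits true  true  false = refl
  bits true  false true  = refl
  bits true  false false = refl
  bits false true  true  = refl
  bits false true  false = refl
  bits false false true  = refl
  bits false false false = refl

bit : Bool → ℕ
bit b = if b then 1 else 0

-- Cycles of length L indexed by a class in B and a position in U. In each class every vertex is special on some cycle,
-- and on every cycle each of the 2 ^ R labels is carried by exactly e special vertices.
record Fam (Γ : Graph) (B U : Set) (R L e : ℕ) : Set where
  field
    {root} : B → U → V Γ
    path   : ∀ b m → Walk Γ (root b m) (root b m)
    unique : ∀ b m → Unique (verts (path b m))
    size : ∀ b m → len (path b m) ≡ L
    cover  : ∀ {x y} → Adj Γ x y → ∃₂ λ b m → On (path b m) x y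
    sp     : B → U → V Γ → Bool
    spcov  : ∀ b v → ∃ λ m → Visits (path b m) v × sp b m v ≡ true
    label  : V Γ → Vec Bool R
    equi   : ∀ b m x → cnt (λ v → sp b m v ∧ (label v == x)) (verts (path b m)) ≡ e

open Fam public

Full : ∀ {Γ B U R L e} → Fam Γ B U R L e → Set
Full {Γ} F = ∀ b m (v : V Γ) → sp F b m v ≡ true

-- One label bit is spent to decide in which of two classes a vertex remains special; so the two
-- classes together still meet every vertex and can be merged into one. A cycle keeps half of its
-- special vertices, with e for each shorter label as before.
halve : ∀ {Γ B U R L e} → Fam Γ (B × Bool) U (suc R) L e → Fam Γ B (Bool × U) R L e
halve {Γ} {B} {U} {R} {L} {e} F = record
  { path   = λ b (β , m) → path F (b , β) m
  ; unique = λ b (β , m) → unique F (b , β) m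
  ; size = λ b (β , m) → size F (b , β) m
  ; cover  = λ e → let (b , β) , m , o = cover F e in b , (β , m) , o
  ; sp     = λ b (β , m) v → sp F (b , β) m v ∧ (Vec.head (label F v) ==ᵇ β)
  ; spcov  = λ b v → let β = Vec.head (label F v) ; m , vis , s = spcov F (b , β) v in
                     (β , m) , vis , cong₂ _∧_ s (==ᵇ-refl β)
  ; label  = λ v → Vec.tail (label F v)
  ; equi   = λ b (β , m) x → trans (cnt-cong (λ v → trans (∧-assoc (sp F (b , β) m v) _ _)
                               (cong (sp F (b , β) m v ∧_) (uncons (label F v) β x))) (verts (path F (b , β) m))) (equi F (b , β) m (β ∷ x))
  }
  where
  uncons : ∀ {n} (u : Vec Bool (suc n)) β x → (Vec.head u ==ᵇ β) ∧ (Vec.tail u == x) ≡ (u == β ∷ x)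
  uncons (a ∷ u) β x = refl

cnt-split : ∀ {A : Set} (p q : A → Bool) xs → cnt p xs ≡ cnt (λ x → p x ∧ q x) xs + cnt (λ x → p x ∧ not (q x)) xs
cnt-split p q []       = refl
cnt-split p q (x ∷ xs) with p x | q x
... | false | _     = cnt-split p q xs
... | true  | true  = cong suc (cnt-split p q xs)
... | true  | false = trans (cong suc (cnt-split p q xs)) (sym (+-suc _ _))

-- All special vertices are kept, but labels are identified in pairs, which doubles e.
forget : ∀ {Γ B U R L e} → Fam Γ B U (suc R) L e → Fam Γ B U R L (e + e)
forget {Γ} {B} {U} {R} {L} {e} F = record
  { path = path F ; unique = unique F ; size = size F ; cover = cover F
  ; sp = sp F ; spcov = spcov F
  ; label = λ v → Vec.tail (label F v)
  ; equi = λ b m x → trans (cnt-split _ (λ v → Vec.head (label F v)) (verts (path F b m))) (cong₂ _+_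
      (trans (cnt-cong (λ v → pos (sp F b m v) (label F v) x) (verts (path F b m))) (equi F b m (true ∷ x)))
      (trans (cnt-cong (λ v → neg (sp F b m v) (label F v) x) (verts (path F b m))) (equi F b m (false ∷ x))))
  }
  where
  pos : ∀ {n} s (u : Vec Bool (suc n)) x → (s ∧ (Vec.tail u == x)) ∧ Vec.head u ≡ s ∧ (u == true ∷ x)
  pos false u           x = refl
  pos true  (true ∷ u)  x = ∧-identityʳ _
  pos true  (false ∷ u) x = ∧-zeroʳ _
  neg : ∀ {n} s (u : Vec Bool (suc n)) x → (s ∧ (Vec.tail u == x)) ∧ not (Vec.head u) ≡ s ∧ (u == false ∷ x)
  neg false u           x = refl
  neg true  (true ∷ u)  x = ∧-zeroʳ _
  neg true  (false ∷ u) x = ∧-identityʳ _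

specials : ∀ {Γ B U R L e} (F : Fam Γ B U R L e) b m → cnt (sp F b m) (verts (path F b m)) ≡ e * 2 ^ R
specials {R = zero} {e = e} F b m = trans (cnt-cong (λ v → sym (none (sp F b m v) (label F v))) (verts (path F b m)))
  (trans (equi F b m []) (sym (*-identityʳ e)))
  where
  none : ∀ s (u : Vec Bool 0) → s ∧ (u == []) ≡ s
  none s [] = ∧-identityʳ s
specials {R = suc R} {e = e} F b m = trans (specials (forget F) b m) (lemma e (2 ^ R))
  where
  lemma : ∀ e p → (e + e) * p ≡ e * (2 * p)
  lemma = solve-∀

-- Surjections are the right maps between index sets, since a family only claims to cover.
record Cover (A B : Set) : Set where
  field
    fun  : A → B
    onto : ∀ b → ∃ λ a → fun a ≡ b

open Cover public

reindex : ∀ {Γ B B′ U U′ R L e} → Cover B′ B → Cover U′ U → Fam Γ B U R L e → Fam Γ B′ U′ R L e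
reindex {Γ} φ ψ F = record
  { path   = λ b m → path F (fun φ b) (fun ψ m)
  ; unique = λ b m → unique F (fun φ b) (fun ψ m)
  ; size = λ b m → size F (fun φ b) (fun ψ m)
  ; cover  = λ e → cover′ (cover F e)
  ; sp     = λ b m → sp F (fun φ b) (fun ψ m)
  ; spcov  = λ b v → spcov′ b v (spcov F (fun φ b) v)
  ; label  = label F
  ; equi   = λ b m → equi F (fun φ b) (fun ψ m)
  }
  where
  cover′ : ∀ {x y} → (∃₂ λ b m → On (path F b m) x y) → ∃₂ λ b m → On (path F (fun φ b) (fun ψ m)) x y
  cover′ (b , m , o) with onto φ b | onto ψ m
  ... | b′ , refl | m′ , refl = b′ , m′ , o
  spcov′ : ∀ b v → (∃ λ m → Visits (path F (fun φ b) m) v × sp F (fun φ b) m v ≡ true) →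
           ∃ λ m → Visits (path F (fun φ b) (fun ψ m)) v × sp F (fun φ b) (fun ψ m) v ≡ true
  spcov′ b v (m , vis , s) with onto ψ m
  ... | m′ , refl = m′ , vis , s

relabel : ∀ {Γ B U R L e} (F : Fam Γ B U R L e) → Full F → ∀ {R′ e′} (label′ : V Γ → Vec Bool R′) →
          (∀ b m x → cnt (λ v → label′ v == x) (verts (path F b m)) ≡ e′) → Fam Γ B U R′ L e′
relabel F full label′ equi′ = record
  { path = path F ; unique = unique F ; size = size F ; cover = cover F
  ; sp = sp F ; spcov = spcov F ; label = label′
  ; equi = λ b m x → trans (cnt-cong (λ v → cong (_∧ (label′ v == x)) (full b m v)) (verts (path F b m))) (equi′ b m x)
  }

fam-map : ∀ {Γ Δ B U R L e} → Γ ≅ Δ → Fam Γ B U R L e → Fam Δ B U R L e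
fam-map iso F = record
  { path   = λ b m → mapʷ (path F b m)
  ; unique = λ b m → uniq-map (path F b m) (unique F b m)
  ; size = λ b m → trans (len-map (path F b m)) (size F b m)
  ; cover  = λ e → let b , m , o = cover F (from-~ e) in b , m , on-map⁻ o
  ; sp     = λ b m v → sp F b m (from v)
  ; spcov  = λ b v → let m , vis , s = spcov F b (from v) in m , visits-map⁻ vis , s
  ; label  = λ v → label F (from v)
  ; equi   = λ b m x → trans (cong (cnt _) (verts-map (path F b m))) (trans (cnt-map _ to (verts (path F b m)))
      (trans (cnt-cong (λ v → cong (λ u → sp F b m u ∧ (label F u == x)) (from∘to v)) (verts (path F b m))) (equi F b m x)))
  }
  where
  open _≅_ iso
  open Transport iso

-- Sums over a full period and products of labelled families

∑-head : ∀ n (f : ℕ → ℕ) → ∑< (suc n) f ≡ f 0 + ∑< n (f ∘ suc)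
∑-head zero    f = refl
∑-head (suc n) f = trans (cong (f (suc n) +_) (∑-head n f)) (swap (f (suc n)) (f 0) (∑< n (f ∘ suc)))
  where
  swap : ∀ a b c → a + (b + c) ≡ b + (a + c)
  swap = solve-∀

∑-cong< : ∀ n {f g : ℕ → ℕ} → (∀ {i} → i < n → f i ≡ g i) → ∑< n f ≡ ∑< n g
∑-cong< zero    eq = refl
∑-cong< (suc n) eq = cong₂ _+_ (eq ≤-refl) (∑-cong< n (eq ∘ m<n⇒m<1+n))

-- Moving the window by one place removes f a and adds f (c + a), which are equal.
∑-shift : ∀ c (f : ℕ → ℕ) → (∀ n → f (c + n) ≡ f n) → ∀ a → ∑< c (λ i → f (i + a)) ≡ ∑< c f
∑-shift c f per zero    = ∑-cong c (λ i → cong f (+-identityʳ i))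
∑-shift c f per (suc a) = trans (+-cancelˡ-≡ (f a) _ _ (begin
  f a + ∑< c (λ i → f (i + suc a))       ≡⟨ cong (f a +_) (∑-cong c (λ i → cong f (+-suc i a))) ⟩
  f a + ∑< c (λ i → f (suc i + a))       ≡⟨ ∑-head c (λ i → f (i + a)) ⟨
  f (c + a) + ∑< c (λ i → f (i + a))     ≡⟨ cong (_+ ∑< c (λ i → f (i + a))) (per a) ⟩
  f a + ∑< c (λ i → f (i + a))           ∎)) (∑-shift c f per a)
  where open ≡-Reasoning

∑-pairs : ∀ n (f : ℕ → ℕ) → ∑< n (λ r → f (r * 2) + f (suc (r * 2))) ≡ ∑< (n * 2) f
∑-pairs zero    f = refl
∑-pairs (suc n) f = trans (cong (f (n * 2) + f (suc (n * 2)) +_) (∑-pairs n f)) (lemma (f (n * 2)) (f (suc (n * 2))) _)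
  where
  lemma : ∀ a b c → a + b + c ≡ b + (a + c)
  lemma = solve-∀

∑-cnt : ∀ {Γ a b} (g : V Γ → Bool) (w : Walk Γ a b) → ∑< (len w) (λ i → bit (g (at w i))) ≡ cnt g (verts w)
∑-cnt g []              = refl
∑-cnt g (_∷_ {a} e w) = trans (∑-head (len w) _) (cong (bit (g a) +_) (∑-cnt g w))

module _ {Γ : Graph} {a : V Γ} (w : Walk Γ a a) (u : Unique (verts w)) {R : ℕ} .{{_ : NonZero (R * 2)}} (len≡ : len w ≡ R * 2) where
  open Cyc (Unroll.cyc w u len≡)

  -- With t = 2 the blocks of a Kotzig cycle meet each level of D exactly once over each special vertex.
  level-count : ∀ (g : V Γ → Bool) a →
                ∑< R (λ r → bit (g (D (r * 2 + a))) + bit (g (D (r * 2 + suc a)))) ≡ cnt g (verts w)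
  level-count g a = begin
    ∑< R (λ r → χ (r * 2 + a) + χ (r * 2 + suc a))
      ≡⟨ ∑-cong R (λ r → cong (λ z → χ (r * 2 + a) + χ z) (+-suc (r * 2) a)) ⟩
    ∑< R (λ r → χ (r * 2 + a) + χ (suc (r * 2) + a))  ≡⟨ ∑-pairs R (λ i → χ (i + a)) ⟩
    ∑< (R * 2) (λ i → χ (i + a))                      ≡⟨ ∑-shift (R * 2) χ (λ n → cong (bit ∘ g) (period n)) a ⟩
    ∑< (R * 2) χ                                      ≡⟨ ∑-cong< (R * 2) (λ i< → cong (bit ∘ g ∘ at w) (m<n⇒m%n≡m i<)) ⟩
    ∑< (R * 2) (λ i → bit (g (at w i)))               ≡⟨ cong (λ n → ∑< n (λ i → bit (g (at w i)))) len≡ ⟨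
    ∑< (len w) (λ i → bit (g (at w i)))               ≡⟨ ∑-cnt g w ⟩
    cnt g (verts w)                                   ∎
    where
    open ≡-Reasoning
    χ : ℕ → ℕ
    χ n = bit (g (D n))

-- Class b of F is multiplied with class b of G. For an edge of Γ over d, a cycle of the same class
-- of G through d is needed; for an edge of Δ over u, a cycle of the same class of F on which u is
-- special. Both come from `spcov`. The 2 τ starts split by parity into two classes with τ positions
-- each.
module Stage {Γ Δ : Graph} {B U U′ : Set} {R R′ L e e′ : ℕ} (F : Fam Γ B U R L e) (m R₀ τ : ℕ)
  .{{_ : NonZero R₀}} .{{_ : NonZero τ}} (G : Fam Δ B U′ R′ (R₀ * (τ * 2)) e′)
  (special≡ : e * 2 ^ R ≡ m * 2 + τ * 2) where

  private instance
    t≢0 : NonZero (τ * 2)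
    t≢0 = m*n≢0 τ 2
    c≢0 : NonZero (R₀ * (τ * 2))
    c≢0 = m*n≢0 R₀ (τ * 2)

  module Un (b : B) (i′ : U′) = Unroll (path G b i′) (unique G b i′) (size G b i′)
  module K (b : B) (i : U) (i′ : U′) =
    Kotzig (path F b i) (sp F b i) m R₀ (τ * 2) (Un.cyc b i′) (trans (specials F b i) special≡)

  private
    start : Bool → Fin τ → ℕ
    start π h = bit π + toℕ h * 2

    find-start : ∀ {ε} → ε < τ * 2 → ∃ λ h → ε ≡ start (odd ε) h
    find-start {ε} ε< with halve-ℕ ε
    ... | inj₁ (h , refl) = Fin.fromℕ< h< , trans (cong (_* 2) (sym (Fin.toℕ-fromℕ< h<)))
                              (cong (λ b → bit b + toℕ (Fin.fromℕ< h<) * 2) (sym (odd-double h)))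
      where
      h< : h < τ
      h< = *-cancelʳ-< 2 h τ ε<
    ... | inj₂ (h , refl) = Fin.fromℕ< h< , trans (cong (λ z → suc (z * 2)) (sym (Fin.toℕ-fromℕ< h<)))
                              (cong (λ b → bit b + toℕ (Fin.fromℕ< h<) * 2) (sym (cong not (odd-double h))))
      where
      h< : h < τ
      h< = *-cancelʳ-< 2 h τ (<-trans (n<1+n (h * 2)) ε<)

  A : ∀ (c : B × Bool) (j : U × U′ × Fin τ) → let (b , π) = c ; (i , i′ , h) = j in
      Walk (Γ ⊠ Δ) (root F b i , Cyc.D (Un.cyc b i′) (start π h)) (root F b i , Cyc.D (Un.cyc b i′) (start π h))
  A (b , π) (i , i′ , h) = K.A b i i′ (start π h)

  private
    reach : ∀ {b i i′ x y} → (∃ λ ε → ε < τ * 2 × On (K.A b i i′ ε) x y) → ∃₂ λ c j → On (A c j) x y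
    reach {b} {i} {i′} (ε , ε< , o) with find-start ε<
    ... | h , eq = (b , odd ε) , (i , i′ , h) , subst (λ ε → On (K.A b i i′ ε) _ _) eq o

    covers : ∀ {x y} → Adj (Γ ⊠ Δ) x y → ∃₂ λ c j → On (A c j) x y
    covers (along₁ {w = d} e) with cover F e
    ... | b , i , o with spcov G b d
    ...   | i′ , (_ , s′) , _ with Un.step-cyc b i′ s′
    covers (along₁ e) | b , i , inj₁ s | i′ , (_ , s′) , _ | n , refl , _ =
      let ε , ε< , s″ = K.cover-along b i i′ s n in reach (ε , ε< , inj₁ s″)
    covers (along₁ e) | b , i , inj₂ s | i′ , (_ , s′) , _ | n , refl , _ =
      let ε , ε< , s″ = K.cover-along b i i′ s n in reach (ε , ε< , inj₂ s″)
    covers (along₂ {u} e) with cover G e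
    ... | b , i′ , o with spcov F b u
    covers (along₂ {u} e) | b , i′ , inj₁ s | i , vis , special with Un.step-cyc b i′ s
    ... | n , refl , refl = reach (K.cover-rise b i i′ vis special n)
    covers (along₂ {u} e) | b , i′ , inj₂ s | i , vis , special with Un.step-cyc b i′ s
    ... | n , refl , refl = let ε , ε< , o = K.cover-rise b i i′ vis special n in reach (ε , ε< , On-sym o)

    special-cover : ∀ (c : B × Bool) (v : V (Γ ⊠ Δ)) → ∃ λ (j : U × U′ × Fin τ) →
                    Visits (A c j) v × sp F (proj₁ c) (proj₁ j) (proj₁ v) ≡ true
    special-cover (b , π) (u , d) with spcov F b u | spcov G b d
    ... | i , vis , special | i′ , (_ , s) , _ with Un.step-cyc b i′ s
    ...   | n , refl , _ with K.cover-visit b i i′ τ refl vis special n π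
    ...     | ε , ε< , refl , vis′ with find-start ε<
    ...       | h , eq = (i , i′ , h) , subst (λ ε → Visits (K.A b i i′ ε) _) eq vis′ , special

  -- The hypothesis says that the two levels met over a special vertex, taken over all blocks, carry
  -- each label of G equally often, wherever the vertical move takes place. Then the label of G is
  -- equidistributed over each single special vertex of the first factor, and so is its
  -- concatenation with the label of F.
  fam : ∀ {γ} → (∀ b i′ y a → ∑< R₀ (λ r → bit (label G (Cyc.D (Un.cyc b i′) (r * (τ * 2) + a)) == y)
                                         + bit (label G (Cyc.D (Un.cyc b i′) (r * (τ * 2) + suc a)) == y)) ≡ γ) →
        Fam (Γ ⊠ Δ) (B × Bool) (U × U′ × Fin τ) (R′ + R) (R₀ * (e * 2 ^ R + L)) (e * γ)
  fam {γ} hγ = record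
    { path   = A
    ; unique = λ (b , π) (i , i′ , h) → K.A-unique b i i′ (m≤n*m 2 τ) (unique F b i) (start π h)
    ; size = λ (b , π) (i , i′ , h) → trans (K.A-len b i i′ (start π h))
                 (cong (R₀ *_) (cong₂ _+_ (specials F b i) (size F b i)))
    ; cover  = covers
    ; sp     = λ c j v → sp F (proj₁ c) (proj₁ j) (proj₁ v)
    ; spcov  = special-cover
    ; label  = λ (u , d) → label G d Vec.++ label F u
    ; equi   = λ (b , π) (i , i′ , h) z → trans (cnt-cong (λ (u , d) → split (sp F b i u) (label G d) (label F u) z) (verts (A (b , π) (i , i′ , h))))
                 (trans (K.A-count b i i′ (λ u → label F u == Vec.drop R′ z) (λ d → label G d == Vec.take R′ z)
                   (hγ b i′ (Vec.take R′ z)) (start π h)) (cong (_* γ) (equi F b i (Vec.drop R′ z))))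
    }
    where
    split : ∀ s (y : Vec Bool R′) (x : Vec Bool R) z →
            s ∧ (y Vec.++ x == z) ≡ (s ∧ (x == Vec.drop R′ z)) ∧ (y == Vec.take R′ z)
    split s y x z = begin
      s ∧ (y Vec.++ x == z)  ≡⟨ cong (λ z → s ∧ (y Vec.++ x == z)) (Vec.take++drop≡id R′ z) ⟨
      s ∧ (y Vec.++ x == Vec.take R′ z Vec.++ Vec.drop R′ z)  ≡⟨ cong (s ∧_) (==-++ y _ x _) ⟩
      s ∧ ((y == Vec.take R′ z) ∧ (x == Vec.drop R′ z))       ≡⟨ cong (s ∧_) (∧-comm (y == Vec.take R′ z) _) ⟩
      s ∧ ((x == Vec.drop R′ z) ∧ (y == Vec.take R′ z))       ≡⟨ ∧-assoc s _ _ ⟨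
      (s ∧ (x == Vec.drop R′ z)) ∧ (y == Vec.take R′ z)       ∎
      where open ≡-Reasoning

Fac : (Γ : Graph) (B U : Set) (R L e : ℕ) → Set
Fac Γ B U R L e = Σ (Fam Γ B U R L e) Full

fac-cast : ∀ {Γ B U R R′ L L′ e e′} → R ≡ R′ → L ≡ L′ → e ≡ e′ → Fac Γ B U R L e → Fac Γ B U R′ L′ e′
fac-cast refl refl refl F = F

fac-cube : ∀ m n {l B U R L e} → m + n ≡ l → Fac (cube m ⊠ cube n) B U R L e → Fac (cube l) B U R L e
fac-cube m n refl (F , full) = fam-map (cube-⊠ m n) F , λ b i v → full b i _

fac-reindex : ∀ {Γ B B′ U U′ R L e} → Cover B′ B → Cover U′ U → Fac Γ B U R L e → Fac Γ B′ U′ R L e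
fac-reindex φ ψ (F , full) = reindex φ ψ F , λ b i v → full _ _ v

fac-forget : ∀ k {Γ B U R L e} → Fac Γ B U (k + R) L e → Fac Γ B U R L (2 ^ k * e)
fac-forget zero    {e = e} F           = fac-cast refl refl (sym (*-identityˡ e)) F
fac-forget (suc k) {e = e} (F , full) = fac-cast refl refl (lemma (2 ^ k) e) (fac-forget k (forget F , full))
  where
  lemma : ∀ p e → p * (e + e) ≡ 2 * p * e
  lemma = solve-∀

↔⇒cover : ∀ {A B : Set} → A ↔ B → Cover A B
↔⇒cover A↔B = record { fun = Inverse.to A↔B ; onto = λ b → Inverse.from A↔B b , Inverse.strictlyInverseˡ A↔B b }

Fin-×2 : ∀ {m n} → m * 2 ≡ n → Cover (Fin n) (Fin m × Bool)
Fin-×2 refl = ↔⇒cover ((↔-id _ ×-↔ Fin.2↔Bool) ↔-∘ Fin.*↔×)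

Fin-⊎ : ∀ {m n} → m * 2 ≡ n → Cover (Fin n) (Fin m ⊎ Fin m)
Fin-⊎ {m} refl = subst (λ n → Cover (Fin n) (Fin m ⊎ Fin m)) (lemma m) (↔⇒cover Fin.+↔⊎)
  where
  lemma : ∀ m → m + m ≡ m * 2
  lemma = solve-∀

cnt-single : ∀ {n} (x : Vec Bool n) xs → Unique xs → x ∈ xs → cnt (_== x) xs ≡ 1
cnt-single x (y ∷ ys) (y∉ ∷ u) (here refl) = trans (cong (λ b → bit b + cnt (_== x) ys) (==-refl x))
  (cong suc (cnt-none ys λ {z} z∈ → differ z (All.lookup y∉ z∈)))
  where
  differ : ∀ z → x ≢ z → (z == x) ≡ false
  differ z x≢z with z == x in eq
  ... | true  = ⊥-elim (x≢z (sym (==⇒≡ z x eq)))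
  ... | false = refl
cnt-single x (y ∷ ys) (y∉ ∷ u) (there x∈) with y == x in eq
... | true  = ⊥-elim (All.lookup y∉ x∈ (==⇒≡ y x eq))
... | false = cnt-single x ys u x∈

-- On a Hamiltonian cycle the vertex can be its own label: each of the 2^n labels occurs once.
ham-fac : ∀ {n m} → Ham (cube n) m (2 ^ n) → Fac (cube n) (Fin m) ⊤ n (2 ^ n) 1
ham-fac H = record
  { path = λ b _ → walk (cycle H b)
  ; unique = λ b _ → uniq (cycle H b)
  ; size = λ b _ → len≡ (cycle H b)
  ; cover = λ e → let b , o = cov H e in b , tt , o
  ; sp = λ _ _ _ → true
  ; spcov = λ b v → tt , visits (cycle H b) v , refl
  ; label = id
  ; equi = λ b _ x → cnt-single x (verts (walk (cycle H b))) (uniq (cycle H b)) (visits⇒∈ (visits (cycle H b) x))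
  } , λ _ _ _ → refl

-- Every cycle is repeated over each vertex of the other factor. Along a copy one summand of `u ⊕ v`
-- is constant, and adding a constant permutes the labels, so equidistribution survives; as the sum
-- is symmetric, one label works in both directions.
module Copies {Γ : Graph} {B U : Set} {R L e : ℕ} (F : Fam Γ B U R L e) (full : Full F) where

  module Swap = Transport (⊠-swap {Γ} {Γ})

  _⊕_ : V Γ → V Γ → Vec Bool R
  u ⊕ v = Vec.zipWith _xor_ (label F u) (label F v)

  rootᶜ : B ⊎ B → U × V Γ → V (Γ ⊠ Γ)
  rootᶜ (inj₁ b) (m , d) = root F b m , d
  rootᶜ (inj₂ b) (m , d) = d , root F b m

  pathᶜ : ∀ b m → Walk (Γ ⊠ Γ) (rootᶜ b m) (rootᶜ b m)
  pathᶜ (inj₁ b) (m , d) = copyˡ (path F b m) d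
  pathᶜ (inj₂ b) (m , d) = Swap.mapʷ (copyˡ (path F b m) d)

  uniqueˡ : ∀ b m d → Unique (verts (copyˡ {Δ = Γ} (path F b m) d))
  uniqueˡ b m d = subst Unique (sym (verts-copyˡ (path F b m) d)) (Unique.map⁺ (cong proj₁) (unique F b m))

  equiˡ : ∀ b m d x → cnt (λ v → proj₁ v ⊕ proj₂ v == x) (verts (copyˡ {Δ = Γ} (path F b m) d)) ≡ e
  equiˡ b m d x = trans (cong (cnt _) (verts-copyˡ (path F b m) d)) (trans (cnt-map _ (_, d) (verts (path F b m)))
    (trans (cnt-cong (λ v → trans (==-xor (label F v) (label F d) x) (cong (_∧ _) (sym (full b m v)))) (verts (path F b m)))
      (equi F b m (Vec.zipWith _xor_ x (label F d)))))

  fac : Fac (Γ ⊠ Γ) (B ⊎ B) (U × V Γ) R L e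
  fac = record
    { path = pathᶜ
    ; unique = λ { (inj₁ b) (m , d) → uniqueˡ b m d ; (inj₂ b) (m , d) → Swap.uniq-map (copyˡ (path F b m) d) (uniqueˡ b m d) }
    ; size = λ { (inj₁ b) (m , d) → trans (len-copyˡ (path F b m) d) (size F b m)
                 ; (inj₂ b) (m , d) → trans (Swap.len-map (copyˡ (path F b m) d)) (trans (len-copyˡ (path F b m) d) (size F b m)) }
    ; cover = λ { (along₁ {w = d} e) → let b , m , o = cover F e in inj₁ b , (m , d) , Sum.map step-copyˡ step-copyˡ o
                ; (along₂ {u = d} e) → let b , m , o = cover F e in inj₂ b , (m , d) , Swap.on-map (Sum.map step-copyˡ step-copyˡ o) }
    ; sp = λ _ _ _ → true
    ; spcov = λ { (inj₁ b) (u , d) → let m , (_ , s) , _ = spcov F b u in (m , d) , (_ , step-copyˡ s) , refl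
                ; (inj₂ b) (d , u) → let m , (_ , s) , _ = spcov F b u in (m , d) , (_ , Swap.step-map (step-copyˡ s)) , refl }
    ; label = λ (u , v) → u ⊕ v
    ; equi = λ { (inj₁ b) (m , d) x → equiˡ b m d x
               ; (inj₂ b) (m , d) x → trans (cong (cnt _) (Swap.verts-map (copyˡ (path F b m) d)))
                   (trans (cnt-map _ (λ v → proj₂ v , proj₁ v) (verts (copyˡ (path F b m) d)))
                     (trans (cnt-cong (λ v → cong (_== x) (Vec.zipWith-comm xor-comm (label F (proj₂ v)) (label F (proj₁ v)))) (verts (copyˡ (path F b m) d)))
                       (equiˡ b m d x))) }
    } , λ _ _ _ → refl

-- Cycles of length a power of 2, by doubling the cube

^-split : ∀ a b → 2 ^ (a + b) ≡ 2 ^ a * 2 ^ b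
^-split = ^-distribˡ-+-* 2

module Double (M X : ℕ) .{{_ : NonZero M}} (H : Ham (cube (M * 2)) M (2 ^ (M * 2))) where

  D : ℕ
  D = M * 2

  -- For many short cycles: copying keeps the length and multiplies the number of positions by 2^D.
  module Short (R p : ℕ) (F : Fac (cube D) (Fin M) (Fin (2 ^ p)) R (2 ^ (R + X)) (2 ^ X)) where

    fac : Fac (cube D ⊠ cube D) (Fin (M * 2)) (Fin (2 ^ (p + D))) R (2 ^ (R + X)) (2 ^ X)
    fac = fac-reindex (Fin-⊎ refl) places (Copies.fac (proj₁ F) (proj₂ F))
      where
      places : Cover (Fin (2 ^ (p + D))) (Fin (2 ^ p) × Vertex D)
      places = subst (λ n → Cover (Fin n) (Fin (2 ^ p) × Vertex D)) (sym (^-split p D))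
        (↔⇒cover ((↔-id _ ×-↔ ↔-sym (cube↔Fin D)) ↔-∘ Fin.*↔×))

  -- Shrinking: t = 2 ^ (p + 1) levels per round trip instead of 2.
  module Middle (R k p j : ℕ) (D≡ : k + R ≡ D) (D≡′ : p + suc j ≡ D) (X≡ : k + suc j ≡ X) where

    F : Fac (cube D) (Fin M) ⊤ R (2 ^ D) (2 ^ k * 1)
    F = fac-forget k (subst (λ n → Fac (cube D) (Fin M) ⊤ n (2 ^ D) 1) (sym D≡) (ham-fac H))

    c≡ : 2 ^ D ≡ 2 ^ j * (2 ^ p * 2)
    c≡ = trans (cong (2 ^_) (sym D≡′)) (trans (^-split p (suc j)) (lemma (2 ^ p) (2 ^ j)))
      where
      lemma : ∀ a b → a * (2 * b) ≡ b * (a * 2)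
      lemma = solve-∀

    G₀ : Fac (cube D) (Fin M) ⊤ D (2 ^ j * (2 ^ p * 2)) 1
    G₀ = fac-cast refl c≡ refl (ham-fac H)

    -- Over a given vertex a cycle meets only two of the t residues of levels, so a label read off
    -- the second factor need not be balanced; the empty label always is.
    G : Fam (cube D) (Fin M) ⊤ 0 (2 ^ j * (2 ^ p * 2)) (2 ^ j * (2 ^ p * 2))
    G = relabel (proj₁ G₀) (proj₂ G₀) (λ _ → [])
      (λ { b m [] → trans (cnt-all (λ _ → refl) (verts (path (proj₁ G₀) b m)))
                      (trans (length-verts (path (proj₁ G₀) b m)) (size (proj₁ G₀) b m)) })

    special≡ : 2 ^ k * 1 * 2 ^ R ≡ 2 ^ p * Nat.pred (2 ^ j) * 2 + 2 ^ p * 2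
    special≡ = begin
      2 ^ k * 1 * 2 ^ R      ≡⟨ cong (_* 2 ^ R) (*-identityʳ (2 ^ k)) ⟩
      2 ^ k * 2 ^ R          ≡⟨ ^-split k R ⟨
      2 ^ (k + R)            ≡⟨ cong (2 ^_) D≡ ⟩
      2 ^ D                  ≡⟨ c≡ ⟩
      2 ^ j * (2 ^ p * 2)    ≡⟨ cong (_* (2 ^ p * 2)) (suc-pred (2 ^ j) {{m^n≢0 2 j}}) ⟨
      suc (Nat.pred (2 ^ j)) * (2 ^ p * 2) ≡⟨ lemma (Nat.pred (2 ^ j)) (2 ^ p) ⟩
      2 ^ p * Nat.pred (2 ^ j) * 2 + 2 ^ p * 2 ∎
      where
      open ≡-Reasoning
      lemma : ∀ z a → suc z * (a * 2) ≡ a * z * 2 + a * 2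
      lemma = solve-∀

    private
      module S = Stage (proj₁ F) (2 ^ p * Nat.pred (2 ^ j)) (2 ^ j) (2 ^ p) {{m^n≢0 2 j}} {{m^n≢0 2 p}} G special≡

      staged : Fac (cube D ⊠ cube D) (Fin M × Bool) (⊤ × ⊤ × Fin (2 ^ p)) R
                 (2 ^ j * (2 ^ k * 1 * 2 ^ R + 2 ^ D)) (2 ^ k * 1 * (2 ^ j * 2))
      staged = S.fam (λ { b _ [] a → ∑-const (2 ^ j) 2 }) , λ b m v → proj₂ F _ _ _

      L≡ : 2 ^ j * (2 ^ k * 1 * 2 ^ R + 2 ^ D) ≡ 2 ^ (R + X)
      L≡ = begin
        2 ^ j * (2 ^ k * 1 * 2 ^ R + 2 ^ D)           ≡⟨ cong (λ d → 2 ^ j * (2 ^ k * 1 * 2 ^ R + 2 ^ d)) D≡ ⟨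
        2 ^ j * (2 ^ k * 1 * 2 ^ R + 2 ^ (k + R))     ≡⟨ cong (λ d → 2 ^ j * (2 ^ k * 1 * 2 ^ R + d)) (^-split k R) ⟩
        2 ^ j * (2 ^ k * 1 * 2 ^ R + 2 ^ k * 2 ^ R)   ≡⟨ lemma (2 ^ j) (2 ^ k) (2 ^ R) ⟩
        2 ^ R * (2 ^ k * 2 ^ suc j)                   ≡⟨ cong (2 ^ R *_) (^-split k (suc j)) ⟨
        2 ^ R * 2 ^ (k + suc j)                       ≡⟨ ^-split R (k + suc j) ⟨
        2 ^ (R + (k + suc j))                         ≡⟨ cong (λ x → 2 ^ (R + x)) X≡ ⟩
        2 ^ (R + X)                                   ∎
        where
        open ≡-Reasoning
        lemma : ∀ a b c → a * (b * 1 * c + b * c) ≡ c * (b * (2 * a))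
        lemma = solve-∀

      e≡ : 2 ^ k * 1 * (2 ^ j * 2) ≡ 2 ^ X
      e≡ = trans (lemma (2 ^ k) (2 ^ j)) (trans (sym (^-split k (suc j))) (cong (2 ^_) X≡))
        where
        lemma : ∀ a b → a * 1 * (b * 2) ≡ a * (2 * b)
        lemma = solve-∀

    fac : Fac (cube D ⊠ cube D) (Fin (M * 2)) (Fin (2 ^ p)) R (2 ^ (R + X)) (2 ^ X)
    fac = fac-reindex (Fin-×2 refl) (record { fun = λ h → tt , tt , h ; onto = λ (_ , _ , h) → h , refl })
            (fac-cast refl L≡ e≡ staged)

  -- For long cycles: with t = 2, the product with a Hamiltonian cycle multiplies the length by 2^D
  -- and contributes D label bits, the coordinates of the first factor.
  module Long (R p z : ℕ) (z≡ : suc z ≡ R + X) (G₀ : Fac (cube D) (Fin M) (Fin (2 ^ p)) R (2 ^ (R + X)) (2 ^ X)) where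

    c≡ : 2 ^ (R + X) ≡ 2 ^ z * (1 * 2)
    c≡ = trans (cong (2 ^_) (sym z≡)) (*-comm 2 (2 ^ z))

    G : Fac (cube D) (Fin M) (Fin (2 ^ p)) R (2 ^ z * (1 * 2)) (2 ^ X)
    G = fac-cast refl c≡ refl G₀

    d : ℕ
    d = Nat.pred D

    D≡ : suc d ≡ D
    D≡ = suc-pred D {{m*n≢0 M 2}}

    special≡ : 1 * 2 ^ D ≡ Nat.pred (2 ^ d) * 2 + 1 * 2
    special≡ = begin
      1 * 2 ^ D                          ≡⟨ *-identityˡ (2 ^ D) ⟩
      2 ^ D                              ≡⟨ cong (2 ^_) D≡ ⟨
      2 * 2 ^ d                          ≡⟨ cong (2 *_) (suc-pred (2 ^ d) {{m^n≢0 2 d}}) ⟨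
      2 * suc (Nat.pred (2 ^ d))         ≡⟨ lemma (Nat.pred (2 ^ d)) ⟩
      Nat.pred (2 ^ d) * 2 + 1 * 2       ∎
      where
      open ≡-Reasoning
      lemma : ∀ q → 2 * suc q ≡ q * 2 + 1 * 2
      lemma = solve-∀

    private
      module S = Stage (proj₁ (ham-fac H)) (Nat.pred (2 ^ d)) (2 ^ z) 1 {{m^n≢0 2 z}} (proj₁ G) special≡

      instance
        c≢0 : NonZero (2 ^ z * (1 * 2))
        c≢0 = m*n≢0 (2 ^ z) (1 * 2) {{m^n≢0 2 z}}

      staged : Fac (cube D ⊠ cube D) (Fin M × Bool) (⊤ × Fin (2 ^ p) × Fin 1) (R + D)
                 (2 ^ z * (1 * 2 ^ D + 2 ^ D)) (1 * 2 ^ X)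
      staged = S.fam (λ b i y a → trans (level-count (path (proj₁ G) b i) (unique (proj₁ G) b i) {2 ^ z} (size (proj₁ G) b i) (λ v → label (proj₁ G) v == y) a)
                 (trans (cnt-cong (λ v → cong (_∧ (label (proj₁ G) v == y)) (sym (proj₂ G b i v))) (verts (path (proj₁ G) b i))) (equi (proj₁ G) b i y)))
               , λ b m v → refl

      L≡ : 2 ^ z * (1 * 2 ^ D + 2 ^ D) ≡ 2 ^ (R + D + X)
      L≡ = begin
        2 ^ z * (1 * 2 ^ D + 2 ^ D)  ≡⟨ lemma (2 ^ z) (2 ^ D) ⟩
        2 * 2 ^ z * 2 ^ D            ≡⟨ cong (λ y → 2 ^ y * 2 ^ D) z≡ ⟩
        2 ^ (R + X) * 2 ^ D          ≡⟨ ^-split (R + X) D ⟨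
        2 ^ (R + X + D)              ≡⟨ cong (2 ^_) (swap R X D) ⟩
        2 ^ (R + D + X)              ∎
        where
        open ≡-Reasoning
        lemma : ∀ a b → a * (1 * b + b) ≡ 2 * a * b
        lemma = solve-∀
        swap : ∀ R X D → R + X + D ≡ R + D + X
        swap = solve-∀

    fac : Fac (cube D ⊠ cube D) (Fin (M * 2)) (Fin (2 ^ p)) (R + D) (2 ^ (R + D + X)) (2 ^ X)
    fac = fac-reindex (Fin-×2 refl) places
            (fac-cast refl L≡ (*-identityˡ (2 ^ X)) staged)
      where
      places : Cover (Fin (2 ^ p)) (⊤ × Fin (2 ^ p) × Fin 1)
      places = record { fun = λ i → tt , i , Fin.zero ; onto = λ { (_ , i , Fin.zero) → i , refl } }

Labelled : (x e R p : ℕ) → Set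
Labelled x e R p = Fac (cube (x * 2 ^ e * 2)) (Fin (x * 2 ^ e)) (Fin (2 ^ p)) R (2 ^ (R + x * 2)) (2 ^ (x * 2))

hamOf : ∀ m .{{_ : NonZero m}} → Ham (cube (m * 2)) m (2 ^ (m * 2))
hamOf (suc m) = ham m (hamCube (suc m))

-- The equation is the count of edges: x 2^e classes of 2^p cycles of length 2^(R + 2x) fill the
-- cube. What exceeds 2x in the dimension can be shared out freely between label bits and positions.
-- The cases D ≤ p and D ≤ R recurse to the cube of half the dimension; the remaining one starts
-- from its Hamiltonian cycles.
labelled : ∀ x .{{_ : NonZero x}} e R p → R + x * 2 + p ≡ x * 2 ^ e * 2 → Labelled x e R p
labelled x zero R p eq = single R p (m+n≡0⇒m≡0 R zero-sum) (m+n≡0⇒n≡0 R zero-sum)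
  where
  X≡ : x * 1 * 2 ≡ x * 2
  X≡ = cong (_* 2) (*-identityʳ x)
  instance
    M≢0 : NonZero (x * 1)
    M≢0 = m*n≢0 x 1
  zero-sum : R + p ≡ 0
  zero-sum = +-cancelˡ-≡ (x * 2) _ _ (trans (lemma R p (x * 2)) (trans eq (trans X≡ (sym (+-identityʳ (x * 2))))))
    where
    lemma : ∀ R p X → X + (R + p) ≡ R + X + p
    lemma = solve-∀
  single : ∀ R p → R ≡ 0 → p ≡ 0 → Labelled x zero R p
  single zero zero _ _ = fac-reindex (↔⇒cover (↔-id _)) (record { fun = λ _ → tt ; onto = λ _ → Fin.zero , refl })
    (fac-cast refl (cong (2 ^_) X≡) (trans (*-identityʳ _) (cong (2 ^_) X≡))
      (fac-forget (x * 1 * 2) (fac-cast (sym (+-identityʳ _)) refl refl (ham-fac (hamOf (x * 1))))))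
labelled x (suc e) R p eq = finish (cases (≤-<-connex D p) (≤-total R D))
  where
  M D X : ℕ
  M = x * 2 ^ e
  D = M * 2
  X = x * 2
  instance
    2^e≢0 : NonZero (2 ^ e)
    2^e≢0 = m^n≢0 2 e
    M≢0 : NonZero M
    M≢0 = m*n≢0 x (2 ^ e)
  module Db = Double M X (hamOf M)
  M′≡ : M * 2 ≡ x * 2 ^ suc e
  M′≡ = lemma x (2 ^ e)
    where
    lemma : ∀ x a → x * a * 2 ≡ x * (2 * a)
    lemma = solve-∀
  total : R + X + p ≡ D + D
  total = trans eq (trans (cong (_* 2) (sym M′≡)) (lemma M))
    where
    lemma : ∀ m → m * 2 * 2 ≡ m * 2 + m * 2
    lemma = solve-∀
  Goal : ℕ → ℕ → Set
  Goal R p = Fac (cube D ⊠ cube D) (Fin (M * 2)) (Fin (2 ^ p)) R (2 ^ (R + X)) (2 ^ X)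
  finish : Goal R p → Labelled x (suc e) R p
  finish F = subst (λ m → Fac (cube (m * 2)) (Fin m) (Fin (2 ^ p)) R (2 ^ (R + X)) (2 ^ X)) M′≡
    (fac-cube D D (lemma M) F)
    where
    lemma : ∀ m → m * 2 + m * 2 ≡ m * 2 * 2
    lemma = solve-∀
  cases : D ≤ p ⊎ p < D → R ≤ D ⊎ D ≤ R → Goal R p
  cases (inj₁ D≤p) _ with m≤n⇒∃[o]m+o≡n D≤p
  ... | p′ , refl = subst (Goal R) (+-comm p′ D) (Db.Short.fac R p′ (labelled x e R p′
        (+-cancelʳ-≡ D _ _ (trans (lemma (R + X) p′ D) total))))
    where
    lemma : ∀ a b c → a + b + c ≡ a + (c + b)
    lemma = solve-∀
  cases (inj₂ p<D) (inj₂ D≤R) with m≤n⇒∃[o]m+o≡n D≤R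
  ... | R′ , refl = subst (λ r → Goal r p) (+-comm R′ D)
        (Db.Long.fac R′ p (Nat.pred (R′ + X)) (suc-pred (R′ + X) {{>-nonZero (<-≤-trans 0<X (m≤n+m X R′))}}) (labelled x e R′ p
          (+-cancelʳ-≡ D _ _ (trans (lemma R′ X p D) total))))
    where
    0<X : 0 < X
    0<X = >-nonZero⁻¹ X {{m*n≢0 x 2}}
    lemma : ∀ R X p D → R + X + p + D ≡ D + R + X + p
    lemma = solve-∀
  cases (inj₂ p<D) (inj₁ R≤D) with m≤n⇒∃[o]m+o≡n p<D | m≤n⇒∃[o]m+o≡n R≤D
  ... | j , D≡′ | k , D≡ = Db.Middle.fac R k p j (trans (+-comm k R) D≡) (trans (+-suc p j) D≡′)
          (+-cancelˡ-≡ (R + p) _ _ (trans (lemma R p k j) (trans (cong₂ _+_ D≡ D≡′) (trans (sym total) (lemma′ R X p)))))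
    where
    lemma : ∀ R p k j → R + p + (k + suc j) ≡ R + k + (suc p + j)
    lemma = solve-∀
    lemma′ : ∀ R X p → R + X + p ≡ R + p + X
    lemma′ = solve-∀

-- One factor for each binary digit

parity : ∀ {n} → Vertex n → Bool
parity []      = false
parity (b ∷ v) = b xor parity v

parity-flip : ∀ {n} (v : Vertex n) i → parity (v [ i ]%= not) ≡ not (parity v)
parity-flip (b ∷ v) Fin.zero    = sym (not-distribˡ-xor b (parity v))
parity-flip (b ∷ v) (Fin.suc i) = trans (cong (b xor_) (parity-flip v i)) (sym (not-distribʳ-xor b (parity v)))

-- Every edge of the cube changes the parity, so of two consecutive vertices exactly one counts.
cnt-parity : ∀ {n a b} (w : Walk (cube n) a b) k → len w ≡ k * 2 → ∀ β → cnt (λ v → parity v ==ᵇ β) (verts w) ≡ k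
cnt-parity []                                   zero    eq β = refl
cnt-parity (_∷_ {a} (i , refl) (_∷_ {_} _ w)) (suc k) eq β = trans (sym (+-assoc (bit (parity a ==ᵇ β)) _ _))
  (cong₂ _+_ (trans (cong (λ p → bit (parity a ==ᵇ β) + bit (p ==ᵇ β)) (parity-flip a i)) (one (parity a) β))
    (cnt-parity w k (suc-injective (suc-injective eq)) β))
  where
  one : ∀ p β → bit (p ==ᵇ β) + bit (not p ==ᵇ β) ≡ 1
  one true  true  = refl
  one true  false = refl
  one false true  = refl
  one false false = refl

-- Of the Y 2^E vertices of a cycle, 2^r 2^E are special, a share of 2^r / Y. The number of classes
-- is tied to r so that at r = i it fits the factor for the digit 2^i.
State : (G n r p E Y : ℕ) → Set
State G n r p E Y = Fam (cube n) (Fin (G * 2 ^ r)) (Fin (2 ^ p)) r (Y * 2 ^ E) (2 ^ E)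

halve-state : ∀ {G n r p E Y} → State G n (suc r) p E Y → State G n r (suc p) E Y
halve-state {G} {n} {r} {p} F =
  reindex (↔⇒cover (↔-id _)) (↔⇒cover ((Fin.2↔Bool ×-↔ ↔-id _) ↔-∘ Fin.*↔×)) (halve (reindex classes (↔⇒cover (↔-id _)) F))
  where
  classes : Cover (Fin (G * 2 ^ r) × Bool) (Fin (G * 2 ^ suc r))
  classes = subst (λ k → Cover (Fin (G * 2 ^ r) × Bool) (Fin k)) (lemma G (2 ^ r))
    (↔⇒cover (↔-sym ((↔-id _ ×-↔ Fin.2↔Bool) ↔-∘ Fin.*↔×)))
    where
    lemma : ∀ g a → g * a * 2 ≡ g * (2 * a)
    lemma = solve-∀

halves : ∀ {G n r p E Y} k → State G n (k + r) p E Y → State G n r (k + p) E Y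
halves                                   zero    F = F
halves {G} {n} {r} {p} {E} {Y} (suc k) F =
  subst (λ j → State G n r j E Y) (+-suc k p) (halves {G} {n} {r} {suc p} {E} {Y} k (halve-state {G} {n} {k + r} {p} {E} {Y} F))

-- A round trip has Y 2^(E+1) horizontal and 2^i 2^(E+1) vertical edges; this is how Y becomes Y +
-- 2^i. The product doubles the number of classes, and the parity in the new factor is the extra
-- label bit that goes with it. It is balanced because t = 2 and cycles in a cube alternate in
-- parity.
attach : ∀ {G n d i p q E Y z R e} → State G n i p (suc E) Y →
         Fac (cube d) (Fin (G * 2 ^ i)) (Fin (2 ^ q)) R (2 ^ suc z) e →
         State G (n + d) (suc i) (p + q) (suc E + z) (Y + 2 ^ i)
attach {G} {n} {d} {i} {p} {q} {E} {Y} {z} F (H₀ , full₀) = subst₂ (λ L e → Fam (cube (n + d)) (Fin (G * 2 ^ suc i)) (Fin (2 ^ (p + q))) (suc i) L e) L≡ e≡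
  (fam-map (cube-⊠ n d) (reindex classes places (S.fam counts)))
  where
  H : Fac (cube d) (Fin (G * 2 ^ i)) (Fin (2 ^ q)) _ (2 ^ z * (1 * 2)) _
  H = fac-cast refl (*-comm 2 (2 ^ z)) refl (H₀ , full₀)

  H₁ : Fam (cube d) (Fin (G * 2 ^ i)) (Fin (2 ^ q)) 1 (2 ^ z * (1 * 2)) (2 ^ z)
  H₁ = relabel (proj₁ H) (proj₂ H) (λ v → parity v ∷ [])
    (λ { b m (β ∷ []) → trans (cnt-cong (λ v → ∧-identityʳ (parity v ==ᵇ β)) (verts (path (proj₁ H) b m)))
                          (cnt-parity (path (proj₁ H) b m) (2 ^ z) (size (proj₁ H) b m) β) })

  special≡ : 2 ^ suc E * 2 ^ i ≡ Nat.pred (2 ^ (E + i)) * 2 + 1 * 2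
  special≡ = begin
    2 * 2 ^ E * 2 ^ i                    ≡⟨ *-assoc 2 (2 ^ E) (2 ^ i) ⟩
    2 * (2 ^ E * 2 ^ i)                  ≡⟨ cong (2 *_) (^-split E i) ⟨
    2 * 2 ^ (E + i)                      ≡⟨ cong (2 *_) (suc-pred (2 ^ (E + i)) {{m^n≢0 2 (E + i)}}) ⟨
    2 * suc (Nat.pred (2 ^ (E + i)))     ≡⟨ lemma (Nat.pred (2 ^ (E + i))) ⟩
    Nat.pred (2 ^ (E + i)) * 2 + 1 * 2   ∎
    where
    open ≡-Reasoning
    lemma : ∀ q → 2 * suc q ≡ q * 2 + 1 * 2
    lemma = solve-∀

  module S = Stage F (Nat.pred (2 ^ (E + i))) (2 ^ z) 1 {{m^n≢0 2 z}} H₁ special≡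

  instance
    c≢0 : NonZero (2 ^ z * (1 * 2))
    c≢0 = m*n≢0 (2 ^ z) (1 * 2) {{m^n≢0 2 z}}

  counts : ∀ b m y a → ∑< (2 ^ z) (λ r → bit (label H₁ (Cyc.D (S.Un.cyc b m) (r * 2 + a)) == y)
                                      + bit (label H₁ (Cyc.D (S.Un.cyc b m) (r * 2 + suc a)) == y)) ≡ 2 ^ z
  counts b m y a = trans (level-count (path H₁ b m) (unique H₁ b m) {2 ^ z} (size H₁ b m) (λ v → label H₁ v == y) a)
    (trans (cnt-cong (λ v → cong (_∧ (label H₁ v == y)) (sym (proj₂ H b m v))) (verts (path H₁ b m))) (equi H₁ b m y))

  classes : Cover (Fin (G * 2 ^ suc i)) (Fin (G * 2 ^ i) × Bool)
  classes = Fin-×2 (lemma G (2 ^ i))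
    where
    lemma : ∀ g a → g * a * 2 ≡ g * (2 * a)
    lemma = solve-∀

  places : Cover (Fin (2 ^ (p + q))) (Fin (2 ^ p) × Fin (2 ^ q) × Fin 1)
  places = subst (λ k → Cover (Fin k) (Fin (2 ^ p) × Fin (2 ^ q) × Fin 1)) (trans (cong (2 ^ p *_) (*-identityʳ (2 ^ q))) (sym (^-split p q)))
    (↔⇒cover ((↔-id _ ×-↔ Fin.*↔×) ↔-∘ Fin.*↔×))

  L≡ : 2 ^ z * (2 ^ suc E * 2 ^ i + Y * 2 ^ suc E) ≡ (Y + 2 ^ i) * 2 ^ (suc E + z)
  L≡ = trans (lemma (2 ^ z) (2 ^ suc E) (2 ^ i) Y) (cong ((Y + 2 ^ i) *_) (sym (^-split (suc E) z)))
    where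
    lemma : ∀ a b c y → a * (b * c + y * b) ≡ (y + c) * (b * a)
    lemma = solve-∀

  e≡ : 2 ^ suc E * 2 ^ z ≡ 2 ^ (suc E + z)
  e≡ = sym (^-split (suc E) z)

module Assemble (x a : ℕ) .{{_ : NonZero x}} where

  G X : ℕ
  G = x * 2 ^ a
  X = x * 2

  dim : ℕ → ℕ
  dim i = x * 2 ^ (i + a) * 2

  dims : List ℕ → ℕ
  dims = sum ∘ map dim

  weight : List ℕ → ℕ
  weight = sum ∘ map (2 ^_)

  2≤X : 2 ≤ X
  2≤X = m≤n*m 2 x

  classes≡ : ∀ i → x * 2 ^ (i + a) ≡ G * 2 ^ i
  classes≡ i = trans (cong (x *_) (trans (cong (2 ^_) (+-comm i a)) (^-split a i))) (sym (*-assoc x (2 ^ a) (2 ^ i)))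

  dim≡ : ∀ i → dim i ≡ G * 2 ^ i * 2
  dim≡ i = cong (_* 2) (classes≡ i)

  dims≡ : ∀ is → dims is ≡ G * weight is * 2
  dims≡ []       = sym (cong (_* 2) (*-zeroʳ G))
  dims≡ (i ∷ is) = trans (cong₂ _+_ (dim≡ i) (dims≡ is)) (lemma G (2 ^ i) (weight is))
    where
    lemma : ∀ g u v → g * u * 2 + g * v * 2 ≡ g * (u + v) * 2
    lemma = solve-∀

  room : ∀ i → i + X ≤ dim i
  room i = begin
    i + X                  ≤⟨ +-monoˡ-≤ X (≤-trans (m≤m+n i a) (m≤n*m (i + a) X {{m*n≢0 x 2}})) ⟩
    X * (i + a) + X        ≡⟨ lemma X (i + a) ⟩
    X * suc (i + a)        ≤⟨ *-monoʳ-≤ X (n<2^n (i + a)) ⟩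
    X * 2 ^ (i + a)        ≡⟨ lemma′ x (2 ^ (i + a)) ⟩
    dim i                  ∎
    where
    open ≤-Reasoning
    lemma : ∀ X m → X * m + X ≡ X * suc m
    lemma = solve-∀
    lemma′ : ∀ x u → x * 2 * u ≡ x * u * 2
    lemma′ = solve-∀
    n<2^n : ∀ n → n < 2 ^ n
    n<2^n zero    = z<s
    n<2^n (suc n) = subst (suc (suc n) ≤_) (cong (2 ^ n +_) (sym (+-identityʳ (2 ^ n))))
      (≤-trans (s≤s (n<2^n n)) (+-monoˡ-≤ (2 ^ n) (m^n>0 2 n)))

  X≤dim : ∀ i → X ≤ dim i
  X≤dim i = ≤-trans (m≤n+m X i) (room i)

  -- The largest exponent of positions in a factor, reached with no label bits.
  cap : ℕ → ℕ
  cap i = dim i ∸ X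

  caps : List ℕ → ℕ
  caps = sum ∘ map cap

  labelled′ : ∀ i R p → R + X + p ≡ dim i → Fac (cube (dim i)) (Fin (G * 2 ^ i)) (Fin (2 ^ p)) R (2 ^ (R + X)) (2 ^ X)
  labelled′ i R p eq = subst (λ k → Fac (cube (dim i)) (Fin k) (Fin (2 ^ p)) R (2 ^ (R + X)) (2 ^ X)) (classes≡ i)
    (labelled x (i + a) R p eq)

  -- Here δ is the part of q still to be placed. In `E≡`, the dimension of each new factor goes to
  -- its positions and to the exponent E, except for one unit: a cycle of length 2^(z+1) takes only
  -- 2^z round trips with t = 2. The equation `rpE≡` is the count of edges, reduced to exponents.
  record Result (n E Y δ : ℕ) (is : List ℕ) : Set where
    field
      {dimension r p E′ Y′} : ℕ
      state  : State G dimension r p E′ Y′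
      n≡     : dimension ≡ n + dims is
      rpE≡   : r + p + E′ ≡ dimension
      2≤E′   : 2 ≤ E′
      E≡     : E′ + δ + length is ≡ E + dims is
      Y≡     : Y′ ≡ Y + weight is

  -- The amount δ is placed greedily, each factor taking as much as it can. The digits decrease
  -- because a product leaves only i′ + 1 label bits after the digit 2^i′, enough for every smaller
  -- digit.
  extend : ∀ i is → Linked _>_ (i ∷ is) → ∀ {n r p E Y} → i ≤ r → State G n r p E Y → r + p + E ≡ n → 2 ≤ E →
           ∀ δ → δ ≤ caps is → Result n E Y δ is
  extend i [] _ {n} {r} {p} {E} {Y} i≤r F eq 2≤E zero _ = record
    { state = F ; n≡ = sym (+-identityʳ n) ; rpE≡ = eq ; 2≤E′ = 2≤E
    ; E≡ = +-identityʳ (E + 0) ; Y≡ = sym (+-identityʳ Y) }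
  extend i (i′ ∷ is) (i>i′ ∷ lk) {n} {r} {p} {E@(suc E₀)} {Y} i≤r F eq 2≤E δ δ≤ = record
    { state = Result.state rec
    ; n≡ = trans (Result.n≡ rec) (+-assoc n (dim i′) (dims is))
    ; rpE≡ = Result.rpE≡ rec
    ; 2≤E′ = Result.2≤E′ rec
    ; E≡ = E-eq
    ; Y≡ = trans (Result.Y≡ rec) (+-assoc Y (2 ^ i′) (weight is))
    }
    where
    k R q δ′ z : ℕ
    k = r ∸ i′
    q = cap i′ ⊓ δ
    R = cap i′ ∸ q
    δ′ = δ ∸ cap i′
    z = Nat.pred (R + X)
    k≡ : k + i′ ≡ r
    k≡ = m∸n+n≡m (≤-trans (<⇒≤ i>i′) i≤r)
    split≡ : R + X + q ≡ dim i′
    split≡ = trans (lemma R X q) (trans (cong (_+ X) (m∸n+n≡m (m⊓n≤m (cap i′) δ))) (m∸n+n≡m (X≤dim i′)))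
      where
      lemma : ∀ R X q → R + X + q ≡ R + q + X
      lemma = solve-∀
    z≡ : suc z ≡ R + X
    z≡ = suc-pred (R + X) {{>-nonZero (≤-trans (s≤s z≤n) (≤-trans 2≤X (m≤n+m X R)))}}
    F′ : State G n i′ (k + p) E Y
    F′ = halves {G} {n} {i′} {p} {E} {Y} k (subst (λ r → State G n r p E Y) (sym k≡) F)
    F″ : State G (n + dim i′) (suc i′) (k + p + q) (E + z) (Y + 2 ^ i′)
    F″ = attach {G} {n} {dim i′} {i′} {k + p} {q} {E₀} {Y} {z} F′ (fac-cast refl (cong (2 ^_) (sym z≡)) refl (labelled′ i′ R q split≡))
    rec : Result (n + dim i′) (E + z) (Y + 2 ^ i′) δ′ is
    rec = extend i′ is lk (n≤1+n i′) F″ eq′ (≤-trans 2≤E (m≤m+n E z)) δ′ (m≤n+o⇒m∸n≤o δ (cap i′) δ≤)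
      where
      eq′ : suc i′ + (k + p + q) + (E + z) ≡ n + dim i′
      eq′ = trans (lemma i′ k p q E z) (cong₂ _+_ (trans (cong (λ r → r + p + E) k≡) eq) (trans (cong (_+ q) z≡) split≡))
        where
        lemma : ∀ i k p q E z → suc i + (k + p + q) + (E + z) ≡ (k + i + p + E) + (suc z + q)
        lemma = solve-∀
    E-eq : Result.E′ rec + δ + suc (length is) ≡ E + (dim i′ + dims is)
    E-eq = begin
      Result.E′ rec + δ + suc (length is)             ≡⟨ cong (λ d → Result.E′ rec + d + suc (length is)) (m⊓n+n∸m≡n (cap i′) δ) ⟨
      Result.E′ rec + (q + δ′) + suc (length is)      ≡⟨ lemma (Result.E′ rec) q δ′ (length is) ⟩
      (Result.E′ rec + δ′ + length is) + suc q        ≡⟨ cong (_+ suc q) (Result.E≡ rec) ⟩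
      (E + z + dims is) + suc q                            ≡⟨ lemma′ E z (dims is) q ⟩
      E + ((suc z + q) + dims is)                          ≡⟨ cong (λ d → E + (d + dims is)) (trans (cong (_+ q) z≡) split≡) ⟩
      E + (dim i′ + dims is)                               ∎
      where
      open ≡-Reasoning
      lemma : ∀ e q d l → e + (q + d) + suc l ≡ (e + d + l) + suc q
      lemma = solve-∀
      lemma′ : ∀ E z d q → (E + z + d) + suc q ≡ E + ((suc z + q) + d)
      lemma′ = solve-∀

-- From closed walks to cycles, and disjointness by counting

toℕ-next : ∀ {L} (k : Fin L) → toℕ (next k) ≡ suc (toℕ k) ⊎ (suc (toℕ k) ≡ L × toℕ (next k) ≡ 0)
toℕ-next {suc m} k with suc (toℕ k) <? suc m
... | yes p = inj₁ (Fin.toℕ-fromℕ< p)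
... | no ¬p = inj₂ (≤-antisym (Fin.toℕ<n k) (≮⇒≥ ¬p) , refl)

at-next : ∀ {Γ a L} (w : Walk Γ a a) → len w ≡ L → (k : Fin L) → at w (toℕ (next k)) ≡ at w (suc (toℕ k))
at-next w len≡ k with toℕ-next k
... | inj₁ eq          = cong (at w) eq
... | inj₂ (full , eq) = trans (cong (at w) eq) (trans (at-0 w) (trans (sym (at-len w)) (cong (at w) (trans len≡ (sym full)))))

toCycle : ∀ {n L a} (w : Walk (cube n) a a) → Unique (verts w) → len w ≡ L → 3 ≤ L → Cycle n L
toCycle w u len≡ 3≤L = record
  { vert = at w ∘ toℕ
  ; len≥3 = 3≤L
  ; distinct = λ {i} {j} eq → Fin.toℕ-injective (at-injective w u (below i) (below j) eq)
  ; adj = λ k → subst (Adjacent _) (sym (at-next w len≡ k)) (step-adj (at-step w (below k)))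
  }
  where
  below : ∀ i → toℕ i < len w
  below i = subst (toℕ i <_) (sym len≡) (Fin.toℕ<n i)

flip-injective : ∀ {n} (v : Vertex n) {i j} → (v [ i ]%= not) ≡ (v [ j ]%= not) → i ≡ j
flip-injective (b ∷ v) {Fin.zero}  {Fin.zero}  eq = refl
flip-injective (b ∷ v) {Fin.suc i} {Fin.suc j} eq = cong Fin.suc (flip-injective v (Vec.∷-injectiveʳ eq))
flip-injective (b ∷ v) {Fin.zero}  {Fin.suc j} eq = contradiction (sym (Vec.∷-injectiveˡ eq)) (not-¬ refl)
flip-injective (b ∷ v) {Fin.suc i} {Fin.zero}  eq = contradiction (Vec.∷-injectiveˡ eq) (not-¬ refl)

-- Coverage suffices: each oriented edge is hit by some (cycle, position, direction), and by counting by only one.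
module Decompose {n K u R L e : ℕ} (F : Fam (cube n) (Fin K) (Fin u) R L e) (3≤L : 3 ≤ L) (edges≡ : K * u * (L * 2) ≡ 2 ^ n * n) where

  C : Fin (K * u) → Cycle n L
  C c = let b , m = Fin.remQuot u c in toCycle (path F b m) (unique F b m) (size F b m) 3≤L

  Slot : Set
  Slot = Fin (K * u) × Fin L × Bool

  arrow : Slot → Vertex n × Fin n
  arrow (c , k , false) = Cycle.vert (C c) k , proj₁ (Cycle.adj (C c) k)
  arrow (c , k , true)  = Cycle.vert (C c) (next k) , proj₁ (Cycle.adj (C c) k)

  hit : ∀ {a b i} → b ≡ (a [ i ]%= not) → ∀ {c k} →
        SamePair a b (Cycle.vert (C c) k) (Cycle.vert (C c) (next k)) → ∃ λ β → arrow (c , k , β) ≡ (a , i)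
  hit {a} {b} {i} b≡ {c} {k} (inj₁ (refl , refl)) =
    false , cong (a ,_) (flip-injective a (trans (sym (proj₂ (Cycle.adj (C c) k))) b≡))
  hit {a} {b} {i} b≡ {c} {k} (inj₂ (refl , refl)) =
    true , cong (a ,_) (flip-injective a (trans (sym (proj₂ (Adjacent-sym (Cycle.adj (C c) k)))) b≡))

  edgeOf : ∀ {a b i} → (b≡ : b ≡ (a [ i ]%= not)) → ∃ λ c → EdgeOf (edge a b (i , b≡)) (C c)
  edgeOf {i = i} b≡ = let c , k , same = via-remQuot {K} {u} {λ (b , m) → ∃ λ k → Located b m k} located in c , k , same
    where
    Located : Fin K → Fin u → Fin L → Set
    Located b m k = SamePair _ _ (at (path F b m) (toℕ k)) (at (path F b m) (toℕ (next k)))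
    position : ∀ {b m x y} → Step (path F b m) x y →
               ∃ λ k → x ≡ at (path F b m) (toℕ k) × y ≡ at (path F b m) (toℕ (next k))
    position {b} {m} s with step-at s
    ... | j , j< , p , q = k , trans (sym p) (cong (at (path F b m)) (sym k≡)) ,
          trans (sym q) (trans (cong (at (path F b m) ∘ suc) (sym k≡)) (sym (at-next (path F b m) (size F b m) k)))
      where
      j<L : j < L
      j<L = <-≤-trans j< (≤-reflexive (size F b m))
      k : Fin L
      k = Fin.fromℕ< j<L
      k≡ : toℕ k ≡ j
      k≡ = Fin.toℕ-fromℕ< j<L
    located : ∃₂ λ b m → ∃ λ k → Located b m k
    located with cover F (i , b≡)
    ... | b , m , inj₁ s = let k , p , q = position s in b , m , k , inj₁ (p , q)
    ... | b , m , inj₂ s = let k , p , q = position s in b , m , k , inj₂ (q , p)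

  arrow-onto : ∀ y → ∃ λ s → arrow s ≡ y
  arrow-onto (a , i) = let c , k , same = edgeOf refl ; β , eq = hit refl {c} {k} same in (c , k , β) , eq

  arrow-injective : ∀ {s s′} → arrow s ≡ arrow s′ → s ≡ s′
  arrow-injective {s} {s′} eq = trans (sym (strictlyInverseʳ s)) (trans (cong from
    (surjective⇒injective {f = f} onto-f {to s} {to s′}
      (cong code (trans (cong arrow (strictlyInverseʳ s)) (trans eq (cong arrow (sym (strictlyInverseʳ s′))))))))
    (strictlyInverseʳ s′))
    where
    slots : Slot ↔ Fin (2 ^ n * n)
    slots = subst (λ N → Slot ↔ Fin N) edges≡ (×↔Fin (↔-id _) (×↔Fin (↔-id _) (↔-sym Fin.2↔Bool)))
    arrows : (Vertex n × Fin n) ↔ Fin (2 ^ n * n)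
    arrows = ×↔Fin (cube↔Fin n) (↔-id _)
    open Inverse slots using (to; from; strictlyInverseˡ; strictlyInverseʳ)
    code : Vertex n × Fin n → Fin (2 ^ n * n)
    code = Inverse.to arrows
    f : Fin (2 ^ n * n) → Fin (2 ^ n * n)
    f = code ∘ arrow ∘ from
    onto-f : ∀ y → ∃ λ x → f x ≡ y
    onto-f y with arrow-onto (Inverse.from arrows y)
    ... | t , eq′ = to t , trans (cong (code ∘ arrow) (strictlyInverseʳ t)) (trans (cong code eq′) (Inverse.strictlyInverseˡ arrows y))

  decomposition : HasCycleDecomposition n (K * u) L
  decomposition = C , λ { (edge a b (i , b≡)) → edgeOf b≡ , λ c c′ (k , same) (k′ , same′) →
    let β , p = hit b≡ {c} {k} same ; β′ , p′ = hit b≡ {c′} {k′} same′ in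
    cong proj₁ (arrow-injective {c , k , β} {c′ , k′ , β′} (trans p (sym p′))) }

-- Placing q and assembling the decomposition

module Main (x a : ℕ) .{{_ : NonZero x}} where
  open Assemble x a

  -- The first factor alone has to supply the label bits by which the share of special vertices is
  -- adjusted at the next digit; i of them are reserved.
  cap₁ : ℕ → ℕ
  cap₁ i = dim i ∸ (i + X)

  -- Each factor loses X = 2x and the first one also i: this is the bound on q.
  caps≡ : ∀ i is → cap₁ i + caps is + (i + X * suc (length is)) ≡ dims (i ∷ is)
  caps≡ i is = begin
    cap₁ i + caps is + (i + X * suc (length is))      ≡⟨ lemma (cap₁ i) (caps is) i X (length is) ⟩
    (cap₁ i + (i + X)) + (caps is + X * length is)    ≡⟨ cong₂ _+_ (m∸n+n≡m (room i)) (others is) ⟩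
    dim i + dims is                                        ∎
    where
    open ≡-Reasoning
    lemma : ∀ c d i X l → c + d + (i + X * suc l) ≡ (c + (i + X)) + (d + X * l)
    lemma = solve-∀
    others : ∀ is → caps is + X * length is ≡ dims is
    others []       = *-zeroʳ X
    others (k ∷ ks) = trans (lemma′ (cap k) (caps ks) X (length ks)) (cong₂ _+_ (m∸n+n≡m (X≤dim k)) (others ks))
      where
      lemma′ : ∀ c d X l → c + d + X * suc l ≡ (c + X) + (d + X * l)
      lemma′ = solve-∀

  decompose : ∀ i is → Linked _>_ (i ∷ is) → ∀ q → q + i + 2 * x * suc (length is) ≤ dims (i ∷ is) →
              ∃₂ λ E M → HasCycleDecomposition (dims (i ∷ is)) (x * 2 ^ M) (weight (i ∷ is) * 2 ^ suc E) ×
                         suc E + q + length is + i ≡ dims (i ∷ is) × M ≡ i + a + length is + q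
  decompose i is lk q q≤ = Nat.pred E′ , a + (r + p) , answer , E-eq , M-eq
    where
    p₁ e₀ E : ℕ
    p₁ = cap₁ i ⊓ q
    e₀ = cap₁ i ∸ p₁
    E = e₀ + X

    q≤caps : q ≤ cap₁ i + caps is
    q≤caps = +-cancelʳ-≤ (i + X * suc (length is)) q _ (begin
      q + (i + X * suc (length is))       ≡⟨ lemma q i x (length is) ⟩
      q + i + 2 * x * suc (length is)     ≤⟨ q≤ ⟩
      dims (i ∷ is)                            ≡⟨ caps≡ i is ⟨
      cap₁ i + caps is + (i + X * suc (length is)) ∎)
      where
      open ≤-Reasoning
      lemma : ∀ q i x l → q + (i + x * 2 * suc l) ≡ q + i + 2 * x * suc l
      lemma = solve-∀

    p₁≡ : p₁ + e₀ ≡ cap₁ i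
    p₁≡ = trans (+-comm p₁ e₀) (m∸n+n≡m (m⊓n≤m (cap₁ i) q))

    split≡ : p₁ + (E + i) ≡ dim i
    split≡ = trans (lemma p₁ e₀ X i) (trans (cong (_+ (i + X)) p₁≡) (m∸n+n≡m (room i)))
      where
      lemma : ∀ p e X i → p + (e + X + i) ≡ p + e + (i + X)
      lemma = solve-∀

    -- All vertices are special, the share 2^i / 2^i. The e₀ surplus label bits are forgotten, which
    -- raises the multiplicity of each label to 2^E.
    first : State G (dim i) i p₁ E (2 ^ i)
    first = proj₁ (fac-cast refl L≡ (sym (^-split e₀ X)) (fac-forget e₀ (labelled′ i (e₀ + i) p₁ (trans (lemma e₀ i X p₁) split≡))))
      where
      lemma : ∀ e i X p → e + i + X + p ≡ p + (e + X + i)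
      lemma = solve-∀
      L≡ : 2 ^ (e₀ + i + X) ≡ 2 ^ i * 2 ^ E
      L≡ = trans (cong (2 ^_) (lemma′ e₀ i X)) (^-split i E)
        where
        lemma′ : ∀ e i X → e + i + X ≡ i + (e + X)
        lemma′ = solve-∀

    extended : Result (dim i) E (2 ^ i) (q ∸ cap₁ i) is
    extended = extend i is lk ≤-refl first (trans (lemma i p₁ E) split≡) (≤-trans 2≤X (m≤n+m X e₀)) (q ∸ cap₁ i)
               (m≤n+o⇒m∸n≤o q (cap₁ i) q≤caps)
      where
      lemma : ∀ i p E → i + p + E ≡ p + (E + i)
      lemma = solve-∀

    open Result extended

    suc-E : suc (Nat.pred E′) ≡ E′
    suc-E = suc-pred E′ {{>-nonZero (≤-trans (s≤s z≤n) 2≤E′)}}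

    E′≡ : E′ + q + length is + i ≡ dims (i ∷ is)
    E′≡ = begin
      E′ + q + length is + i                                  ≡⟨ cong (λ d → E′ + d + length is + i) (m⊓n+n∸m≡n (cap₁ i) q) ⟨
      E′ + (p₁ + (q ∸ cap₁ i)) + length is + i                ≡⟨ lemma E′ p₁ (q ∸ cap₁ i) (length is) i ⟩
      (E′ + (q ∸ cap₁ i) + length is) + (p₁ + i)              ≡⟨ cong (_+ (p₁ + i)) E≡ ⟩
      (E + dims is) + (p₁ + i)                                     ≡⟨ lemma′ E (dims is) p₁ i ⟩
      (p₁ + (E + i)) + dims is                                     ≡⟨ cong (_+ dims is) split≡ ⟩
      dim i + dims is                                              ∎
      where
      open ≡-Reasoning
      lemma : ∀ e p d l i → e + (p + d) + l + i ≡ (e + d + l) + (p + i)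
      lemma = solve-∀
      lemma′ : ∀ E d p i → (E + d) + (p + i) ≡ (p + (E + i)) + d
      lemma′ = solve-∀

    E-eq : suc (Nat.pred E′) + q + length is + i ≡ dims (i ∷ is)
    E-eq = trans (cong (λ e → e + q + length is + i) suc-E) E′≡

    M-eq : a + (r + p) ≡ i + a + length is + q
    M-eq = +-cancelˡ-≡ E′ _ _ (begin
      E′ + (a + (r + p))                 ≡⟨ lemma E′ a r p ⟩
      a + (r + p + E′)                   ≡⟨ cong (a +_) (trans rpE≡ (trans n≡ (sym E′≡))) ⟩
      a + (E′ + q + length is + i)  ≡⟨ lemma′ a E′ q (length is) i ⟩
      E′ + (i + a + length is + q)  ∎)
      where
      open ≡-Reasoning
      lemma : ∀ e a r p → e + (a + (r + p)) ≡ a + (r + p + e)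
      lemma = solve-∀
      lemma′ : ∀ a e q l i → a + (e + q + l + i) ≡ e + (i + a + l + q)
      lemma′ = solve-∀

    3≤L : 3 ≤ Y′ * 2 ^ E′
    3≤L = begin
      3                          ≤⟨ n≤1+n 3 ⟩
      2 ^ 2                      ≤⟨ ^-monoʳ-≤ 2 2≤E′ ⟩
      2 ^ E′                     ≤⟨ m≤n*m (2 ^ E′) Y′ {{>-nonZero 0<Y′}} ⟩
      Y′ * 2 ^ E′                ∎
      where
      open ≤-Reasoning
      0<Y′ : 0 < Y′
      0<Y′ = subst (0 <_) (sym Y≡) (≤-trans (m^n>0 2 i) (m≤m+n (2 ^ i) (weight is)))

    edges≡ : G * 2 ^ r * 2 ^ p * (Y′ * 2 ^ E′ * 2) ≡ 2 ^ dimension * dimension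
    edges≡ = begin
      G * 2 ^ r * 2 ^ p * (Y′ * 2 ^ E′ * 2)      ≡⟨ lemma G (2 ^ r) (2 ^ p) Y′ (2 ^ E′) ⟩
      2 ^ r * 2 ^ p * 2 ^ E′ * (G * Y′ * 2)      ≡⟨ cong₂ _*_ powers factors ⟩
      2 ^ dimension * dimension                  ∎
      where
      open ≡-Reasoning
      lemma : ∀ g r p y e → g * r * p * (y * e * 2) ≡ r * p * e * (g * y * 2)
      lemma = solve-∀
      powers : 2 ^ r * 2 ^ p * 2 ^ E′ ≡ 2 ^ dimension
      powers = trans (cong (_* 2 ^ E′) (sym (^-split r p))) (trans (sym (^-split (r + p) E′)) (cong (2 ^_) rpE≡))
      factors : G * Y′ * 2 ≡ dimension
      factors = trans (cong (λ y → G * y * 2) Y≡) (trans (sym (dims≡ (i ∷ is))) (sym n≡))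

    count≡ : G * 2 ^ r * 2 ^ p ≡ x * 2 ^ (a + (r + p))
    count≡ = begin
      x * 2 ^ a * 2 ^ r * 2 ^ p      ≡⟨ lemma x (2 ^ a) (2 ^ r) (2 ^ p) ⟩
      x * (2 ^ a * (2 ^ r * 2 ^ p))  ≡⟨ cong (λ z → x * (2 ^ a * z)) (^-split r p) ⟨
      x * (2 ^ a * 2 ^ (r + p))      ≡⟨ cong (x *_) (^-split a (r + p)) ⟨
      x * 2 ^ (a + (r + p))          ∎
      where
      open ≡-Reasoning
      lemma : ∀ x a r p → x * a * r * p ≡ x * (a * (r * p))
      lemma = solve-∀

    answer : HasCycleDecomposition (dims (i ∷ is)) (x * 2 ^ (a + (r + p))) (weight (i ∷ is) * 2 ^ suc (Nat.pred E′))
    answer = subst₂ (λ n m → HasCycleDecomposition n m (weight (i ∷ is) * 2 ^ suc (Nat.pred E′))) n≡ count≡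
      (subst (HasCycleDecomposition dimension (G * 2 ^ r * 2 ^ p)) (cong₂ (λ y e → y * 2 ^ e) Y≡ (sym suc-E))
        (Decompose.decomposition state 3≤L edges≡))

theorem1 : (x y α : ℕ) → Odd x → Odd y → 1 ≤ α →
           (i₁ : ℕ) (rest : List ℕ) →
           Linked _>_ (i₁ ∷ rest) →
           last (i₁ ∷ rest) ≡ just 0 →
           sum (map (2 ^_) (i₁ ∷ rest)) ≡ y →
           let n = x * y * 2 ^ α
               j = length (i₁ ∷ rest)
           in (q : ℕ) → q + i₁ + 2 * x * j ≤ n →
              HasCycleDecomposition n (x * 2 ^ (i₁ + α + j ∸ 2 + q)) (y * 2 ^ (n ∸ i₁ ∸ j ∸ q + 1))
theorem1 zero y α (_ , ()) _ _
theorem1 x@(suc _) y (suc a) _ _ _ i rest lk _ refl q q≤ =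
  adjust (Main.decompose x a i rest lk q (subst (q + i + 2 * x * suc l ≤_) n≡ q≤))
  where
  open Assemble x a
  l : ℕ
  l = length rest
  n≡ : x * y * 2 ^ suc a ≡ dims (i ∷ rest)
  n≡ = trans (lemma x (2 ^ a) y) (sym (dims≡ (i ∷ rest)))
    where
    lemma : ∀ x p y → x * y * (2 * p) ≡ x * p * y * 2
    lemma = solve-∀
  adjust : (∃₂ λ E M → HasCycleDecomposition (dims (i ∷ rest)) (x * 2 ^ M) (y * 2 ^ suc E) ×
                       suc E + q + l + i ≡ dims (i ∷ rest) × M ≡ i + a + l + q) →
           HasCycleDecomposition (x * y * 2 ^ suc a) (x * 2 ^ (i + suc a + suc l ∸ 2 + q))
                                 (y * 2 ^ (x * y * 2 ^ suc a ∸ i ∸ suc l ∸ q + 1))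
  adjust (E , M , C , E≡ , M≡) = subst₂ (λ m e → HasCycleDecomposition (x * y * 2 ^ suc a) (x * 2 ^ m) (y * 2 ^ e)) m≡ e≡
    (subst (λ n → HasCycleDecomposition n (x * 2 ^ M) (y * 2 ^ suc E)) (sym n≡) C)
    where
    -- The 2 is absorbed by α = suc a and j = suc l, so the truncated subtraction is exact; in `e≡`
    -- it is exact as well once n is written as a sum.
    m≡ : M ≡ i + suc a + suc l ∸ 2 + q
    m≡ = trans M≡ (cong (_+ q) (sym (cong (_∸ 2) (lemma i a l))))
      where
      lemma : ∀ i a l → i + suc a + suc l ≡ 2 + (i + a + l)
      lemma = solve-∀
    e≡ : suc E ≡ x * y * 2 ^ suc a ∸ i ∸ suc l ∸ q + 1
    e≡ = sym (begin
      x * y * 2 ^ suc a ∸ i ∸ suc l ∸ q + 1              ≡⟨ cong (λ n → n ∸ i ∸ suc l ∸ q + 1) (trans n≡ (trans (sym E≡) (lemma E q l i))) ⟩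
      i + (suc l + (q + E)) ∸ i ∸ suc l ∸ q + 1          ≡⟨ cong (λ n → n ∸ suc l ∸ q + 1) (m+n∸m≡n i _) ⟩
      suc l + (q + E) ∸ suc l ∸ q + 1                    ≡⟨ cong (λ n → n ∸ q + 1) (m+n∸m≡n (suc l) _) ⟩
      q + E ∸ q + 1                                      ≡⟨ cong (_+ 1) (m+n∸m≡n q E) ⟩
      E + 1                                              ≡⟨ +-comm E 1 ⟩
      suc E                                              ∎)
      where
      open ≡-Reasoning
      lemma : ∀ E q l i → suc E + q + l + i ≡ i + (suc l + (q + E))
      lemma = solve-∀
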